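{- Let $a=a(n)$ be a positive integer (a function of $n$), and consider the $(a:b)$ Maker-Breaker connectivity game on $K_n$ with Breaker moving first. (i) If $a=o\left(\sqrt{\frac{n}{\ln n}}\right)$, then the asymptotically optimal threshold bias for the connectivity game is $\frac{an}{a+\ln n}$. (ii) If $a=\Omega\left(\sqrt{\frac{n}{\ln n}}\right)$, then the asymptotically optimal threshold bias for the connectivity game is $n$.
   Context: The $(a:b)$ Maker-Breaker connectivity game on $K_n$: the board is the edge set of the complete graph $K_n$ on $n$ vertices. In each round Breaker first claims $b$ previously unclaimed edges, then Maker claims $a$ previously unclaimed edges (if fewer edges remain, a player claims all remaining ones). Maker wins if at the end of the game his edges contain a connected spanning subgraph of $K_n$ (equivalently a spanning tree); otherwise Breaker wins. A function $\beta(n)$ is the asymptotically optimal threshold bias if for every $\varepsilon>0$ there is $n_0$ such that for every $n\ge n_0$: Maker has a winning strategy for every positive integer $b\le(1-\varepsilon)\beta(n)$, and Breaker has a winning strategy for every integer $b\ge(1+\varepsilon)\beta(n)$. -}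

module Defs where

open import Data.Nat as ℕ using (ℕ; zero; suc; z≤n; s≤s)
import Data.Nat.Properties as ℕ
open import Data.Integer as ℤ using (+_)
import Data.Integer.Properties as ℤ
open import Data.Rational as ℚ using (ℚ; 0ℚ; 1ℚ; ½; mkℚ; toℚᵘ)
import Data.Rational.Properties as ℚ
open import Data.Rational.Solver using (module +-*-Solver)
import Data.Rational.Unnormalised as ℚᵘ
import Data.Rational.Unnormalised.Properties as ℚᵘ
open import Data.Fin as Fin using (Fin)
open import Data.List using (List; []; length; _++_)
open import Data.List.Membership.Propositional using (_∈_; _∉_)
open import Data.List.Relation.Binary.Subset.Propositional using (_⊆_)
open import Data.List.Relation.Unary.All using (All)
open import Data.List.Relation.Unary.Unique.Propositional using (Unique)
open import Data.Product using (∃-syntax; _×_; _,_; proj₁; proj₂)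
open import Data.Sum using (_⊎_; inj₁; inj₂)
open import Relation.Binary.Construct.Closure.ReflexiveTransitive using (Star)
open import Relation.Binary.PropositionalEquality
open import Relation.Nullary using (¬_; yes; no)

------------------------------------------------------------------------
-- Rational arithmetic

module Rational where
  open import Data.Rational using (_+_; _*_; _-_; -_; _≤_; _<_; ∣_∣)
  open +-*-Solver

  fromℕ : ℕ → ℚ
  fromℕ n = + n ℚ./ 1

  -- recip n = 1 / (n + 1)
  recip : ℕ → ℚ
  recip n = + 1 ℚ./ suc n

  toℚᵘ-/ : ∀ i n → toℚᵘ (i ℚ./ suc n) ℚᵘ.≃ ℚᵘ.mkℚᵘ i n
  toℚᵘ-/ i n = ℚ.toℚᵘ-fromℚᵘ (ℚᵘ.mkℚᵘ i n)

  /-mono-≤ : ∀ i j m n → i ℤ.* + suc n ℤ.≤ j ℤ.* + suc m →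
             i ℚ./ suc m ≤ j ℚ./ suc n
  /-mono-≤ i j m n h = ℚ.toℚᵘ-cancel-≤
    (ℚᵘ.≤-respˡ-≃ (ℚᵘ.≃-sym (toℚᵘ-/ i m))
      (ℚᵘ.≤-respʳ-≃ (ℚᵘ.≃-sym (toℚᵘ-/ j n)) (ℚᵘ.*≤* h)))

  fromℕ-mono : ∀ {m n} → m ℕ.≤ n → fromℕ m ≤ fromℕ n
  fromℕ-mono {m} {n} h = /-mono-≤ (+ m) (+ n) 0 0
    (subst₂ ℤ._≤_ (sym (ℤ.*-identityʳ (+ m))) (sym (ℤ.*-identityʳ (+ n))) (ℤ.+≤+ h))

  fromℕ-+ : ∀ m n → fromℕ (m ℕ.+ n) ≡ fromℕ m + fromℕ n
  fromℕ-+ m n = ℚ.toℚᵘ-injective (begin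
    toℚᵘ (fromℕ (m ℕ.+ n))                ≈⟨ toℚᵘ-/ (+ (m ℕ.+ n)) 0 ⟩
    ℚᵘ.mkℚᵘ (+ (m ℕ.+ n)) 0               ≈⟨ ℚᵘ.*≡* (cong (ℤ._* + 1)
      (cong₂ ℤ._+_ (sym (ℤ.*-identityʳ (+ m))) (sym (ℤ.*-identityʳ (+ n))))) ⟩
    ℚᵘ.mkℚᵘ (+ m) 0 ℚᵘ.+ ℚᵘ.mkℚᵘ (+ n) 0  ≈⟨ ℚᵘ.+-cong (toℚᵘ-/ (+ m) 0) (toℚᵘ-/ (+ n) 0) ⟨
    toℚᵘ (fromℕ m) ℚᵘ.+ toℚᵘ (fromℕ n)    ≈⟨ ℚ.toℚᵘ-homo-+ (fromℕ m) (fromℕ n) ⟨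
    toℚᵘ (fromℕ m + fromℕ n)              ∎)
    where open ℚᵘ.≃-Reasoning

  fromℕ-* : ∀ m n → fromℕ (m ℕ.* n) ≡ fromℕ m * fromℕ n
  fromℕ-* m n = ℚ.toℚᵘ-injective (begin
    toℚᵘ (fromℕ (m ℕ.* n))                ≈⟨ toℚᵘ-/ (+ (m ℕ.* n)) 0 ⟩
    ℚᵘ.mkℚᵘ (+ (m ℕ.* n)) 0               ≈⟨ ℚᵘ.*≡* (cong (ℤ._* + 1) (ℤ.pos-* m n)) ⟩
    ℚᵘ.mkℚᵘ (+ m) 0 ℚᵘ.* ℚᵘ.mkℚᵘ (+ n) 0  ≈⟨ ℚᵘ.*-cong (toℚᵘ-/ (+ m) 0) (toℚᵘ-/ (+ n) 0) ⟨
    toℚᵘ (fromℕ m) ℚᵘ.* toℚᵘ (fromℕ n)    ≈⟨ ℚ.toℚᵘ-homo-* (fromℕ m) (fromℕ n) ⟨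
    toℚᵘ (fromℕ m * fromℕ n)              ∎)
    where open ℚᵘ.≃-Reasoning

  n/d*d≡n : ∀ n d → (+ n ℚ./ suc d) * fromℕ (suc d) ≡ fromℕ n
  n/d*d≡n n d = ℚ.toℚᵘ-injective (begin
    toℚᵘ ((+ n ℚ./ suc d) * fromℕ (suc d))          ≈⟨ ℚ.toℚᵘ-homo-* (+ n ℚ./ suc d) (fromℕ (suc d)) ⟩
    toℚᵘ (+ n ℚ./ suc d) ℚᵘ.* toℚᵘ (fromℕ (suc d))  ≈⟨ ℚᵘ.*-cong (toℚᵘ-/ (+ n) d) (toℚᵘ-/ (+ suc d) 0) ⟩
    ℚᵘ.mkℚᵘ (+ n) d ℚᵘ.* ℚᵘ.mkℚᵘ (+ suc d) 0        ≈⟨ ℚᵘ.*≡* (trans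
      (ℤ.*-identityʳ (+ n ℤ.* + suc d))
      (cong (λ k → + n ℤ.* + k) (sym (ℕ.*-identityʳ (suc d))))) ⟩
    ℚᵘ.mkℚᵘ (+ n) 0                                 ≈⟨ toℚᵘ-/ (+ n) 0 ⟨
    toℚᵘ (fromℕ n)                                  ∎)
    where open ℚᵘ.≃-Reasoning

  recip*suc : ∀ n → recip n * fromℕ (suc n) ≡ 1ℚ
  recip*suc n = n/d*d≡n 1 n

  recip-antimono : ∀ {m n} → m ℕ.≤ n → recip n ≤ recip m
  recip-antimono {m} {n} h = /-mono-≤ (+ 1) (+ 1) n m
    (subst₂ ℤ._≤_ (sym (ℤ.*-identityˡ (+ suc m))) (sym (ℤ.*-identityˡ (+ suc n)))
      (ℤ.+≤+ (s≤s h)))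

  0<recip : ∀ n → 0ℚ < recip n
  0<recip n = ℚ.positive⁻¹ (recip n) {{ℚ.normalize-pos 1 (suc n)}}

  0≤/ : ∀ n d → 0ℚ ≤ + n ℚ./ suc d
  0≤/ n d = ℚ.nonNegative⁻¹ (+ n ℚ./ suc d) {{ℚ.normalize-nonNeg n (suc d)}}

  0<fromℕ : ∀ n → 0ℚ < fromℕ (suc n)
  0<fromℕ n = ℚ.positive⁻¹ (fromℕ (suc n)) {{ℚ.normalize-pos (suc n) 1}}

  archimedean : ∀ ε → 0ℚ < ε → ∃[ N ] ∀ m → N ℕ.≤ m → recip m ≤ ε
  archimedean (mkℚ (+ zero) d c) (ℚ.*<* (ℤ.+<+ ()))
  archimedean (mkℚ ℤ.-[1+ n ] d c) (ℚ.*<* ())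
  archimedean ε@(mkℚ (+ suc p) d c) 0<ε = d , λ m d≤m →
    ℚ.toℚᵘ-cancel-≤ {recip m} {ε} (ℚᵘ.≤-respˡ-≃ (ℚᵘ.≃-sym (toℚᵘ-/ (+ 1) m))
      (ℚᵘ.*≤* (subst (ℤ._≤ + suc p ℤ.* + suc m) (sym (ℤ.*-identityˡ (+ suc d)))
        (ℤ.+≤+ (ℕ.≤-trans (s≤s d≤m) (ℕ.m≤m+n (suc m) (p ℕ.* suc m)))))))

  p≤∣p∣ : ∀ p → p ≤ ∣ p ∣
  p≤∣p∣ p with ℚ.≤-total 0ℚ p
  ... | inj₁ 0≤p = ℚ.≤-reflexive (sym (ℚ.0≤p⇒∣p∣≡p 0≤p))
  ... | inj₂ p≤0 = ℚ.≤-trans p≤0 (ℚ.0≤∣p∣ p)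

  ∣p-q∣≤ε⇒p≤q+ε : ∀ p q {ε} → ∣ p - q ∣ ≤ ε → p ≤ q + ε
  ∣p-q∣≤ε⇒p≤q+ε p q h = ℚ.≤-trans
    (ℚ.≤-reflexive (solve 2 (λ p q → p := q :+ (p :- q)) refl p q))
    (ℚ.+-monoʳ-≤ q (ℚ.≤-trans (p≤∣p∣ (p - q)) h))

  p≤q+ε⇒p-q≤ε : ∀ p q {ε} → p ≤ q + ε → p - q ≤ ε
  p≤q+ε⇒p-q≤ε p q {ε} h = ℚ.≤-trans (ℚ.+-monoˡ-≤ (- q) h)
    (ℚ.≤-reflexive (solve 2 (λ q e → (q :+ e) :- q := e) refl q ε))

  ∣p-q∣≤ε : ∀ p q {ε} → p ≤ q + ε → q ≤ p + ε → ∣ p - q ∣ ≤ ε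
  ∣p-q∣≤ε p q h₁ h₂ with ℚ.∣p∣≡p∨∣p∣≡-p (p - q)
  ... | inj₁ eq = ℚ.≤-trans (ℚ.≤-reflexive eq) (p≤q+ε⇒p-q≤ε p q h₁)
  ... | inj₂ eq = ℚ.≤-trans
    (ℚ.≤-reflexive (trans eq (solve 2 (λ p q → :- (p :- q) := q :- p) refl p q)))
    (p≤q+ε⇒p-q≤ε q p h₂)

  0<p*q : ∀ {p q} → 0ℚ < p → 0ℚ < q → 0ℚ < p * q
  0<p*q {p} {q} 0<p 0<q = ℚ.positive⁻¹ (p * q)
    {{ℚ.pos*pos⇒pos p {{ℚ.positive 0<p}} q {{ℚ.positive 0<q}}}}

  0≤p*q : ∀ {p q} → 0ℚ ≤ p → 0ℚ ≤ q → 0ℚ ≤ p * q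
  0≤p*q {p} {q} 0≤p 0≤q = ℚ.nonNegative⁻¹ (p * q)
    {{ℚ.nonNeg*nonNeg⇒nonNeg p {{ℚ.nonNegative 0≤p}} q {{ℚ.nonNegative 0≤q}}}}

  *-mono-≤ : ∀ {p q r s} → 0ℚ ≤ q → 0ℚ ≤ r → p ≤ q → r ≤ s → p * r ≤ q * s
  *-mono-≤ {p} {q} {r} {s} 0≤q 0≤r p≤q r≤s = ℚ.≤-trans
    (ℚ.*-monoʳ-≤-nonNeg r {{ℚ.nonNegative 0≤r}} p≤q)
    (ℚ.*-monoˡ-≤-nonNeg q {{ℚ.nonNegative 0≤q}} r≤s)

  p+½ε+½ε : ∀ p ε → (p + ½ * ε) + ½ * ε ≡ p + ε
  p+½ε+½ε p ε = solve 2 (λ p e → (p :+ con ½ :* e) :+ con ½ :* e := p :+ e) refl p ε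

  0<½ : 0ℚ < ½
  0<½ = ℚ.positive⁻¹ ½

  ∑< : ℕ → (ℕ → ℚ) → ℚ
  ∑< zero    f = 0ℚ
  ∑< (suc n) f = ∑< n f + f n

  ∑-mono : ∀ n {f g} → (∀ i → i ℕ.< n → f i ≤ g i) → ∑< n f ≤ ∑< n g
  ∑-mono zero    h = ℚ.≤-refl
  ∑-mono (suc n) h = ℚ.+-mono-≤
    (∑-mono n (λ i i<n → h i (ℕ.m<n⇒m<1+n i<n))) (h n (ℕ.n<1+n n))

  ∑-const : ∀ n c → ∑< n (λ _ → c) ≡ fromℕ n * c
  ∑-const zero    c = sym (ℚ.*-zeroˡ c)
  ∑-const (suc n) c = begin
    ∑< n (λ _ → c) + c       ≡⟨ cong (_+ c) (∑-const n c) ⟩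
    fromℕ n * c + c          ≡⟨ solve 2 (λ x c → x :* c :+ c := (con 1ℚ :+ x) :* c) refl (fromℕ n) c ⟩
    (fromℕ 1 + fromℕ n) * c  ≡⟨ cong (_* c) (fromℕ-+ 1 n) ⟨
    fromℕ (suc n) * c        ∎
    where open ≡-Reasoning

  ∑-+ : ∀ m n f → ∑< (m ℕ.+ n) f ≡ ∑< m f + ∑< n (λ i → f (m ℕ.+ i))
  ∑-+ m zero f = trans (cong (λ k → ∑< k f) (ℕ.+-identityʳ m)) (sym (ℚ.+-identityʳ _))
  ∑-+ m (suc n) f = begin
    ∑< (m ℕ.+ suc n) f                                  ≡⟨ cong (λ k → ∑< k f) (ℕ.+-suc m n) ⟩
    ∑< (m ℕ.+ n) f + f (m ℕ.+ n)                        ≡⟨ cong (_+ f (m ℕ.+ n)) (∑-+ m n f) ⟩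
    ∑< m f + ∑< n (λ i → f (m ℕ.+ i)) + f (m ℕ.+ n)     ≡⟨ ℚ.+-assoc (∑< m f) _ _ ⟩
    ∑< m f + (∑< n (λ i → f (m ℕ.+ i)) + f (m ℕ.+ n))   ∎
    where open ≡-Reasoning

  ∑-blocks : ∀ n k f → ∑< (n ℕ.* k) f ≡ ∑< n (λ j → ∑< k (λ r → f (j ℕ.* k ℕ.+ r)))
  ∑-blocks zero    k f = refl
  ∑-blocks (suc n) k f = begin
    ∑< (k ℕ.+ n ℕ.* k) f                               ≡⟨ cong (λ m → ∑< m f) (ℕ.+-comm k (n ℕ.* k)) ⟩
    ∑< (n ℕ.* k ℕ.+ k) f                               ≡⟨ ∑-+ (n ℕ.* k) k f ⟩
    ∑< (n ℕ.* k) f + ∑< k (λ r → f (n ℕ.* k ℕ.+ r))    ≡⟨ cong (_+ ∑< k (λ r → f (n ℕ.* k ℕ.+ r))) (∑-blocks n k f) ⟩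
    ∑< n (λ j → ∑< k (λ r → f (j ℕ.* k ℕ.+ r))) + ∑< k (λ r → f (n ℕ.* k ℕ.+ r)) ∎
    where open ≡-Reasoning

------------------------------------------------------------------------
-- Riemann sums for ∫ dx/x

module RiemannSum where
  open import Data.Rational using (_+_; _*_; _≤_; _<_)
  open Rational

  -- The right (lower) and left (upper) Riemann sums of 1/x over
  -- [1 , 1 + K] with mesh 1/m:  Σ (1/m) · 1/(1 + (i+1)/m) = Σ 1/(m+i+1),
  -- and likewise Σ 1/(m+i), where here m = suc m′.
  lower : ℕ → ℕ → ℚ
  lower K m = ∑< (K ℕ.* m) (λ i → recip (m ℕ.+ i))

  upper : ℕ → ℕ → ℚ
  upper K m′ = ∑< (K ℕ.* suc m′) (λ i → recip (m′ ℕ.+ i))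

  lower≤upper : ∀ K m′ → lower K (suc m′) ≤ upper K m′
  lower≤upper K m′ = ∑-mono (K ℕ.* suc m′) (λ i _ → recip-antimono (ℕ.n≤1+n (m′ ℕ.+ i)))

  telescope : ∀ N x → ∑< N (λ i → recip (x ℕ.+ i)) + recip (x ℕ.+ N)
                      ≡ recip x + ∑< N (λ i → recip (suc x ℕ.+ i))
  telescope zero x = trans (ℚ.+-identityˡ _)
    (trans (cong recip (ℕ.+-identityʳ x)) (sym (ℚ.+-identityʳ _)))
  telescope (suc N) x = begin
    ∑< N (λ i → recip (x ℕ.+ i)) + recip (x ℕ.+ N) + recip (x ℕ.+ suc N)
      ≡⟨ cong₂ _+_ (telescope N x) (cong recip (ℕ.+-suc x N)) ⟩
    recip x + ∑< N (λ i → recip (suc x ℕ.+ i)) + recip (suc x ℕ.+ N)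
      ≡⟨ ℚ.+-assoc (recip x) _ _ ⟩
    recip x + (∑< N (λ i → recip (suc x ℕ.+ i)) + recip (suc x ℕ.+ N)) ∎
    where open ≡-Reasoning

  upper≤lower+ : ∀ K m′ → upper K m′ ≤ lower K (suc m′) + recip m′
  upper≤lower+ K m′ = begin
    upper K m′                                  ≡⟨ ℚ.+-identityʳ (upper K m′) ⟨
    upper K m′ + 0ℚ                             ≤⟨ ℚ.+-monoʳ-≤ (upper K m′) (ℚ.<⇒≤ (0<recip (m′ ℕ.+ K ℕ.* suc m′))) ⟩
    upper K m′ + recip (m′ ℕ.+ K ℕ.* suc m′)    ≡⟨ telescope (K ℕ.* suc m′) m′ ⟩
    recip m′ + lower K (suc m′)                 ≡⟨ ℚ.+-comm (recip m′) (lower K (suc m′)) ⟩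
    lower K (suc m′) + recip m′                 ∎
    where open ℚ.≤-Reasoning

  k*recip : ∀ k′ x → fromℕ (suc k′) * recip (x ℕ.+ k′ ℕ.* suc x) ≡ recip x
  k*recip k′ x = begin
    A * R                     ≡⟨ ℚ.*-identityʳ (A * R) ⟨
    A * R * 1ℚ                ≡⟨ cong (A * R *_) (recip*suc x) ⟨
    A * R * (recip x * X)     ≡⟨ solve 4 (λ a r s x → a :* r :* (s :* x) := r :* (a :* x) :* s) refl A R (recip x) X ⟩
    R * (A * X) * recip x     ≡⟨ cong (λ z → R * z * recip x) (fromℕ-* (suc k′) (suc x)) ⟨
    R * fromℕ (suc k′ ℕ.* suc x) * recip x ≡⟨ cong (_* recip x) (recip*suc (x ℕ.+ k′ ℕ.* suc x)) ⟩
    1ℚ * recip x              ≡⟨ ℚ.*-identityˡ (recip x) ⟩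
    recip x                   ∎
    where
    open ≡-Reasoning
    open +-*-Solver
    A = fromℕ (suc k′)
    X = fromℕ (suc x)
    R = recip (x ℕ.+ k′ ℕ.* suc x)

  regroup : ∀ K m k f → ∑< (K ℕ.* (m ℕ.* k)) f
                        ≡ ∑< (K ℕ.* m) (λ j → ∑< k (λ r → f (j ℕ.* k ℕ.+ r)))
  regroup K m k f = trans (cong (λ N → ∑< N f) (sym (ℕ.*-assoc K m k))) (∑-blocks (K ℕ.* m) k f)

  lower-refine : ∀ K m k′ → lower K m ≤ lower K (m ℕ.* suc k′)
  lower-refine K m k′ = begin
    ∑< (K ℕ.* m) (λ j → recip (m ℕ.+ j))
      ≤⟨ ∑-mono (K ℕ.* m) block ⟩
    ∑< (K ℕ.* m) (λ j → ∑< k (λ r → recip (m ℕ.* k ℕ.+ (j ℕ.* k ℕ.+ r))))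
      ≡⟨ regroup K m k (λ i → recip (m ℕ.* k ℕ.+ i)) ⟨
    lower K (m ℕ.* k) ∎
    where
    open ℚ.≤-Reasoning
    k = suc k′
    index : ∀ j r → r ℕ.< k → m ℕ.* k ℕ.+ (j ℕ.* k ℕ.+ r) ℕ.≤ (m ℕ.+ j) ℕ.+ k′ ℕ.* suc (m ℕ.+ j)
    index j r r<k = ℕ.≤-pred (subst₂ ℕ._≤_
      (trans (ℕ.+-suc _ r) (cong suc (trans (cong (ℕ._+ r) (ℕ.*-distribʳ-+ k m j)) (ℕ.+-assoc (m ℕ.* k) (j ℕ.* k) r))))
      (trans (ℕ.+-comm ((m ℕ.+ j) ℕ.* k) k) (ℕ.*-comm (suc (m ℕ.+ j)) k))
      (ℕ.+-monoʳ-≤ ((m ℕ.+ j) ℕ.* k) r<k))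
    block : ∀ j → j ℕ.< K ℕ.* m → recip (m ℕ.+ j) ≤ ∑< k (λ r → recip (m ℕ.* k ℕ.+ (j ℕ.* k ℕ.+ r)))
    block j _ = begin
      recip (m ℕ.+ j)                                                ≡⟨ k*recip k′ (m ℕ.+ j) ⟨
      fromℕ k * recip ((m ℕ.+ j) ℕ.+ k′ ℕ.* suc (m ℕ.+ j))           ≡⟨ ∑-const k _ ⟨
      ∑< k (λ _ → recip ((m ℕ.+ j) ℕ.+ k′ ℕ.* suc (m ℕ.+ j)))        ≤⟨ ∑-mono k (λ r r<k → recip-antimono (index j r r<k)) ⟩
      ∑< k (λ r → recip (m ℕ.* k ℕ.+ (j ℕ.* k ℕ.+ r)))               ∎

  -- Here suc (k′ + m′ * suc k′) = suc m′ * suc k′ definitionally.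
  upper-refine : ∀ K m′ k′ → upper K (k′ ℕ.+ m′ ℕ.* suc k′) ≤ upper K m′
  upper-refine K m′ k′ = begin
    upper K M′
      ≡⟨ regroup K (suc m′) k (λ i → recip (M′ ℕ.+ i)) ⟩
    ∑< (K ℕ.* suc m′) (λ j → ∑< k (λ r → recip (M′ ℕ.+ (j ℕ.* k ℕ.+ r))))
      ≤⟨ ∑-mono (K ℕ.* suc m′) block ⟩
    upper K m′ ∎
    where
    open ℚ.≤-Reasoning
    k = suc k′
    M′ = k′ ℕ.+ m′ ℕ.* suc k′
    index : ∀ j r → (m′ ℕ.+ j) ℕ.+ k′ ℕ.* suc (m′ ℕ.+ j) ℕ.≤ M′ ℕ.+ (j ℕ.* k ℕ.+ r)
    index j r = ℕ.≤-pred (subst₂ ℕ._≤_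
      (ℕ.*-comm (suc (m′ ℕ.+ j)) k)
      (trans (cong (λ z → k ℕ.+ z ℕ.+ r) (ℕ.*-distribʳ-+ k m′ j))
        (trans (cong (ℕ._+ r) (sym (ℕ.+-assoc k (m′ ℕ.* k) (j ℕ.* k))))
               (ℕ.+-assoc (k ℕ.+ m′ ℕ.* k) (j ℕ.* k) r)))
      (ℕ.m≤m+n (suc (m′ ℕ.+ j) ℕ.* k) r))
    block : ∀ j → j ℕ.< K ℕ.* suc m′ → ∑< k (λ r → recip (M′ ℕ.+ (j ℕ.* k ℕ.+ r))) ≤ recip (m′ ℕ.+ j)
    block j _ = begin
      ∑< k (λ r → recip (M′ ℕ.+ (j ℕ.* k ℕ.+ r)))                      ≤⟨ ∑-mono k (λ r _ → recip-antimono (index j r)) ⟩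
      ∑< k (λ _ → recip ((m′ ℕ.+ j) ℕ.+ k′ ℕ.* suc (m′ ℕ.+ j)))        ≡⟨ ∑-const k _ ⟩
      fromℕ k * recip ((m′ ℕ.+ j) ℕ.+ k′ ℕ.* suc (m′ ℕ.+ j))           ≡⟨ k*recip k′ (m′ ℕ.+ j) ⟩
      recip (m′ ℕ.+ j)                                                 ∎

  lower-close : ∀ K m′ k′ → lower K (suc m′) ≤ lower K (suc k′) + recip k′
  lower-close K m′ k′ = begin
    lower K (suc m′)                          ≤⟨ lower-refine K (suc m′) k′ ⟩
    lower K (suc m′ ℕ.* suc k′)               ≡⟨ cong (lower K) (ℕ.*-comm (suc m′) (suc k′)) ⟩
    lower K (suc (m′ ℕ.+ k′ ℕ.* suc m′))      ≤⟨ lower≤upper K (m′ ℕ.+ k′ ℕ.* suc m′) ⟩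
    upper K (m′ ℕ.+ k′ ℕ.* suc m′)            ≤⟨ upper-refine K k′ m′ ⟩
    upper K k′                                ≤⟨ upper≤lower+ K k′ ⟩
    lower K (suc k′) + recip k′               ∎
    where open ℚ.≤-Reasoning

  0≤lower : ∀ K m → 0ℚ ≤ lower K m
  0≤lower K m = begin
    0ℚ                           ≡⟨ ℚ.*-zeroʳ (fromℕ (K ℕ.* m)) ⟨
    fromℕ (K ℕ.* m) * 0ℚ         ≡⟨ ∑-const (K ℕ.* m) 0ℚ ⟨
    ∑< (K ℕ.* m) (λ _ → 0ℚ)      ≤⟨ ∑-mono (K ℕ.* m) (λ i _ → ℚ.<⇒≤ (0<recip (m ℕ.+ i))) ⟩
    lower K m                    ∎
    where open ℚ.≤-Reasoning

  recip≤lower : ∀ K′ m′ → recip (suc K′) ≤ lower (suc K′) (suc m′)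
  recip≤lower K′ m′ = begin
    recip K                       ≡⟨ k*recip m′ K ⟨
    fromℕ m * c                   ≤⟨ ℚ.*-monoʳ-≤-nonNeg c {{ℚ.nonNegative (ℚ.<⇒≤ (0<recip (K ℕ.+ m′ ℕ.* suc K)))}}
                                       (fromℕ-mono (ℕ.m≤m+n m (K′ ℕ.* m))) ⟩
    fromℕ (K ℕ.* m) * c           ≡⟨ ∑-const (K ℕ.* m) c ⟨
    ∑< (K ℕ.* m) (λ _ → c)        ≤⟨ ∑-mono (K ℕ.* m) (λ i i<Km → recip-antimono (index i i<Km)) ⟩
    lower K m                     ∎
    where
    open ℚ.≤-Reasoning
    K = suc K′
    m = suc m′
    c = recip (K ℕ.+ m′ ℕ.* suc K)
    index : ∀ i → i ℕ.< K ℕ.* m → m ℕ.+ i ℕ.≤ K ℕ.+ m′ ℕ.* suc K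
    index i h = ℕ.≤-pred (subst₂ ℕ._≤_ (ℕ.+-suc m i) (ℕ.*-comm (suc K) m) (ℕ.+-monoʳ-≤ m h))

------------------------------------------------------------------------
-- Rational approximations of square roots

module SquareRoot where
  open import Data.Rational using (_+_; _*_; _≤_; _<_; ↥_; ↧ₙ_)
  open Rational

  -- isqrt n = ⌊√n⌋
  isqrt : ℕ → ℕ
  isqrt zero    = zero
  isqrt (suc n) = step (isqrt n)
    module ISqrt where
    step : ℕ → ℕ
    step r with suc r ℕ.* suc r ℕ.≤? suc n
    ... | yes _ = suc r
    ... | no  _ = r

  isqrt² : ∀ n → isqrt n ℕ.* isqrt n ℕ.≤ n × n ℕ.< suc (isqrt n) ℕ.* suc (isqrt n)
  isqrt² zero = z≤n , s≤s z≤n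
  isqrt² (suc n) = step² (isqrt n) (isqrt² n)
    where
    step² : ∀ r → r ℕ.* r ℕ.≤ n × n ℕ.< suc r ℕ.* suc r →
            let s = ISqrt.step n r in s ℕ.* s ℕ.≤ suc n × suc n ℕ.< suc s ℕ.* suc s
    step² r (lo , hi) with suc r ℕ.* suc r ℕ.≤? suc n
    ... | yes h = h , ℕ.≤-<-trans hi (ℕ.*-mono-< (ℕ.n<1+n (suc r)) (ℕ.n<1+n (suc r)))
    ... | no ¬h = ℕ.≤-trans lo (ℕ.n≤1+n n) , ℕ.≰⇒> ¬h

  -- With q = p/d in lowest terms and m = suc m′, this is ⌊√(p d m²)⌋ / (d m),
  -- the root of q rounded down to a multiple of 1/(d m).
  approx : ℕ → ℚ → ℚ
  approx m′ q@(mkℚ p d-1 _) =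
    + isqrt (ℤ.∣ p ∣ ℕ.* suc d-1 ℕ.* (suc m′ ℕ.* suc m′)) ℚ./ (suc d-1 ℕ.* suc m′)

  0≤approx : ∀ m′ q → 0ℚ ≤ approx m′ q
  0≤approx m′ (mkℚ p d-1 _) =
    0≤/ (isqrt (ℤ.∣ p ∣ ℕ.* suc d-1 ℕ.* (suc m′ ℕ.* suc m′))) (m′ ℕ.+ d-1 ℕ.* suc m′)

  *-cancel-≤ : ∀ {p q} d → p * fromℕ (suc d) ≤ q * fromℕ (suc d) → p ≤ q
  *-cancel-≤ d = ℚ.*-cancelʳ-≤-pos (fromℕ (suc d)) {{ℚ.positive (0<fromℕ d)}}

  *-cancel-< : ∀ {p q} d → p * fromℕ (suc d) < q * fromℕ (suc d) → p < q
  *-cancel-< d = ℚ.*-cancelʳ-<-nonNeg (fromℕ (suc d)) {{ℚ.nonNegative (ℚ.<⇒≤ (0<fromℕ d))}}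

  q*d≡p : ∀ q → 0ℚ ≤ q → q * fromℕ (↧ₙ q) ≡ fromℕ ℤ.∣ ↥ q ∣
  q*d≡p q@(mkℚ (+ n) d-1 _) _ = trans
    (cong (_* fromℕ (suc d-1)) (sym (ℚ.↥p/↧p≡p q))) (n/d*d≡n n d-1)
  q*d≡p (mkℚ ℤ.-[1+ n ] d-1 _) (ℚ.*≤* ())

  approx² : ∀ m′ q → 0ℚ ≤ q →
    approx m′ q * approx m′ q ≤ q ×
    q < (approx m′ q + recip m′) * (approx m′ q + recip m′)
  approx² m′ q@(mkℚ p d-1 _) 0≤q = lo , hi
    where
    open ℚ.≤-Reasoning
    open +-*-Solver
    m = suc m′
    d = suc d-1
    N = ℤ.∣ p ∣ ℕ.* d ℕ.* (m ℕ.* m)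
    k = isqrt N
    s = approx m′ q
    M = fromℕ m
    D = fromℕ d
    E-1 = m′ ℕ.+ d-1 ℕ.* m
    E = fromℕ (d ℕ.* m)
    E≡ : E ≡ D * M
    E≡ = fromℕ-* d m
    sE : s * E ≡ fromℕ k
    sE = n/d*d≡n k E-1
    qEE : q * E * E ≡ fromℕ N
    qEE = begin-equality
      q * E * E                          ≡⟨ cong (λ e → q * e * e) E≡ ⟩
      q * (D * M) * (D * M)              ≡⟨ solve 3 (λ q d m → q :* (d :* m) :* (d :* m) := q :* d :* d :* (m :* m)) refl q D M ⟩
      q * D * D * (M * M)                ≡⟨ cong (λ z → z * D * (M * M)) (q*d≡p q 0≤q) ⟩
      fromℕ ℤ.∣ p ∣ * D * (M * M)        ≡⟨ cong₂ _*_ (fromℕ-* ℤ.∣ p ∣ d) (fromℕ-* m m) ⟨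
      fromℕ (ℤ.∣ p ∣ ℕ.* d) * fromℕ (m ℕ.* m) ≡⟨ fromℕ-* (ℤ.∣ p ∣ ℕ.* d) (m ℕ.* m) ⟨
      fromℕ N                            ∎
    lo : s * s ≤ q
    lo = *-cancel-≤ E-1 (*-cancel-≤ E-1 (begin
      s * s * E * E         ≡⟨ solve 2 (λ s e → s :* s :* e :* e := (s :* e) :* (s :* e)) refl s E ⟩
      (s * E) * (s * E)     ≡⟨ cong₂ _*_ sE sE ⟩
      fromℕ k * fromℕ k     ≡⟨ fromℕ-* k k ⟨
      fromℕ (k ℕ.* k)       ≤⟨ fromℕ-mono (proj₁ (isqrt² N)) ⟩
      fromℕ N               ≡⟨ qEE ⟨
      q * E * E             ∎))
    t = s + recip m′
    k+1≤tE : fromℕ (suc k) ≤ t * E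
    k+1≤tE = begin
      fromℕ (suc k)               ≡⟨ fromℕ-+ 1 k ⟩
      1ℚ + fromℕ k                ≤⟨ ℚ.+-monoˡ-≤ (fromℕ k) (fromℕ-mono {1} {d} (s≤s z≤n)) ⟩
      D + fromℕ k                 ≡⟨ cong₂ _+_ (ℚ.*-identityˡ D) sE ⟨
      1ℚ * D + s * E              ≡⟨ cong (λ z → z * D + s * E) (recip*suc m′) ⟨
      recip m′ * M * D + s * E    ≡⟨ cong (λ e → recip m′ * M * D + s * e) E≡ ⟩
      recip m′ * M * D + s * (D * M) ≡⟨ solve 4 (λ r m d s → r :* m :* d :+ s :* (d :* m) := (s :+ r) :* (d :* m)) refl (recip m′) M D s ⟩
      t * (D * M)                 ≡⟨ cong (t *_) E≡ ⟨
      t * E                       ∎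
    fromℕ-mono-< : ∀ {i j} → i ℕ.< j → fromℕ i < fromℕ j
    fromℕ-mono-< {i} h = ℚ.<-≤-trans
      (subst₂ _<_ (ℚ.+-identityˡ (fromℕ i)) (sym (fromℕ-+ 1 i)) (ℚ.+-monoˡ-< (fromℕ i) (0<fromℕ 0)))
      (fromℕ-mono h)
    hi : q < t * t
    hi = *-cancel-< E-1 (*-cancel-< E-1 (begin-strict
      q * E * E                       ≡⟨ qEE ⟩
      fromℕ N                         <⟨ fromℕ-mono-< (proj₂ (isqrt² N)) ⟩
      fromℕ (suc k ℕ.* suc k)         ≡⟨ fromℕ-* (suc k) (suc k) ⟩
      fromℕ (suc k) * fromℕ (suc k)   ≤⟨ *-mono-≤ (ℚ.≤-trans (ℚ.<⇒≤ (0<fromℕ k)) k+1≤tE) (ℚ.<⇒≤ (0<fromℕ k)) k+1≤tE k+1≤tE ⟩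
      (t * E) * (t * E)               ≡⟨ solve 2 (λ s e → s :* s :* e :* e := (s :* e) :* (s :* e)) refl t E ⟨
      t * t * E * E                   ∎))

------------------------------------------------------------------------
-- Real numbers, as Cauchy sequences of rationals

record ℝ : Set where
  constructor mkℝ
  field
    seq    : ℕ → ℚ
    cauchy : ∀ ε → 0ℚ ℚ.< ε → ∃[ N ] ∀ m n → N ℕ.≤ m → N ℕ.≤ n →
             ℚ.∣ seq m ℚ.- seq n ∣ ℚ.≤ ε

open ℝ public

infix  4 _≤_ _<_
infixl 6 _+_ _-_
infixl 7 _*_ _÷_[_]
infix  8 -_

record _≤_ (x y : ℝ) : Set where
  constructor mk≤
  field
    eventually : ∀ ε → 0ℚ ℚ.< ε → ∃[ N ] ∀ m → N ℕ.≤ m → seq x m ℚ.≤ seq y m ℚ.+ ε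

record _<_ (x y : ℝ) : Set where
  constructor mk<
  field
    gap        : ℚ
    0<gap      : 0ℚ ℚ.< gap
    index      : ℕ
    eventually : ∀ m → index ℕ.≤ m → seq x m ℚ.+ gap ℚ.≤ seq y m

fromℚ : ℚ → ℝ
fromℚ q .seq    _     = q
fromℚ q .cauchy ε 0<ε = 0 , λ _ _ _ _ →
  subst (ℚ._≤ ε) (cong ℚ.∣_∣ (sym (ℚ.+-inverseʳ q))) (ℚ.<⇒≤ 0<ε)

fromℕ : ℕ → ℝ
fromℕ n = fromℚ (Rational.fromℕ n)

0ℝ 1ℝ : ℝ
0ℝ = fromℕ 0
1ℝ = fromℕ 1

_+_ : ℝ → ℝ → ℝ
(x + y) .seq m = seq x m ℚ.+ seq y m
(x + y) .cauchy ε 0<ε =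
  let ½ε        = ½ ℚ.* ε
      0<½ε      = Rational.0<p*q Rational.0<½ 0<ε
      (N₁ , h₁) = cauchy x ½ε 0<½ε
      (N₂ , h₂) = cauchy y ½ε 0<½ε
  in N₁ ℕ.⊔ N₂ , λ m n N≤m N≤n →
    let a = seq x m; b = seq y m; c = seq x n; d = seq y n in begin
    ℚ.∣ (a ℚ.+ b) ℚ.- (c ℚ.+ d) ∣           ≡⟨ cong ℚ.∣_∣ (solve 4 (λ a b c d →
                                                 (a :+ b) :- (c :+ d) := (a :- c) :+ (b :- d)) refl a b c d) ⟩
    ℚ.∣ (a ℚ.- c) ℚ.+ (b ℚ.- d) ∣           ≤⟨ ℚ.∣p+q∣≤∣p∣+∣q∣ (a ℚ.- c) (b ℚ.- d) ⟩
    ℚ.∣ a ℚ.- c ∣ ℚ.+ ℚ.∣ b ℚ.- d ∣         ≤⟨ ℚ.+-mono-≤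
      (h₁ m n (ℕ.m⊔n≤o⇒m≤o N₁ N₂ N≤m) (ℕ.m⊔n≤o⇒m≤o N₁ N₂ N≤n))
      (h₂ m n (ℕ.m⊔n≤o⇒n≤o N₁ N₂ N≤m) (ℕ.m⊔n≤o⇒n≤o N₁ N₂ N≤n)) ⟩
    ½ε ℚ.+ ½ε                               ≡⟨ solve 1 (λ e → con ½ :* e :+ con ½ :* e := e) refl ε ⟩
    ε                                       ∎
  where
  open ℚ.≤-Reasoning
  open +-*-Solver

-_ : ℝ → ℝ
(- x) .seq m = ℚ.- seq x m
(- x) .cauchy ε 0<ε = let (N , h) = cauchy x ε 0<ε in N , λ m n N≤m N≤n →
  subst (ℚ._≤ ε) (cong ℚ.∣_∣ (solve 2 (λ p q → q :- p := (:- p) :- (:- q)) refl (seq x m) (seq x n)))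
    (h n m N≤n N≤m)
  where open +-*-Solver

_-_ : ℝ → ℝ → ℝ
x - y = x + (- y)

eventuallyBounded : ∀ x → ∃[ B ] 0ℚ ℚ.< B × ∃[ N ] ∀ m → N ℕ.≤ m → ℚ.∣ seq x m ∣ ℚ.≤ B
eventuallyBounded x with cauchy x 1ℚ (ℚ.positive⁻¹ 1ℚ)
... | N , h = 1ℚ ℚ.+ ℚ.∣ c ∣ , ℚ.<-≤-trans (ℚ.positive⁻¹ 1ℚ)
        (subst (ℚ._≤ 1ℚ ℚ.+ ℚ.∣ c ∣) (ℚ.+-identityʳ 1ℚ) (ℚ.+-monoʳ-≤ 1ℚ (ℚ.0≤∣p∣ c)))
    , N , λ m N≤m → let p = seq x m in begin
      ℚ.∣ p ∣                         ≡⟨ cong ℚ.∣_∣ (solve 2 (λ p c → p := (p :- c) :+ c) refl p c) ⟩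
      ℚ.∣ (p ℚ.- c) ℚ.+ c ∣           ≤⟨ ℚ.∣p+q∣≤∣p∣+∣q∣ (p ℚ.- c) c ⟩
      ℚ.∣ p ℚ.- c ∣ ℚ.+ ℚ.∣ c ∣       ≤⟨ ℚ.+-monoˡ-≤ ℚ.∣ c ∣ (h m N N≤m ℕ.≤-refl) ⟩
      1ℚ ℚ.+ ℚ.∣ c ∣                  ∎
  where
  open ℚ.≤-Reasoning
  open +-*-Solver
  c = seq x N

_*_ : ℝ → ℝ → ℝ
(x * y) .seq m = seq x m ℚ.* seq y m
(x * y) .cauchy ε 0<ε =
  let (X , 0<X , M₁ , k₁) = eventuallyBounded x
      (Y , 0<Y , M₂ , k₂) = eventuallyBounded y
      0<X+Y     = subst (ℚ._< X ℚ.+ Y) (ℚ.+-identityʳ 0ℚ) (ℚ.+-mono-< 0<X 0<Y)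
      instance
        X+Y>0   = ℚ.positive 0<X+Y
        X+Y≢0   = ℚ.pos⇒nonZero (X ℚ.+ Y)
      Z         = ℚ.1/ (X ℚ.+ Y)
      δ         = ε ℚ.* Z
      0<δ       = Rational.0<p*q 0<ε (ℚ.positive⁻¹ Z {{ℚ.1/pos⇒pos (X ℚ.+ Y)}})
      (N₁ , h₁) = cauchy x δ 0<δ
      (N₂ , h₂) = cauchy y δ 0<δ
      N         = (M₁ ℕ.⊔ M₂) ℕ.⊔ (N₁ ℕ.⊔ N₂)
      M₁≤ : ∀ {m} → N ℕ.≤ m → M₁ ℕ.≤ m
      M₁≤ p     = ℕ.m⊔n≤o⇒m≤o M₁ M₂ (ℕ.m⊔n≤o⇒m≤o (M₁ ℕ.⊔ M₂) (N₁ ℕ.⊔ N₂) p)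
      M₂≤ : ∀ {m} → N ℕ.≤ m → M₂ ℕ.≤ m
      M₂≤ p     = ℕ.m⊔n≤o⇒n≤o M₁ M₂ (ℕ.m⊔n≤o⇒m≤o (M₁ ℕ.⊔ M₂) (N₁ ℕ.⊔ N₂) p)
      N₁≤ : ∀ {m} → N ℕ.≤ m → N₁ ℕ.≤ m
      N₁≤ p     = ℕ.m⊔n≤o⇒m≤o N₁ N₂ (ℕ.m⊔n≤o⇒n≤o (M₁ ℕ.⊔ M₂) (N₁ ℕ.⊔ N₂) p)
      N₂≤ : ∀ {m} → N ℕ.≤ m → N₂ ℕ.≤ m
      N₂≤ p     = ℕ.m⊔n≤o⇒n≤o N₁ N₂ (ℕ.m⊔n≤o⇒n≤o (M₁ ℕ.⊔ M₂) (N₁ ℕ.⊔ N₂) p)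
  in N , λ m n N≤m N≤n →
    let a = seq x m; b = seq y m; c = seq x n; d = seq y n in begin
    ℚ.∣ a ℚ.* b ℚ.- c ℚ.* d ∣                                 ≡⟨ cong ℚ.∣_∣ (solve 4 (λ a b c d →
      a :* b :- c :* d := a :* (b :- d) :+ d :* (a :- c)) refl a b c d) ⟩
    ℚ.∣ a ℚ.* (b ℚ.- d) ℚ.+ d ℚ.* (a ℚ.- c) ∣                 ≤⟨ ℚ.∣p+q∣≤∣p∣+∣q∣ (a ℚ.* (b ℚ.- d)) (d ℚ.* (a ℚ.- c)) ⟩
    ℚ.∣ a ℚ.* (b ℚ.- d) ∣ ℚ.+ ℚ.∣ d ℚ.* (a ℚ.- c) ∣           ≡⟨ cong₂ ℚ._+_ (ℚ.∣p*q∣≡∣p∣*∣q∣ a (b ℚ.- d)) (ℚ.∣p*q∣≡∣p∣*∣q∣ d (a ℚ.- c)) ⟩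
    ℚ.∣ a ∣ ℚ.* ℚ.∣ b ℚ.- d ∣ ℚ.+ ℚ.∣ d ∣ ℚ.* ℚ.∣ a ℚ.- c ∣   ≤⟨ ℚ.+-mono-≤
      (Rational.*-mono-≤ (ℚ.<⇒≤ 0<X) (ℚ.0≤∣p∣ (b ℚ.- d)) (k₁ m (M₁≤ N≤m)) (h₂ m n (N₂≤ N≤m) (N₂≤ N≤n)))
      (Rational.*-mono-≤ (ℚ.<⇒≤ 0<Y) (ℚ.0≤∣p∣ (a ℚ.- c)) (k₂ n (M₂≤ N≤n)) (h₁ m n (N₁≤ N≤m) (N₁≤ N≤n))) ⟩
    X ℚ.* δ ℚ.+ Y ℚ.* δ                                       ≡⟨ solve 4 (λ x y e z →
      x :* (e :* z) :+ y :* (e :* z) := e :* ((x :+ y) :* z)) refl X Y ε Z ⟩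
    ε ℚ.* ((X ℚ.+ Y) ℚ.* Z)                                   ≡⟨ cong (ε ℚ.*_) (ℚ.*-inverseʳ (X ℚ.+ Y)) ⟩
    ε ℚ.* 1ℚ                                                  ≡⟨ ℚ.*-identityʳ ε ⟩
    ε                                                         ∎
  where
  open ℚ.≤-Reasoning
  open +-*-Solver

-- The terms of y are eventually at least the gap δ of 0 < y, so replacing
-- y_m by max(y_m , δ) changes only finitely many terms.
reciprocal : (y : ℝ) → 0ℝ < y → ℝ
reciprocal y (mk< δ 0<δ N₁ δ≤) = record { seq = inv ; cauchy = inv-cauchy }
  where
  open ℚ.≤-Reasoning
  open +-*-Solver
  u : ℕ → ℚ
  u m = seq y m ℚ.⊔ δ
  u>0 : ∀ m → ℚ.Positive (u m)
  u>0 m = ℚ.positive (ℚ.<-≤-trans 0<δ (ℚ.p≤q⊔p (seq y m) δ))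
  inv : ℕ → ℚ
  inv m = (ℚ.1/ u m) {{ℚ.pos⇒nonZero (u m) {{u>0 m}}}}
  u*inv : ∀ m → u m ℚ.* inv m ≡ 1ℚ
  u*inv m = ℚ.*-inverseʳ (u m) {{ℚ.pos⇒nonZero (u m) {{u>0 m}}}}
  0<inv : ∀ m → 0ℚ ℚ.< inv m
  0<inv m = ℚ.positive⁻¹ (inv m) {{ℚ.1/pos⇒pos (u m) {{u>0 m}}}}
  δ*inv≤1 : ∀ m → δ ℚ.* inv m ℚ.≤ 1ℚ
  δ*inv≤1 m = ℚ.≤-trans
    (ℚ.*-monoʳ-≤-nonNeg (inv m) {{ℚ.nonNegative (ℚ.<⇒≤ (0<inv m))}} (ℚ.p≤q⊔p (seq y m) δ))
    (ℚ.≤-reflexive (u*inv m))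
  u≡ : ∀ m → N₁ ℕ.≤ m → u m ≡ seq y m
  u≡ m h = ℚ.p≥q⇒p⊔q≡p (subst (ℚ._≤ seq y m) (ℚ.+-identityˡ δ) (δ≤ m h))
  inv-cauchy : ∀ ε → 0ℚ ℚ.< ε → ∃[ N ] ∀ m n → N ℕ.≤ m → N ℕ.≤ n →
               ℚ.∣ inv m ℚ.- inv n ∣ ℚ.≤ ε
  inv-cauchy ε 0<ε =
    let (N₂ , h) = cauchy y (ε ℚ.* (δ ℚ.* δ)) (Rational.0<p*q 0<ε (Rational.0<p*q 0<δ 0<δ))
    in N₁ ℕ.⊔ N₂ , λ m n N≤m N≤n →
      let p = inv m; q = inv n
          m₁ = ℕ.m⊔n≤o⇒m≤o N₁ N₂ N≤m; n₁ = ℕ.m⊔n≤o⇒m≤o N₁ N₂ N≤n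
          m₂ = ℕ.m⊔n≤o⇒n≤o N₁ N₂ N≤m; n₂ = ℕ.m⊔n≤o⇒n≤o N₁ N₂ N≤n
          0≤p = ℚ.<⇒≤ (0<inv m); 0≤q = ℚ.<⇒≤ (0<inv n)
          0≤δ = ℚ.<⇒≤ 0<δ
      in begin
      ℚ.∣ p ℚ.- q ∣
        ≡⟨ cong ℚ.∣_∣ (trans (cong₂ ℚ._-_
             (sym (trans (cong (p ℚ.*_) (u*inv n)) (ℚ.*-identityʳ p)))
             (sym (trans (cong (q ℚ.*_) (u*inv m)) (ℚ.*-identityʳ q))))
             (solve 4 (λ p q u v → p :* (v :* q) :- q :* (u :* p) := (v :- u) :* (p :* q)) refl p q (u m) (u n))) ⟩
      ℚ.∣ (u n ℚ.- u m) ℚ.* (p ℚ.* q) ∣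
        ≡⟨ ℚ.∣p*q∣≡∣p∣*∣q∣ (u n ℚ.- u m) (p ℚ.* q) ⟩
      ℚ.∣ u n ℚ.- u m ∣ ℚ.* ℚ.∣ p ℚ.* q ∣
        ≡⟨ cong₂ (λ s t → ℚ.∣ s ∣ ℚ.* t) (cong₂ ℚ._-_ (u≡ n n₁) (u≡ m m₁))
             (ℚ.0≤p⇒∣p∣≡p (Rational.0≤p*q 0≤p 0≤q)) ⟩
      ℚ.∣ seq y n ℚ.- seq y m ∣ ℚ.* (p ℚ.* q)
        ≤⟨ ℚ.*-monoʳ-≤-nonNeg (p ℚ.* q) {{ℚ.nonNegative (Rational.0≤p*q 0≤p 0≤q)}} (h n m n₂ m₂) ⟩
      ε ℚ.* (δ ℚ.* δ) ℚ.* (p ℚ.* q)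
        ≡⟨ solve 4 (λ e d p q → e :* (d :* d) :* (p :* q) := e :* ((d :* p) :* (d :* q))) refl ε δ p q ⟩
      ε ℚ.* ((δ ℚ.* p) ℚ.* (δ ℚ.* q))
        ≤⟨ ℚ.*-monoˡ-≤-nonNeg ε {{ℚ.nonNegative (ℚ.<⇒≤ 0<ε)}}
             (Rational.*-mono-≤ (ℚ.<⇒≤ (ℚ.positive⁻¹ 1ℚ)) (Rational.0≤p*q 0≤δ 0≤q) (δ*inv≤1 m) (δ*inv≤1 n)) ⟩
      ε ℚ.* (1ℚ ℚ.* 1ℚ)
        ≡⟨ ℚ.*-identityʳ ε ⟩
      ε ∎

_÷_[_] : (x y : ℝ) → 0ℝ < y → ℝ
x ÷ y [ 0<y ] = x * reciprocal y 0<y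

-- Negative numbers are sent to 0.
√ : ℝ → ℝ
√ x .seq m = SquareRoot.approx m (seq x m ℚ.⊔ 0ℚ)
√ x .cauchy ε 0<ε =
  let 0<½ε      = 0<p*q 0<½ 0<ε
      (N₁ , h₁) = cauchy x (½ε ℚ.* ½ε) (0<p*q 0<½ε 0<½ε)
      (N₂ , h₂) = archimedean ½ε 0<½ε
  in N₁ ℕ.⊔ N₂ , λ m n N≤m N≤n →
    let m₁ = ℕ.m⊔n≤o⇒m≤o N₁ N₂ N≤m; n₁ = ℕ.m⊔n≤o⇒m≤o N₁ N₂ N≤n
        m₂ = ℕ.m⊔n≤o⇒n≤o N₁ N₂ N≤m; n₂ = ℕ.m⊔n≤o⇒n≤o N₁ N₂ N≤n
    in ∣p-q∣≤ε (s m) (s n)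
         (s≤s+ε m n (∣p-q∣≤ε⇒p≤q+ε (seq x m) (seq x n) (h₁ m n m₁ n₁)) (h₂ n n₂))
         (s≤s+ε n m (∣p-q∣≤ε⇒p≤q+ε (seq x n) (seq x m) (h₁ n m n₁ m₁)) (h₂ m m₂))
  where
  open Rational
  open SquareRoot
  open ℚ.≤-Reasoning
  open +-*-Solver
  ½ε = ½ ℚ.* ε
  0≤½ε = ℚ.<⇒≤ (0<p*q 0<½ 0<ε)
  q s : ℕ → ℚ
  q m = seq x m ℚ.⊔ 0ℚ
  s m = approx m (q m)
  0≤q : ∀ m → 0ℚ ℚ.≤ q m
  0≤q m = ℚ.p≤q⊔p (seq x m) 0ℚ
  0≤½ε² = 0≤p*q 0≤½ε 0≤½ε
  q≤ : ∀ m n → seq x m ℚ.≤ seq x n ℚ.+ ½ε ℚ.* ½ε → q m ℚ.≤ q n ℚ.+ ½ε ℚ.* ½ε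
  q≤ m n h = ℚ.⊔-lub
    (ℚ.≤-trans h (ℚ.+-monoˡ-≤ (½ε ℚ.* ½ε) (ℚ.p≤p⊔q (seq x n) 0ℚ)))
    (subst (ℚ._≤ q n ℚ.+ ½ε ℚ.* ½ε) (ℚ.+-identityʳ 0ℚ) (ℚ.+-mono-≤ (0≤q n) 0≤½ε²))
  s≤s+ε : ∀ m n → seq x m ℚ.≤ seq x n ℚ.+ ½ε ℚ.* ½ε → recip n ℚ.≤ ½ε → s m ℚ.≤ s n ℚ.+ ε
  s≤s+ε m n h r≤ = ℚ.≮⇒≥ λ sn+ε<sm → ℚ.<-irrefl refl (begin-strict
    s m ℚ.* s m                                          ≤⟨ proj₁ (approx² m (q m) (0≤q m)) ⟩
    q m                                                  ≤⟨ q≤ m n h ⟩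
    q n ℚ.+ ½ε ℚ.* ½ε                                    <⟨ ℚ.+-monoˡ-< (½ε ℚ.* ½ε) (proj₂ (approx² n (q n) (0≤q n))) ⟩
    (s n ℚ.+ recip n) ℚ.* (s n ℚ.+ recip n) ℚ.+ ½ε ℚ.* ½ε ≤⟨ ℚ.+-monoˡ-≤ (½ε ℚ.* ½ε) (square-mono
                                                              (0≤+ 0≤sn (ℚ.<⇒≤ (0<recip n))) (ℚ.+-monoʳ-≤ (s n) r≤)) ⟩
    t ℚ.* t ℚ.+ ½ε ℚ.* ½ε                                ≡⟨ ℚ.+-identityʳ _ ⟨
    t ℚ.* t ℚ.+ ½ε ℚ.* ½ε ℚ.+ 0ℚ                         ≤⟨ ℚ.+-monoʳ-≤ (t ℚ.* t ℚ.+ ½ε ℚ.* ½ε) (0≤+ (0≤p*q 0≤½ε 0≤t) (0≤p*q 0≤½ε 0≤t)) ⟩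
    t ℚ.* t ℚ.+ ½ε ℚ.* ½ε ℚ.+ (½ε ℚ.* t ℚ.+ ½ε ℚ.* t)  ≡⟨ solve 2 (λ s h →
                                                              (s :+ h) :* (s :+ h) :+ h :* h :+ (h :* (s :+ h) :+ h :* (s :+ h))
                                                              := (s :+ h :+ h) :* (s :+ h :+ h)) refl (s n) ½ε ⟩
    (t ℚ.+ ½ε) ℚ.* (t ℚ.+ ½ε)                            ≡⟨ cong (λ z → z ℚ.* z) (p+½ε+½ε (s n) ε) ⟩
    (s n ℚ.+ ε) ℚ.* (s n ℚ.+ ε)                          ≤⟨ square-mono (0≤+ 0≤sn (ℚ.<⇒≤ 0<ε)) (ℚ.<⇒≤ sn+ε<sm) ⟩
    s m ℚ.* s m                                          ∎)
    where
    0≤sn = 0≤approx n (q n)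
    t = s n ℚ.+ ½ε
    0≤+ : ∀ {p q} → 0ℚ ℚ.≤ p → 0ℚ ℚ.≤ q → 0ℚ ℚ.≤ p ℚ.+ q
    0≤+ {p} {q} a b = subst (ℚ._≤ p ℚ.+ q) (ℚ.+-identityʳ 0ℚ) (ℚ.+-mono-≤ a b)
    0≤t = 0≤+ 0≤sn 0≤½ε
    square-mono : ∀ {p q} → 0ℚ ℚ.≤ p → p ℚ.≤ q → p ℚ.* p ℚ.≤ q ℚ.* q
    square-mono 0≤p p≤q = *-mono-≤ (ℚ.≤-trans 0≤p p≤q) 0≤p p≤q p≤q

-- ln n = ∫₁ⁿ dx/x, as the limit of Riemann sums of mesh 1/(m+1); ln 0 is
-- set to 0.
ln : ℕ → ℝ
ln n .seq m = RiemannSum.lower (n ℕ.∸ 1) (suc m)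
ln n .cauchy ε 0<ε = let (N , h) = Rational.archimedean ε 0<ε in N , λ m k N≤m N≤k →
  Rational.∣p-q∣≤ε (L m) (L k)
    (ℚ.≤-trans (RiemannSum.lower-close (n ℕ.∸ 1) m k) (ℚ.+-monoʳ-≤ (L k) (h k N≤k)))
    (ℚ.≤-trans (RiemannSum.lower-close (n ℕ.∸ 1) k m) (ℚ.+-monoʳ-≤ (L m) (h m N≤m)))
  where
  L : ℕ → ℚ
  L m = RiemannSum.lower (n ℕ.∸ 1) (suc m)

0<ln : ∀ k → 0ℝ < ln (2 ℕ.+ k)
0<ln k = mk< (Rational.recip (suc k)) (Rational.0<recip (suc k)) 0 λ m _ →
  subst (ℚ._≤ seq (ln (2 ℕ.+ k)) m) (sym (ℚ.+-identityˡ _)) (RiemannSum.recip≤lower k m)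

0<a+ln : ∀ {a} n → 0 ℕ.< a → 0ℝ < fromℕ a + ln n
0<a+ln {a} n 0<a = mk< 1ℚ (ℚ.positive⁻¹ 1ℚ) 0 λ m _ →
  subst (ℚ._≤ Rational.fromℕ a ℚ.+ seq (ln n) m) (ℚ.+-comm 1ℚ 0ℚ)
    (ℚ.+-mono-≤ (Rational.fromℕ-mono 0<a) (RiemannSum.0≤lower (n ℕ.∸ 1) (suc m)))

------------------------------------------------------------------------
-- Asymptotic notation, for nonnegative functions

infix 4 _=o_ _=Ω_

_=o_ : (f g : ℕ → ℝ) → Set
f =o g = ∀ ε → 0ℝ < ε → ∃[ n₀ ] ∀ n → n₀ ℕ.≤ n → f n ≤ ε * g n

_=Ω_ : (f g : ℕ → ℝ) → Set
f =Ω g = ∃[ c ] 0ℝ < c × ∃[ n₀ ] ∀ n → n₀ ℕ.≤ n → c * g n ≤ f n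

-- The values at n = 0 and n = 1, where n / ln n is undefined, do not matter.
√[n/ln-n] : ℕ → ℝ
√[n/ln-n] 0                   = 0ℝ
√[n/ln-n] 1                   = 0ℝ
√[n/ln-n] n@(suc (suc k)) = √ (fromℕ n ÷ ln n [ 0<ln k ])

------------------------------------------------------------------------
-- Biased Maker-Breaker games

data Player : Set where
  maker breaker : Player

opponent : Player → Player
opponent maker   = breaker
opponent breaker = maker

-- A game on the board X: MakerGoal M says that the elements M claimed by
-- Maker by the end of the game make him the winner, and bias P is the
-- number of elements P claims per move.
module MakerBreaker {X : Set} (MakerGoal : List X → Set) (bias : Player → ℕ) where

  record Position : Set where
    constructor position
    field
      makers breakers : List X

    claimed : List X
    claimed = makers ++ breakers

  open Position public

  start : Position
  start = position [] []

  claim : Player → List X → Position → Position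
  claim maker   xs (position M B) = position (xs ++ M) B
  claim breaker xs (position M B) = position M (xs ++ B)

  Full : Position → Set
  Full p = ∀ x → x ∈ claimed p

  record Legal (P : Player) (p : Position) (xs : List X) : Set where
    field
      distinct  : Unique xs
      unclaimed : All (_∉ claimed p) xs
      size      : length xs ≡ bias P
                ⊎ length xs ℕ.< bias P × Full (claim P xs p)

  Won : Player → Position → Set
  Won maker   p = MakerGoal (makers p)
  Won breaker p = ¬ MakerGoal (makers p)

  -- Winning strategies for P, as strategy trees: a move of P in each
  -- position with P to move, a continuation for each legal move of the
  -- opponent, and P the winner at every leaf.
  mutual
    data WinningToMove (P : Player) (p : Position) : Set where
      finished : Full p → Won P p → WinningToMove P p
      move     : ∀ xs → Legal P p xs → WinningToReply P (claim P xs p) → WinningToMove P p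

    data WinningToReply (P : Player) (p : Position) : Set where
      finished : Full p → Won P p → WinningToReply P p
      reply    : (∀ xs → Legal (opponent P) p xs → WinningToMove P (claim (opponent P) xs p)) →
                 WinningToReply P p

------------------------------------------------------------------------
-- The connectivity game on the complete graph

record Edge (n : ℕ) : Set where
  constructor edge
  field
    u v  : Fin n
    .u<v : u Fin.< v

module _ {n : ℕ} where

  Adjacent : List (Edge n) → Fin n → Fin n → Set
  Adjacent E x y = ∃[ e ] e ∈ E ×
    (Edge.u e ≡ x × Edge.v e ≡ y ⊎ Edge.u e ≡ y × Edge.v e ≡ x)

  -- Connectedness of the graph with all of Fin n as its vertex set.
  Connected : List (Edge n) → Set
  Connected E = ∀ x y → Star (Adjacent E) x y

  ContainsConnectedSpanningSubgraph : List (Edge n) → Set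
  ContainsConnectedSpanningSubgraph M = ∃[ T ] T ⊆ M × Connected T

biases : ℕ → ℕ → Player → ℕ
biases a b maker   = a
biases a b breaker = b

-- Breaker moves first.
MakerWins BreakerWins : (a b n : ℕ) → Set
MakerWins   a b n = WinningToReply maker start
  where open MakerBreaker (ContainsConnectedSpanningSubgraph {n}) (biases a b)
BreakerWins a b n = WinningToMove breaker start
  where open MakerBreaker (ContainsConnectedSpanningSubgraph {n}) (biases a b)

IsThresholdBias : (a : ℕ → ℕ) (β : ℕ → ℝ) → Set
IsThresholdBias a β = ∀ ε → 0ℝ < ε → ∃[ n₀ ] ∀ n → n₀ ℕ.≤ n →
  (∀ b → 0 ℕ.< b → fromℕ b ≤ (1ℝ - ε) * β n → MakerWins (a n) b n) ×
  (∀ b → (1ℝ + ε) * β n ≤ fromℕ b → BreakerWins (a n) b n)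

{-# OPTIONS --safe #-}
-- The bias a n / (a + ln n) is the threshold for every a; when a dominates
-- ln n it is asymptotic to n.
--
-- Maker keeps one active vertex in each of his components.  With every edge
-- he joins to another component the one (of at most half of the vertices)
-- whose active vertex has the largest Breaker degree, and deactivates that
-- vertex.  By averaging, if S(J) counts Breaker's edges that touch a set J of
-- j active vertices, then S(J)/j exceeds the largest S(J′)/(j + a) over sets J′
-- of j + a vertices that were active a round earlier by at most
-- b/(j + a) + a.  For j of order n, S(J)/j is small because Breaker has few
-- edges; going down from there to j = 1 in steps of a, the degree of an active
-- vertex stays below b + (b/a) ln n + o(n) < n, so that Maker always finds an
-- edge leaving the chosen component.
--
-- If b < n, Breaker first builds a clique of n^(1-o(1)) vertices untouched by
-- Maker, adding a + 1 vertices per round of which Maker spoils at most a.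
-- Each edge of Maker now spoils one vertex of the clique, so while a R + 1
-- vertices shrink to one, Breaker claims b/(a s + 1) edges at each survivor in
-- the round with a s + 1 vertices left, and b edges at the last vertex: in
-- total b + (b/a) ln R and thus at least n edges, which isolate it.
module Submission where

open import Defs using
  ( Player; maker; breaker; opponent; module MakerBreaker
  ; Edge; edge; Adjacent; Connected; ContainsConnectedSpanningSubgraph; biases; MakerWins; BreakerWins
  ; module Rational; module RiemannSum; module SquareRoot
  ; ℝ; seq; 0ℝ; 1ℝ; mk<; mk≤; reciprocal; √; √[n/ln-n]; ln; _÷_[_]; 0<ln; 0<a+ln )
import Defs as ℝ
open import Data.Fin as Fin using (Fin)
import Data.Fin.Properties as Fin
open import Data.List using
  ( List; []; _∷_; length; _++_; filter; take; drop; map; concatMap; cartesianProduct; allFin; deduplicate )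
import Data.List.Extrema.Nat as Extrema
import Data.List.Membership.DecPropositional as DecMembership
open import Data.List.Membership.Propositional using (_∈_; _∉_; find; lose)
open import Data.List.Membership.Propositional.Properties using
  ( ∈-∃++; ∈-++⁻; ∈-++⁺ˡ; ∈-++⁺ʳ; ∈-filter⁻; ∈-filter⁺; ∈-length; ∈-concatMap⁺; ∈-concatMap⁻
  ; ∈-allFin; ∈-deduplicate⁺; ∈-cartesianProduct⁻ )
import Data.List.Properties as List
open import Data.List.Relation.Binary.Subset.Propositional using (_⊆_)
open import Data.List.Relation.Unary.All as All using (All; []; _∷_)
import Data.List.Relation.Unary.All.Properties as All
open import Data.List.Relation.Unary.AllPairs as AllPairs using (_∷_)
open import Data.List.Relation.Unary.Any as Any using (Any; here; there; any?)
import Data.List.Relation.Unary.Unique.DecPropositional.Properties as UniqueDec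
open import Data.List.Relation.Unary.Unique.Propositional using (Unique)
import Data.List.Relation.Unary.Unique.Propositional.Properties as Unique
open import Data.Nat as ℕ using (ℕ; zero; suc; z≤n; s≤s)
open import Data.Nat.DivMod using
  ( _/_; _%_; m/n*n≤m; m/n≤m; m*n/n≡m; m≡m%n+[m/n]*n; m%n<n; m≥n⇒m/n>0; /-monoˡ-≤; /-monoʳ-≤ )
import Data.Nat.Properties as ℕ
import Data.Nat.Solver as ℕSolver
import Data.Nat.Tactic.RingSolver as ℕ
open import Data.Product using (_×_; _,_; proj₁; proj₂; ∃-syntax)
open import Data.Rational as ℚ using (ℚ; 0ℚ; 1ℚ)
import Data.Rational.Properties as ℚ
import Data.Rational.Solver as ℚSolver
open import Data.Sum using (_⊎_; inj₁; inj₂)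
open import Function using (_∘_; id)
open import Level using (0ℓ)
open import Relation.Binary.Construct.Closure.ReflexiveTransitive as Star using (Star; _◅_; _◅◅_)
open import Relation.Binary.Definitions using (DecidableEquality; tri<; tri≈; tri>)
open import Relation.Binary.PropositionalEquality
open import Relation.Nullary using (¬_; Dec; yes; no; contradiction)
open import Relation.Nullary.Decidable using (_×-dec_; _⊎-dec_; ¬?; decidable-stable; recompute)
open import Relation.Unary using (Pred; Decidable)

-- The averaging is carried out edge by edge of Maker, not round by round. After Breaker's move the
-- bound on a′·S(J) may exceed its value between rounds by b·r, where r counts the moves Maker still
-- has in this round. Each deactivation converts b of this excess into a term b/(j + 1) of the
-- potential, so that a round of a′ moves acts like a′ single moves against bias b/a′. The number a′
-- is a capped at n: only the first a′ edges of a round are charged, and further merges do no harm.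
--
-- Breaker's clique is affordable for a reason hidden in the bias: if b ≤ n and b is at least (1 +
-- 1/E) a n / (a + ℓ + 2), then a is at most E (ℓ + 2), so that all losses polynomial in a and ln n
-- are beaten by a small power of n.
--
-- Both strategies are analysed in natural numbers. A positive ε is replaced by 1/E, and ln n by an
-- integer ℓ with ℓ ≤ ln n ≤ ℓ + 2; the error of 2 disappears in the slack given by E. Real numbers
-- return only when the integer inequalities are read off from the bounds on b.

module _ {X Y : Set} (R : X → Y → Set) where
  open import Data.Nat using (_≤_)

  -- Removing from ys the partner of the head of xs leaves partners for its tail.
  injective⇒length≤ : ∀ {xs ys} → Unique xs →
    (∀ {x} → x ∈ xs → ∃[ y ] y ∈ ys × R x y) →
    (∀ {x x′ y} → x ∈ xs → x′ ∈ xs → R x y → R x′ y → x ≡ x′) → length xs ≤ length ys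
  injective⇒length≤ {[]}     _           _       _   = z≤n
  injective⇒length≤ {x ∷ xs} (x∉ ∷ uniq) partner inj with partner (here refl)
  ... | y , y∈ , Rxy with ∈-∃++ y∈
  ... | as , bs , refl = subst (suc (length xs) ≤_) (sym (List.length-++-sucʳ as y bs))
    (s≤s (injective⇒length≤ uniq partner′ λ p q → inj (there p) (there q)))
    where
    skip : ∀ {z z′} → z ∈ xs → R z z′ → z′ ∈ as ⊎ z′ ∈ y ∷ bs → z′ ∈ as ++ bs
    skip _  _ (inj₁ z′∈as)          = ∈-++⁺ˡ z′∈as
    skip z∈ r (inj₂ (here refl))    = contradiction (inj (here refl) (there z∈) Rxy r) (All.lookup x∉ z∈)
    skip _  _ (inj₂ (there z′∈bs))  = ∈-++⁺ʳ as z′∈bs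
    partner′ : ∀ {z} → z ∈ xs → ∃[ z′ ] z′ ∈ as ++ bs × R z z′
    partner′ z∈ = let (z′ , z′∈ , r) = partner (there z∈) in z′ , skip z∈ r (∈-++⁻ as z′∈) , r

unique-⊆⇒length≤ : ∀ {X : Set} {xs ys : List X} → Unique xs → xs ⊆ ys → length xs ℕ.≤ length ys
unique-⊆⇒length≤ uniq xs⊆ys = injective⇒length≤ _≡_ uniq (λ x∈ → _ , xs⊆ys x∈ , refl)
  λ _ _ p q → trans p (sym q)

-- Counting elements of lists.

module Lists {X : Set} where
  open import Data.Nat using (_+_; _≤_; _<_)

  take-⊆ : ∀ k (xs : List X) → take k xs ⊆ xs
  take-⊆ (suc k) (x ∷ xs) (here p)  = here p
  take-⊆ (suc k) (x ∷ xs) (there p) = there (take-⊆ k xs p)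

  count : {P : Pred X 0ℓ} → Decidable P → List X → ℕ
  count P? xs = length (filter P? xs)

  module _ {P Q : Pred X 0ℓ} (P? : Decidable P) (Q? : Decidable Q) where

    count-mono : ∀ xs → (∀ {x} → x ∈ xs → P x → Q x) → count P? xs ≤ count Q? xs
    count-mono []       _ = z≤n
    count-mono (x ∷ xs) h with P? x | Q? x
    ... | yes p | yes q = s≤s (count-mono xs (h ∘ there))
    ... | yes p | no ¬q = contradiction (h (here refl) p) ¬q
    ... | no ¬p | yes q = ℕ.m≤n⇒m≤1+n (count-mono xs (h ∘ there))
    ... | no ¬p | no ¬q = count-mono xs (h ∘ there)

    count-mono-< : ∀ xs → (∀ {x} → x ∈ xs → P x → Q x) →
                   ∀ {z} → z ∈ xs → ¬ P z → Q z → count P? xs < count Q? xs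
    count-mono-< (x ∷ xs) h z∈ ¬pz qz with P? x | Q? x | z∈
    ... | yes p | _     | here refl = contradiction p ¬pz
    ... | no _  | yes q | here refl = s≤s (count-mono xs (h ∘ there))
    ... | _     | no ¬q | here refl = contradiction qz ¬q
    ... | yes p | yes q | there z∈′ = s≤s (count-mono-< xs (h ∘ there) z∈′ ¬pz qz)
    ... | yes p | no ¬q | there _   = contradiction (h (here refl) p) ¬q
    ... | no ¬p | yes q | there z∈′ = ℕ.m≤n⇒m≤1+n (count-mono-< xs (h ∘ there) z∈′ ¬pz qz)
    ... | no ¬p | no ¬q | there z∈′ = count-mono-< xs (h ∘ there) z∈′ ¬pz qz

    count-⊎-× : ∀ xs → count (λ x → P? x ⊎-dec Q? x) xs + count (λ x → P? x ×-dec Q? x) xs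
                       ≡ count P? xs + count Q? xs
    count-⊎-× []       = refl
    count-⊎-× (x ∷ xs) with P? x | Q? x
    ... | yes p | yes q = cong suc (trans (ℕ.+-suc _ _) (trans (cong suc (count-⊎-× xs)) (sym (ℕ.+-suc _ _))))
    ... | yes p | no ¬q = cong suc (count-⊎-× xs)
    ... | no ¬p | yes q = trans (cong suc (count-⊎-× xs)) (sym (ℕ.+-suc _ _))
    ... | no ¬p | no ¬q = count-⊎-× xs

    count-⊎-≤ : ∀ xs → count (λ x → P? x ⊎-dec Q? x) xs ≤ count P? xs + count Q? xs
    count-⊎-≤ xs = ℕ.≤-trans (ℕ.m≤m+n _ _) (ℕ.≤-reflexive (count-⊎-× xs))

    count-disjoint : ∀ xs → (∀ {x} → P x → Q x → x ∉ xs) → count P? xs + count Q? xs ≤ length xs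
    count-disjoint xs disj = begin
      count P? xs + count Q? xs                                                      ≡⟨ count-⊎-× xs ⟨
      count (λ x → P? x ⊎-dec Q? x) xs + count (λ x → P? x ×-dec Q? x) xs            ≡⟨ cong (λ zs → count (λ x → P? x ⊎-dec Q? x) xs + length zs)
        (List.filter-none (λ x → P? x ×-dec Q? x) (All.tabulate λ x∈ (p , q) → disj p q x∈)) ⟩
      count (λ x → P? x ⊎-dec Q? x) xs + 0                                           ≡⟨ ℕ.+-identityʳ _ ⟩
      count (λ x → P? x ⊎-dec Q? x) xs                                               ≤⟨ List.length-filter (λ x → P? x ⊎-dec Q? x) xs ⟩
      length xs                                                                      ∎
      where open ℕ.≤-Reasoning

  module _ {P : Pred X 0ℓ} (P? : Decidable P) where

    count-++ : ∀ xs ys → count P? (xs ++ ys) ≡ count P? xs + count P? ys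
    count-++ xs ys = trans (cong length (List.filter-++ P? xs ys)) (List.length-++ (filter P? xs))

    count-complement : ∀ xs → count P? xs + count (λ x → ¬? (P? x)) xs ≡ length xs
    count-complement []       = refl
    count-complement (x ∷ xs) with P? x
    ... | yes _ = cong suc (count-complement xs)
    ... | no  _ = trans (ℕ.+-suc _ _) (cong suc (count-complement xs))

    count≤1 : ∀ {xs} → Unique xs → (∀ {x y} → x ∈ xs → y ∈ xs → P x → P y → x ≡ y) → count P? xs ≤ 1
    count≤1 {xs} uniq same = small (filter P? xs) (Unique.filter⁺ P? uniq)
      λ x∈ y∈ → let (x∈xs , px) = ∈-filter⁻ P? x∈ ; (y∈xs , py) = ∈-filter⁻ P? y∈ in same x∈xs y∈xs px py
      where
      small : ∀ zs → Unique zs → (∀ {x y} → x ∈ zs → y ∈ zs → x ≡ y) → length zs ≤ 1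
      small []           _                _    = z≤n
      small (_ ∷ [])     _                _    = s≤s z≤n
      small (_ ∷ _ ∷ _) ((x≢y ∷ _) ∷ _) same = contradiction (same (here refl) (there (here refl))) x≢y

  length-take : ∀ {k} {xs : List X} → k ≤ length xs → length (take k xs) ≡ k
  length-take {k} {xs} k≤ = trans (List.length-take k xs) (ℕ.m≤n⇒m⊓n≡m k≤)

  ∈-take-or-drop : ∀ k {xs : List X} {x} → x ∈ xs → x ∈ take k xs ⊎ x ∈ drop k xs
  ∈-take-or-drop k {xs} x∈ = ∈-++⁻ (take k xs) (subst (_ ∈_) (sym (List.take++drop≡id k xs)) x∈)

module _ {X Y : Set} where
  open import Data.Nat using (_+_; _*_; _≤_)

  length-cartesianProduct : ∀ (xs : List X) (ys : List Y) →
                            length (cartesianProduct xs ys) ≡ length xs * length ys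
  length-cartesianProduct []       ys = refl
  length-cartesianProduct (x ∷ xs) ys = trans (List.length-++ (map (x ,_) ys))
    (cong₂ _+_ (List.length-map (x ,_) ys) (length-cartesianProduct xs ys))

  length-concatMap-≤ : ∀ {c} (f : X → List Y) xs → (∀ x → length (f x) ≤ c) →
                       length (concatMap f xs) ≤ length xs * c
  length-concatMap-≤ f []       _ = z≤n
  length-concatMap-≤ f (x ∷ xs) h = ℕ.≤-trans (ℕ.≤-reflexive (List.length-++ (f x)))
    (ℕ.+-mono-≤ (h x) (length-concatMap-≤ f xs h))

-- Constructing legal moves, and play after the outcome is decided.

module Play {X : Set} (_≟_ : DecidableEquality X) (board : List X)
            (board-unique : Unique board) (board-complete : ∀ x → x ∈ board)
            (MakerGoal : List X → Set) (bias : Player → ℕ) where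
  open import Data.Nat using (_+_; _∸_; _≤_; _<_)
  open MakerBreaker MakerGoal bias
  open DecMembership _≟_ using (_∈?_)
  open Lists {X}

  Free : Position → X → Set
  Free p x = x ∉ claimed p

  free? : ∀ p → Decidable (Free p)
  free? p x = ¬? (x ∈? claimed p)

  ¬free⇒claimed : ∀ p {x} → ¬ Free p x → x ∈ claimed p
  ¬free⇒claimed p {x} = decidable-stable (x ∈? claimed p)

  claim⁺ˡ : ∀ P xs p → xs ⊆ claimed (claim P xs p)
  claim⁺ˡ maker   xs p x∈ = ∈-++⁺ˡ (∈-++⁺ˡ x∈)
  claim⁺ˡ breaker xs p x∈ = ∈-++⁺ʳ (makers p) (∈-++⁺ˡ x∈)

  claim⁺ʳ : ∀ P xs p → claimed p ⊆ claimed (claim P xs p)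
  claim⁺ʳ maker xs p x∈ with ∈-++⁻ (makers p) x∈
  ... | inj₁ x∈M = ∈-++⁺ˡ (∈-++⁺ʳ xs x∈M)
  ... | inj₂ x∈B = ∈-++⁺ʳ (xs ++ makers p) x∈B
  claim⁺ʳ breaker xs p x∈ with ∈-++⁻ (makers p) x∈
  ... | inj₁ x∈M = ∈-++⁺ˡ x∈M
  ... | inj₂ x∈B = ∈-++⁺ʳ (makers p) (∈-++⁺ʳ xs x∈B)

  claim⁻ : ∀ P xs p {x} → x ∈ claimed (claim P xs p) → x ∈ xs ⊎ x ∈ claimed p
  claim⁻ maker xs p x∈ with ∈-++⁻ (xs ++ makers p) x∈
  ... | inj₂ x∈B = inj₂ (∈-++⁺ʳ (makers p) x∈B)
  ... | inj₁ x∈′ with ∈-++⁻ xs x∈′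
  ... | inj₁ x∈xs = inj₁ x∈xs
  ... | inj₂ x∈M  = inj₂ (∈-++⁺ˡ x∈M)
  claim⁻ breaker xs p x∈ with ∈-++⁻ (makers p) x∈
  ... | inj₁ x∈M = inj₂ (∈-++⁺ˡ x∈M)
  ... | inj₂ x∈′ with ∈-++⁻ xs x∈′
  ... | inj₁ x∈xs = inj₁ x∈xs
  ... | inj₂ x∈B  = inj₂ (∈-++⁺ʳ (makers p) x∈B)

  legal-size : ∀ {P p xs} → Legal P p xs → length xs ≤ bias P
  legal-size legal with Legal.size legal
  ... | inj₁ eq       = ℕ.≤-reflexive eq
  ... | inj₂ (lt , _) = ℕ.<⇒≤ lt

  -- The rules demand exactly `bias P` elements unless the board runs out, whereas a strategy names
  -- only the elements it cares about; the rest is padding with arbitrary free elements. If these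
  -- are too few, the move takes all of them and fills the board, which is the second alternative of
  -- `size`.
  extend : ∀ P p {xs} → Unique xs → All (Free p) xs → length xs ≤ bias P →
           ∃[ ys ] xs ⊆ ys × Legal P p ys
  extend P p {xs} uniq free len = xs ++ zs , ∈-++⁺ˡ , record
    { distinct  = Unique.++⁺ uniq (Unique.take⁺ k (Unique.filter⁺ rest? board-unique))
                    λ (x∈xs , x∈zs) → proj₂ (zs-rest x∈zs) x∈xs
    ; unclaimed = All.++⁺ free (All.tabulate (proj₁ ∘ zs-rest))
    ; size      = size (k ℕ.≤? length rest)
    }
    where
    rest? : Decidable (λ x → Free p x × x ∉ xs)
    rest? x = free? p x ×-dec ¬? (x ∈? xs)
    rest = filter rest? board
    k = bias P ∸ length xs
    zs = take k rest
    zs-rest : ∀ {x} → x ∈ zs → Free p x × x ∉ xs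
    zs-rest x∈ = proj₂ (∈-filter⁻ rest? {xs = board} (take-⊆ k rest x∈))
    length-ys : length (xs ++ zs) ≡ length xs + length zs
    length-ys = List.length-++ xs
    size : _ → length (xs ++ zs) ≡ bias P ⊎ length (xs ++ zs) < bias P × Full (claim P (xs ++ zs) p)
    size (yes k≤) = inj₁ (trans length-ys (trans (cong (length xs +_) (length-take k≤)) (ℕ.m+[n∸m]≡n len)))
    size (no  k≰) = inj₂ (lt , full)
      where
      zs≡rest : zs ≡ rest
      zs≡rest = List.take-all k rest (ℕ.<⇒≤ (ℕ.≰⇒> k≰))
      lt : length (xs ++ zs) < bias P
      lt = subst₂ _<_ (sym (trans length-ys (cong (λ l → length xs + length l) zs≡rest)))
             (ℕ.m+[n∸m]≡n len) (ℕ.+-monoʳ-< (length xs) (ℕ.≰⇒> k≰))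
      full : Full (claim P (xs ++ zs) p)
      full x with rest? x
      ... | yes r = claim⁺ˡ P (xs ++ zs) p
            (∈-++⁺ʳ xs (subst (x ∈_) (sym zs≡rest) (∈-filter⁺ rest? (board-complete x) r)))
      ... | no ¬r with x ∈? xs
      ... | yes x∈xs = claim⁺ˡ P (xs ++ zs) p (∈-++⁺ˡ x∈xs)
      ... | no x∉xs  = claim⁺ʳ P (xs ++ zs) p (¬free⇒claimed p λ fr → ¬r (fr , x∉xs))

  -- Elements of `zs` that either player already owns are dropped from the move. Hence the
  -- conclusion speaks of claimed elements and not of elements of `P`.
  cover : ∀ P p zs → length zs ≤ bias P →
          ∃[ ys ] Legal P p ys × (∀ {z} → z ∈ zs → z ∈ claimed (claim P ys p))
  cover P p zs len = ys , legal , covered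
    where
    wanted? : Decidable (λ x → x ∈ zs × Free p x)
    wanted? x = x ∈? zs ×-dec free? p x
    xs = filter wanted? board
    extended = extend P p {xs} (Unique.filter⁺ wanted? board-unique) (All.map proj₂ (All.all-filter wanted? board))
      (ℕ.≤-trans (unique-⊆⇒length≤ (Unique.filter⁺ wanted? board-unique)
        (proj₁ ∘ proj₂ ∘ ∈-filter⁻ wanted? {xs = board})) len)
    ys = proj₁ extended
    legal = proj₂ (proj₂ extended)
    covered : ∀ {z} → z ∈ zs → z ∈ claimed (claim P ys p)
    covered {z} z∈ with z ∈? claimed p
    ... | yes z∈p = claim⁺ʳ P ys p z∈p
    ... | no  fz  = claim⁺ˡ P ys p (proj₁ (proj₂ extended) (∈-filter⁺ wanted? (board-complete z) (z∈ , fz)))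

  #free : Position → ℕ
  #free p = count (free? p) board

  -- The empty move is legal only with bias 0 or on a full board; `0 < bias P` and the free `z`
  -- exclude both.
  #free-decreases : ∀ {P p xs z} → 0 < bias P → Legal P p xs → Free p z →
                    #free (claim P xs p) < #free p
  #free-decreases {P} {p} {[]} {z} 0<b legal fz with Legal.size legal
  ... | inj₁ eq         = contradiction 0<b (subst (λ b → ¬ 0 < b) eq λ ())
  ... | inj₂ (_ , full) with claim⁻ P [] p (full z)
  ... | inj₂ z∈ = contradiction z∈ fz
  #free-decreases {P} {p} {x ∷ xs} _ legal _ = count-mono-< (free? (claim P (x ∷ xs) p)) (free? p) board
    (λ _ fr x∈ → fr (claim⁺ʳ P (x ∷ xs) p x∈)) (board-complete x)
    (λ fr → fr (claim⁺ˡ P (x ∷ xs) p (here refl))) (All.head (Legal.unclaimed legal))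

  full-or-free : ∀ p → Full p ⊎ ∃[ x ] Free p x
  full-or-free p with any? (free? p) board
  ... | yes ∃free = let (x , _ , fx) = find ∃free in inj₂ (x , fx)
  ... | no ¬∃free = inj₁ λ x → ¬free⇒claimed p λ fx → ¬∃free (lose (board-complete x) fx)

  #free>0 : ∀ p {x} → Free p x → ¬ #free p ≤ 0
  #free>0 p fx h = ℕ.<⇒≱ (∈-length (∈-filter⁺ (free? p) (board-complete _) fx)) h

  -- A strategy tree must reach a full board even when the winner is settled earlier. For a property
  -- that every legal move preserves, arbitrary moves will do, and the number of free elements,
  -- bounded by `f`, makes the tree finite.
  module Secured (0<bias : ∀ P → 0 < bias P) (P : Player) (Secure : Position → Set)
                 (preserved : ∀ {p} Q {xs} → Secure p → Legal Q p xs → Secure (claim Q xs p))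
                 (won : ∀ p → Secure p → Won P p) where

    toMove  : ∀ f p → #free p ≤ f → Secure p → WinningToMove P p
    toReply : ∀ f p → #free p ≤ f → Secure p → WinningToReply P p

    toMove f p h s with full-or-free p
    toMove f       p h s | inj₁ full     = finished full (won p s)
    toMove zero    p h s | inj₂ (z , fz) = contradiction h (#free>0 p fz)
    toMove (suc f) p h s | inj₂ (z , fz) with extend P p {[]} AllPairs.[] [] z≤n
    ... | xs , _ , legal = move xs legal (toReply f _
          (ℕ.≤-pred (ℕ.≤-trans (#free-decreases (0<bias P) legal fz) h)) (preserved P s legal))

    toReply f p h s with full-or-free p
    toReply f       p h s | inj₁ full     = finished full (won p s)
    toReply zero    p h s | inj₂ (z , fz) = contradiction h (#free>0 p fz)
    toReply (suc f) p h s | inj₂ (z , fz) = reply λ xs legal → toMove f _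
      (ℕ.≤-pred (ℕ.≤-trans (#free-decreases (0<bias (opponent P)) legal fz) h))
      (preserved (opponent P) s legal)

-- Edges of the complete graph.

module Edges {n : ℕ} where
  open import Data.Nat using (_*_; _≤_)
  open Lists {Edge n}
  open Edge using (u; v)

  infix 4 _≟_

  _≟_ : DecidableEquality (Edge n)
  edge x y _ ≟ edge x′ y′ _ with x Fin.≟ x′ | y Fin.≟ y′
  ... | yes refl | yes refl = yes refl
  ... | no x≢    | _        = no λ { refl → x≢ refl }
  ... | yes _    | no y≢    = no λ { refl → y≢ refl }

  -- An indexed family in place of equations between endpoints: a match substitutes the endpoints in
  -- one of the two orientations.
  data Joins : Edge n → Fin n → Fin n → Set where
    uv : ∀ {x y} .{x<y} → Joins (edge x y x<y) x y
    vu : ∀ {x y} .{x<y} → Joins (edge x y x<y) y x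

  joins? : ∀ x y e → Dec (Joins e x y)
  joins? x y (edge x′ y′ _) with x Fin.≟ x′ ×-dec y Fin.≟ y′ | x Fin.≟ y′ ×-dec y Fin.≟ x′
  ... | yes (refl , refl) | _                 = yes uv
  ... | no _              | yes (refl , refl) = yes vu
  ... | no ¬uv            | no ¬vu            =
    no λ { uv → ¬uv (refl , refl) ; vu → ¬vu (refl , refl) }

  joins⇒adjacent : ∀ {e x y E} → e ∈ E → Joins e x y → Adjacent E x y
  joins⇒adjacent e∈ uv = _ , e∈ , inj₁ (refl , refl)
  joins⇒adjacent e∈ vu = _ , e∈ , inj₂ (refl , refl)

  edgeBetween : ∀ {x y : Fin n} → x ≢ y → ∃[ e ] Joins e x y
  edgeBetween {x} {y} x≢y with Fin.<-cmp x y
  ... | tri< x<y _ _ = edge x y x<y , uv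
  ... | tri≈ _ x≡y _ = contradiction x≡y x≢y
  ... | tri> _ _ y<x = edge y x y<x , vu

  joins-sym : ∀ {e x y} → Joins e x y → Joins e y x
  joins-sym uv = vu
  joins-sym vu = uv

  joins⇒≢ : ∀ {e x y} → Joins e x y → x ≢ y
  joins⇒≢ (uv {x<y = x<y}) refl = ℕ.<-irrefl refl (recompute (_ Fin.<? _) x<y)
  joins⇒≢ (vu {x<y = x<y}) refl = ℕ.<-irrefl refl (recompute (_ Fin.<? _) x<y)

  joins-unique : ∀ {e e′ x y} → Joins e x y → Joins e′ x y → e ≡ e′
  joins-unique uv             uv             = refl
  joins-unique vu             vu             = refl
  joins-unique (uv {x<y = p}) (vu {x<y = q}) =
    contradiction (recompute (_ Fin.<? _) p) (ℕ.<-asym (recompute (_ Fin.<? _) q))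
  joins-unique (vu {x<y = p}) (uv {x<y = q}) =
    contradiction (recompute (_ Fin.<? _) p) (ℕ.<-asym (recompute (_ Fin.<? _) q))

  joins-endpoints : ∀ {e x y x′ y′} → Joins e x y → Joins e x′ y′ → x ≡ x′ × y ≡ y′ ⊎ x ≡ y′ × y ≡ x′
  joins-endpoints uv uv = inj₁ (refl , refl)
  joins-endpoints uv vu = inj₂ (refl , refl)
  joins-endpoints vu uv = inj₂ (refl , refl)
  joins-endpoints vu vu = inj₁ (refl , refl)

  data Touches : Fin n → Edge n → Set where
    atᵘ : ∀ {x y} .{x<y} → Touches x (edge x y x<y)
    atᵛ : ∀ {x y} .{x<y} → Touches y (edge x y x<y)

  touches? : ∀ x e → Dec (Touches x e)
  touches? x (edge x′ y′ _) with x Fin.≟ x′ | x Fin.≟ y′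
  ... | yes refl | _        = yes atᵘ
  ... | no _     | yes refl = yes atᵛ
  ... | no ¬u    | no ¬v    = no λ { atᵘ → ¬u refl ; atᵛ → ¬v refl }

  joins⇒touchesˡ : ∀ {e x y} → Joins e x y → Touches x e
  joins⇒touchesˡ uv = atᵘ
  joins⇒touchesˡ vu = atᵛ

  touches⇒joins : ∀ {e x} → Touches x e → ∃[ y ] Joins e x y
  touches⇒joins atᵘ = _ , uv
  touches⇒joins atᵛ = _ , vu

  touches-both : ∀ {e x y} → x ≢ y → Touches x e → Touches y e → Joins e x y
  touches-both x≢y atᵘ atᵘ = contradiction refl x≢y
  touches-both x≢y atᵘ atᵛ = uv
  touches-both x≢y atᵛ atᵘ = vu
  touches-both x≢y atᵛ atᵛ = contradiction refl x≢y

  private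
    orderedPair : Fin n → Fin n → List (Edge n)
    orderedPair x y with x Fin.<? y
    ... | yes x<y = edge x y x<y ∷ []
    ... | no  _   = []

    ∈-orderedPair : ∀ e → e ∈ orderedPair (u e) (v e)
    ∈-orderedPair (edge x y x<y) with x Fin.<? y
    ... | yes _   = here refl
    ... | no ¬x<y = contradiction (recompute (x Fin.<? y) x<y) ¬x<y

    pairs : List (Edge n)
    pairs = concatMap (λ x → concatMap (orderedPair x) (allFin n)) (allFin n)

  edges : List (Edge n)
  edges = deduplicate _≟_ pairs

  edges-unique : Unique edges
  edges-unique = UniqueDec.deduplicate-! _≟_ pairs

  edges-complete : ∀ e → e ∈ edges
  edges-complete e = ∈-deduplicate⁺ _≟_ (∈-concatMap⁺ _ (lose (∈-allFin (u e))
    (∈-concatMap⁺ _ (lose (∈-allFin (v e)) (∈-orderedPair e)))))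

  between : Fin n → Fin n → List (Edge n)
  between x y = filter (joins? x y) edges

  ∈-between : ∀ {e x y} → Joins e x y → e ∈ between x y
  ∈-between j = ∈-filter⁺ (joins? _ _) (edges-complete _) j

  length-between : ∀ x y → length (between x y) ≤ 1
  length-between x y = count≤1 (joins? x y) edges-unique λ _ _ → joins-unique

  allBetween : List (Fin n) → List (Fin n) → List (Edge n)
  allBetween xs ys = concatMap (λ x → concatMap (between x) ys) xs

  ∈-allBetween : ∀ {xs ys e x y} → x ∈ xs → y ∈ ys → Joins e x y → e ∈ allBetween xs ys
  ∈-allBetween x∈ y∈ j = ∈-concatMap⁺ _ (lose x∈ (∈-concatMap⁺ _ (lose y∈ (∈-between j))))

  ∈-allBetween⁻ : ∀ {xs ys e} → e ∈ allBetween xs ys →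
                  ∃[ x ] ∃[ y ] x ∈ xs × y ∈ ys × Joins e x y
  ∈-allBetween⁻ {xs} {ys} e∈ with find (∈-concatMap⁻ _ {xs = xs} e∈)
  ... | x , x∈ , e∈′ with find (∈-concatMap⁻ (between x) {xs = ys} e∈′)
  ... | y , y∈ , e∈″ = x , y , x∈ , y∈ , proj₂ (∈-filter⁻ (joins? x y) {xs = edges} e∈″)

  length-allBetween : ∀ xs ys → length (allBetween xs ys) ≤ length xs * length ys
  length-allBetween xs ys = length-concatMap-≤ _ xs λ x → ℕ.≤-trans
    (length-concatMap-≤ (between x) ys (length-between x)) (ℕ.≤-reflexive (ℕ.*-identityʳ (length ys)))

  -- Each pair in W × Z has its own edge: an edge determines its pair up to a swap, and disjointness
  -- of W and Z excludes the swap.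
  cut-size : ∀ {W Z E} → Unique W → Unique Z → (∀ {w} → w ∈ W → w ∉ Z) →
             (∀ {e w z} → w ∈ W → z ∈ Z → Joins e w z → e ∈ E) →
             length W * length Z ≤ length E
  cut-size {W} {Z} {E} uniqW uniqZ disjoint full = subst (_≤ length E) (length-cartesianProduct W Z)
    (injective⇒length≤ (λ (w , z) e → Joins e w z) (Unique.cartesianProduct⁺ uniqW uniqZ)
      (λ p → let (w∈ , z∈) = ∈-cartesianProduct⁻ W Z p
                 (e , j)   = edgeBetween λ w≡z → disjoint w∈ (subst (_∈ Z) (sym w≡z) z∈)
             in e , full w∈ z∈ j , j)
      λ p p′ j j′ → same (∈-cartesianProduct⁻ W Z p) (∈-cartesianProduct⁻ W Z p′) (joins-endpoints j j′))
    where
    same : ∀ {w z w′ z′} → w ∈ W × z ∈ Z → w′ ∈ W × z′ ∈ Z →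
           w ≡ w′ × z ≡ z′ ⊎ w ≡ z′ × z ≡ w′ → (w , z) ≡ (w′ , z′)
    same _        _        (inj₁ (refl , refl)) = refl
    same (w∈ , _) (_ , z∈) (inj₂ (refl , refl)) = contradiction z∈ (disjoint w∈)

-- Maker's strategy and its potential.

module MakerStrategy
  {n a b a′ : ℕ} (0<a : 0 ℕ.< a) (0<b : 0 ℕ.< b) (a′≤a : a′ ℕ.≤ a) (a′≤n : a′ ℕ.≤ n)
  -- Between rounds, `G j` bounds a′·S(J)/j for sets J of j candidates. The first alternative of
  -- `G-step` covers j so large that the total number of Breaker's edges suffices. The second is the
  -- price of descending from j + 1 to j: b/(j + 1) for a share of Breaker's edges and `a′` for
  -- edges counted twice. In `G-small`, `G 1 + b * a′` bounds a′ times the degree of a candidate,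
  -- and `4 * b` bounds a′ times the size of its component if the cut around it were full.
  (G : ℕ → ℕ)
  (G-step : ∀ j → 0 ℕ.< j → b ℕ.* n ℕ.≤ j ℕ.* G j ⊎
            suc j ℕ.* G (suc j) ℕ.+ b ℕ.+ suc j ℕ.* a′ ℕ.≤ suc j ℕ.* G j)
  (G-small : G 1 ℕ.+ b ℕ.* a′ ℕ.+ 4 ℕ.* b ℕ.< a′ ℕ.* n) where

  open import Relation.Binary.Construct.Closure.ReflexiveTransitive using (ε)
  open ℕSolver using (module +-*-Solver)
  open import Data.Nat using (_+_; _*_; _∸_; _≤_; _<_)
  open Edges {n}
  open Lists
  open MakerBreaker (ContainsConnectedSpanningSubgraph {n}) (biases a b)
  open Play _≟_ edges edges-unique edges-complete (ContainsConnectedSpanningSubgraph {n}) (biases a b)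
  open DecMembership _≟_ using (_∈?_)

  TouchesAny : List (Fin n) → Edge n → Set
  TouchesAny J e = Any (λ v → Touches v e) J

  touchesAny? : ∀ J e → Dec (TouchesAny J e)
  touchesAny? J e = any? (λ v → touches? v e) J

  degree : Position → Fin n → ℕ
  degree p v = count (touches? v) (breakers p)

  S : Position → List (Fin n) → ℕ
  S p J = count (touchesAny? J) (breakers p)

  degree≤S : ∀ p v → degree p v ≤ S p (v ∷ [])
  degree≤S p v = count-mono (touches? v) (touchesAny? (v ∷ [])) (breakers p) λ _ → here

  S-[] : ∀ p → S p [] ≡ 0
  S-[] p = cong length (List.filter-none (touchesAny? []) {breakers p} (All.tabulate λ _ ()))

  S-∷≤ : ∀ p v J → S p (v ∷ J) ≤ degree p v + S p J
  S-∷≤ p v J = ℕ.≤-trans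
    (count-mono (touchesAny? (v ∷ J)) (λ e → touches? v e ⊎-dec touchesAny? J e) (breakers p)
      λ { _ (here t) → inj₁ t ; _ (there t) → inj₂ t })
    (count-⊎-≤ (touches? v) (touchesAny? J) (breakers p))

  S≤length*d : ∀ p {d} J → (∀ {u} → u ∈ J → degree p u ≤ d) → S p J ≤ length J * d
  S≤length*d p []      _ = ℕ.≤-reflexive (S-[] p)
  S≤length*d p (u ∷ J) h = ℕ.≤-trans (S-∷≤ p u J) (ℕ.+-mono-≤ (h (here refl)) (S≤length*d p J (h ∘ there)))

  touchesBoth? : ∀ v J e → Dec (Touches v e × TouchesAny J e)
  touchesBoth? v J e = touches? v e ×-dec touchesAny? J e

  -- An edge at both `v` and another vertex x is the edge vx, so that each x in `J` accounts for at
  -- most one.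
  count-touchesBoth : ∀ {v E} J → v ∉ J → Unique E → count (touchesBoth? v J) E ≤ length J
  count-touchesBoth {v} {E} []      _  _    =
    ℕ.≤-reflexive (cong length (List.filter-none (touchesBoth? v []) {E} (All.tabulate λ { _ (_ , ()) })))
  count-touchesBoth {v} {E} (x ∷ J) v∉ uniq = begin
    count (touchesBoth? v (x ∷ J)) E                      ≤⟨ count-mono _ (λ e → both? e ⊎-dec touchesBoth? v J e) E
                                                               (λ { _ (t , here t′) → inj₁ (t , t′) ; _ (t , there t′) → inj₂ (t , t′) }) ⟩
    count (λ e → both? e ⊎-dec touchesBoth? v J e) E      ≤⟨ count-⊎-≤ both? (touchesBoth? v J) E ⟩
    count both? E + count (touchesBoth? v J) E            ≤⟨ ℕ.+-mono-≤
                                                               (count≤1 both? uniq λ _ _ (t , t′) (s , s′) →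
                                                                 joins-unique (touches-both v≢x t t′) (touches-both v≢x s s′))
                                                               (count-touchesBoth J (v∉ ∘ there) uniq) ⟩
    1 + length J                                          ∎
    where
    open ℕ.≤-Reasoning
    v≢x : v ≢ x
    v≢x = v∉ ∘ here
    both? : ∀ e → Dec (Touches v e × Touches x e)
    both? e = touches? v e ×-dec touches? x e

  -- Inclusion and exclusion: only the edges between `v` and `J` are counted twice.
  S+degree≤ : ∀ p v J → v ∉ J → Unique (breakers p) → S p J + degree p v ≤ S p (v ∷ J) + length J
  S+degree≤ p v J v∉J uniq = begin
    S p J + degree p v                                            ≡⟨ ℕ.+-comm (S p J) (degree p v) ⟩
    degree p v + S p J                                            ≡⟨ count-⊎-× (touches? v) (touchesAny? J) B ⟨
    count either? B + count (touchesBoth? v J) B                  ≤⟨ ℕ.+-mono-≤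
                                                                       (count-mono either? (touchesAny? (v ∷ J)) B
                                                                         λ { _ (inj₁ t) → here t ; _ (inj₂ t) → there t })
                                                                       (count-touchesBoth J v∉J uniq) ⟩
    S p (v ∷ J) + length J                                        ∎
    where
    open ℕ.≤-Reasoning
    B = breakers p
    either? : ∀ e → Dec (Touches v e ⊎ TouchesAny J e)
    either? e = touches? v e ⊎-dec touchesAny? J e

  active? : ∀ (rep : Fin n → Fin n) v → Dec (rep v ≡ v)
  active? rep v = rep v Fin.≟ v

  #active : (Fin n → Fin n) → ℕ
  #active rep = count (active? rep) (allFin n)

  inClass? : ∀ (rep : Fin n → Fin n) v x → Dec (rep x ≡ v)
  inClass? rep v x = rep x Fin.≟ v

  class complement : (Fin n → Fin n) → Fin n → List (Fin n)
  class      rep v = filter (inClass? rep v) (allFin n)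
  complement rep v = filter (λ x → ¬? (inClass? rep v x)) (allFin n)

  -- The limit of one half serves twice. Two distinct components cannot both exceed it, so
  -- candidates run out only when Maker's graph is connected; and at least half of the vertices lie
  -- outside the component, so that a full cut needs many edges of Breaker.
  Candidate : (Fin n → Fin n) → Fin n → Set
  Candidate rep v = rep v ≡ v × length (class rep v) + length (class rep v) ≤ n

  candidate? : ∀ rep v → Dec (Candidate rep v)
  candidate? rep v = active? rep v ×-dec (_ ℕ.≤? n)

  -- rep sends a vertex to the active vertex of its component in Maker's
  -- graph; i rounds have begun and r of the moves that the potential
  -- accounts for are left to Maker in the current one.
  record Invariant (p : Position) (rep : Fin n → Fin n) (i r : ℕ) : Set where
    field
      reaches    : ∀ x → Star (Adjacent (makers p)) x (rep x)
      idempotent : ∀ x → rep (rep x) ≡ rep x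
      respects   : ∀ {e x y} → e ∈ makers p → Joins e x y → rep x ≡ rep y
      distinctB  : Unique (breakers p)
      fewB       : length (breakers p) ≤ b * i
      rounds     : a′ * i + #active rep ≤ n + r
      r≤a′       : r ≤ a′
      potential  : ∀ J → Unique J → (∀ {v} → v ∈ J → Candidate rep v) →
                   a′ * S p J ≤ length J * G (length J) + b * r

  adjacent-sym : ∀ {E : List (Edge n)} {x y} → Adjacent E x y → Adjacent E y x
  adjacent-sym (e , e∈ , inj₁ (p , q)) = e , e∈ , inj₂ (p , q)
  adjacent-sym (e , e∈ , inj₂ (p , q)) = e , e∈ , inj₁ (p , q)

  relabel : Fin n → Fin n → Fin n → Fin n
  relabel v t s with s Fin.≟ v
  ... | yes _ = t
  ... | no  _ = s

  relabel-≡ : ∀ v t → relabel v t v ≡ t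
  relabel-≡ v t with v Fin.≟ v
  ... | yes _  = refl
  ... | no v≢v = contradiction refl v≢v

  relabel-≢ : ∀ {v s} t → s ≢ v → relabel v t s ≡ s
  relabel-≢ {v} {s} t s≢v with s Fin.≟ v
  ... | yes s≡v = contradiction s≡v s≢v
  ... | no _    = refl

  -- Removing from j + 1 vertices one of at least average degree costs at most
  -- the j edges from it to the others, which the summand a′ of G j pays for.
  module _ {r′ s s′ d j} (s≤ : s ≤ j * d) (s+d≤ : s + d ≤ s′ + j)
           (s′≤ : a′ * s′ ≤ suc j * G (suc j) + b * suc r′)
           (step : suc j * G (suc j) + b + suc j * a′ ≤ suc j * G j) where
    open +-*-Solver
    open ℕ.≤-Reasoning

    average : a′ * s ≤ j * G j + b * r′
    average = ℕ.*-cancelˡ-≤ (suc j) (begin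
      suc j * (a′ * s)                                        ≡⟨ solve 3 (λ j a s → (con 1 :+ j) :* (a :* s) := j :* (a :* s) :+ a :* s) refl j a′ s ⟩
      j * (a′ * s) + a′ * s                                   ≤⟨ ℕ.+-monoʳ-≤ (j * (a′ * s)) (ℕ.*-monoʳ-≤ a′ s≤) ⟩
      j * (a′ * s) + a′ * (j * d)                             ≡⟨ solve 4 (λ j a s d → j :* (a :* s) :+ a :* (j :* d) := j :* (a :* (s :+ d))) refl j a′ s d ⟩
      j * (a′ * (s + d))                                      ≤⟨ ℕ.*-monoʳ-≤ j (ℕ.*-monoʳ-≤ a′ s+d≤) ⟩
      j * (a′ * (s′ + j))                                     ≡⟨ solve 3 (λ j a s → j :* (a :* (s :+ j)) := j :* (a :* s :+ a :* j)) refl j a′ s′ ⟩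
      j * (a′ * s′ + a′ * j)                                  ≤⟨ ℕ.*-monoʳ-≤ j (ℕ.+-monoˡ-≤ (a′ * j) s′≤) ⟩
      j * (suc j * G (suc j) + b * suc r′ + a′ * j)           ≤⟨ ℕ.m≤m+n _ (j * a′ + b * r′) ⟩
      j * (suc j * G (suc j) + b * suc r′ + a′ * j) + (j * a′ + b * r′)
                                                              ≡⟨ solve 5 (λ j a b g r → j :* ((con 1 :+ j) :* g :+ b :* (con 1 :+ r) :+ a :* j) :+ (j :* a :+ b :* r)
                                                                   := j :* ((con 1 :+ j) :* g :+ b :+ (con 1 :+ j) :* a) :+ (con 1 :+ j) :* (b :* r)) refl j a′ b (G (suc j)) r′ ⟩
      j * (suc j * G (suc j) + b + suc j * a′) + suc j * (b * r′)
                                                              ≤⟨ ℕ.+-monoˡ-≤ (suc j * (b * r′)) (ℕ.*-monoʳ-≤ j step) ⟩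
      j * (suc j * G j) + suc j * (b * r′)                    ≡⟨ solve 4 (λ j g b r → j :* ((con 1 :+ j) :* g) :+ (con 1 :+ j) :* (b :* r) := (con 1 :+ j) :* (j :* g :+ b :* r)) refl j (G j) b r′ ⟩
      suc j * (j * G j + b * r′)                              ∎)

  module Merge {p rep i r} (inv : Invariant p rep i r) {v w z e}
               (cand : Candidate rep v) (max : ∀ {u} → Candidate rep u → degree p u ≤ degree p v)
               (w∈ : rep w ≡ v) (z∉ : rep z ≢ v) (joins : Joins e w z) where
    open Invariant inv

    t = rep z

    -- The merged component keeps the active vertex of the side that was reached; `v`, of largest
    -- degree, is the one given up.
    rep′ : Fin n → Fin n
    rep′ x = relabel v t (rep x)

    p′ : Position
    p′ = claim maker (e ∷ []) p

    lift : ∀ {x y} → Star (Adjacent (makers p)) x y → Star (Adjacent (makers p′)) x y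
    lift = Star.map λ (e , e∈ , j) → e , there e∈ , j

    rep′-fixed⇒≢v : ∀ {x} → rep′ x ≡ x → x ≢ v
    rep′-fixed⇒≢v fixed refl = z∉ (trans (sym (relabel-≡ v t)) (trans (cong (relabel v t) (sym (proj₁ cand))) fixed))

    rep′-fixed⇒rep-fixed : ∀ {x} → rep′ x ≡ x → rep x ≡ x
    rep′-fixed⇒rep-fixed {x} fixed with rep x Fin.≟ v
    ... | no _  = fixed
    ... | yes q = contradiction (trans (sym (idempotent z)) (trans (cong rep fixed) q)) z∉

    class-grows : ∀ {x} → x ≢ v → length (class rep x) ≤ length (class rep′ x)
    class-grows {x} x≢v = count-mono (inClass? rep x) (inClass? rep′ x) (allFin n)
      λ { _ refl → relabel-≢ t x≢v }

    candidate-shrinks : ∀ {x} → Candidate rep′ x → Candidate rep x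
    candidate-shrinks (fixed , small) = rep′-fixed⇒rep-fixed fixed ,
      ℕ.≤-trans (ℕ.+-mono-≤ (class-grows (rep′-fixed⇒≢v fixed)) (class-grows (rep′-fixed⇒≢v fixed))) small

    #active-decreases : #active rep′ < #active rep
    #active-decreases = count-mono-< (active? rep′) (active? rep) (allFin n) (λ _ → rep′-fixed⇒rep-fixed)
      (∈-allFin v) (λ fixed → rep′-fixed⇒≢v fixed refl) (proj₁ cand)

    reaches′ : ∀ x → Star (Adjacent (makers p′)) x (rep′ x)
    reaches′ x with rep x Fin.≟ v
    ... | no _  = lift (reaches x)
    ... | yes q = subst (Star _ x) q (lift (reaches x))
              ◅◅ Star.reverse adjacent-sym (subst (Star _ w) w∈ (lift (reaches w)))
              ◅◅ joins⇒adjacent (here refl) joins ◅ lift (reaches z)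

    idempotent′ : ∀ x → rep′ (rep′ x) ≡ rep′ x
    idempotent′ x with rep x Fin.≟ v
    ... | yes _   = trans (cong (relabel v t) (idempotent z)) (relabel-≢ t z∉)
    ... | no rx≢v = trans (cong (relabel v t) (idempotent x)) (relabel-≢ t rx≢v)

    respects′ : ∀ {e′ x y} → e′ ∈ makers p′ → Joins e′ x y → rep′ x ≡ rep′ y
    respects′ (there e′∈)  j = cong (relabel v t) (respects e′∈ j)
    respects′ (here refl)  j with joins-endpoints j joins
    ... | inj₁ (refl , refl) = trans (trans (cong (relabel v t) w∈) (relabel-≡ v t)) (sym (relabel-≢ t z∉))
    ... | inj₂ (refl , refl) = sym (trans (trans (cong (relabel v t) w∈) (relabel-≡ v t)) (sym (relabel-≢ t z∉)))

    rounds′ : ∀ r → a′ * i + #active rep ≤ n + r → a′ * i + #active rep′ ≤ n + (r ∸ 1)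
    rounds′ zero     h = ℕ.≤-trans (ℕ.+-monoʳ-≤ (a′ * i) (ℕ.<⇒≤ #active-decreases)) h
    rounds′ (suc r′) h = ℕ.≤-pred (ℕ.≤-trans (ℕ.≤-reflexive (sym (ℕ.+-suc (a′ * i) _)))
      (ℕ.≤-trans (ℕ.+-monoʳ-≤ (a′ * i) #active-decreases) (ℕ.≤-trans h (ℕ.≤-reflexive (ℕ.+-suc n r′)))))

    open ℕ.≤-Reasoning

    -- Each charged move has used up an active vertex, so `rounds` admits about n/a′ rounds and
    -- hence about b n/a′ edges of Breaker.
    fewB′ : ∀ {r′} → a′ * i + #active rep′ ≤ n + r′ → a′ * length (breakers p) ≤ b * n + b * r′
    fewB′ {r′} h = begin
      a′ * length (breakers p)      ≤⟨ ℕ.*-monoʳ-≤ a′ fewB ⟩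
      a′ * (b * i)                  ≡⟨ +-*-Solver.solve 3 (λ a b i → a :* (b :* i) := b :* (a :* i)) refl a′ b i ⟩
      b * (a′ * i)                  ≤⟨ ℕ.*-monoʳ-≤ b (ℕ.≤-trans (ℕ.m≤m+n (a′ * i) _) h) ⟩
      b * (n + r′)                  ≡⟨ ℕ.*-distribˡ-+ b n r′ ⟩
      b * n + b * r′                ∎
      where open +-*-Solver using (_:*_; _:=_)

    -- Maker's edge leaves S unchanged, and before the merge `v` could still be adjoined to `J`, so
    -- the old bound for one more vertex applies. All of `J` were candidates then, with degree at
    -- most that of `v`, which makes `v` a vertex of at least average degree. The fall from
    -- `b * suc r` to `b * r` is what this deactivation pays. With no charged moves left, the bound
    -- survives because every new candidate is an old one.
    potential′ : ∀ r → a′ * i + #active rep ≤ n + r →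
      (∀ J → Unique J → (∀ {x} → x ∈ J → Candidate rep x) → a′ * S p J ≤ length J * G (length J) + b * r) →
      ∀ J → Unique J → (∀ {x} → x ∈ J → Candidate rep′ x) →
      a′ * S p J ≤ length J * G (length J) + b * (r ∸ 1)
    potential′ zero    _ pot J uniq cands = pot J uniq (candidate-shrinks ∘ cands)
    potential′ (suc r) h pot []         uniq cands = ℕ.≤-trans
      (ℕ.≤-reflexive (trans (cong (a′ *_) (S-[] p)) (ℕ.*-zeroʳ a′))) z≤n
    potential′ (suc r) h pot J@(x ∷ J′) uniq cands with G-step (length J) (s≤s z≤n)
    ... | inj₁ large = begin
      a′ * S p J                           ≤⟨ ℕ.*-monoʳ-≤ a′ (List.length-filter (touchesAny? J) (breakers p)) ⟩
      a′ * length (breakers p)             ≤⟨ fewB′ (rounds′ (suc r) h) ⟩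
      b * n + b * r                        ≤⟨ ℕ.+-monoˡ-≤ (b * r) large ⟩
      length J * G (length J) + b * r      ∎
    ... | inj₂ step = average (S≤length*d p J (max ∘ candidate-shrinks ∘ cands)) (S+degree≤ p v J v∉J distinctB)
      (pot (v ∷ J) (All.tabulate (λ x∈J v≡x → v∉J (subst (_∈ J) (sym v≡x) x∈J)) AllPairs.∷ uniq)
        λ { (here refl) → cand ; (there x∈) → candidate-shrinks (cands x∈) })
      step
      where
      v∉J : v ∉ J
      v∉J v∈J = rep′-fixed⇒≢v (proj₁ (cands v∈J)) refl

    merged : Invariant p′ rep′ i (r ∸ 1)
    merged = record
      { reaches    = reaches′
      ; idempotent = idempotent′
      ; respects   = respects′
      ; distinctB  = distinctB
      ; fewB       = fewB
      ; rounds     = rounds′ r rounds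
      ; r≤a′       = ℕ.≤-trans (ℕ.m∸n≤m r 1) r≤a′
      ; potential  = potential′ r rounds potential
      }

  module _ {p rep i r} (inv : Invariant p rep i r) where
    open Invariant inv
    open ℕ.≤-Reasoning

    -- A full cut around the class C of v would give n ∸ ∣C∣ ≤ degree v and
    -- ∣C∣ (n ∸ ∣C∣) ≤ ∣breakers∣, hence a′ n ≤ 4 b + a′ degree v.
    cut-not-full : ∀ {v c z} → Candidate rep v → c + z ≡ n → c + c ≤ n →
                   z ≤ degree p v → ¬ c * z ≤ length (breakers p)
    cut-not-full {v} {c} {z} cand c+z≡n c+c≤n z≤d cz≤ = ℕ.<⇒≱ G-small (begin
      a′ * n                                       ≡⟨ cong (a′ *_) c+z≡n ⟨
      a′ * (c + z)                                 ≡⟨ ℕ.*-distribˡ-+ a′ c z ⟩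
      a′ * c + a′ * z                              ≤⟨ ℕ.+-mono-≤ a′c≤ (ℕ.≤-trans (ℕ.*-monoʳ-≤ a′ z≤d) a′d≤) ⟩
      4 * b + (G 1 + b * a′)                       ≡⟨ ℕ.+-comm (4 * b) _ ⟩
      G 1 + b * a′ + 4 * b                         ∎)
      where
      open +-*-Solver
      a′d≤ : a′ * degree p v ≤ G 1 + b * a′
      a′d≤ = begin
        a′ * degree p v          ≤⟨ ℕ.*-monoʳ-≤ a′ (degree≤S p v) ⟩
        a′ * S p (v ∷ [])        ≤⟨ potential (v ∷ []) ([] AllPairs.∷ AllPairs.[]) (λ { (here refl) → cand }) ⟩
        1 * G 1 + b * r          ≤⟨ ℕ.+-mono-≤ (ℕ.≤-reflexive (ℕ.*-identityˡ (G 1))) (ℕ.*-monoʳ-≤ b r≤a′) ⟩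
        G 1 + b * a′             ∎
      n≤2z : n ≤ 2 * z
      n≤2z = ℕ.+-cancelˡ-≤ n n (2 * z) (begin
        n + n                    ≡⟨ cong₂ _+_ c+z≡n c+z≡n ⟨
        (c + z) + (c + z)        ≡⟨ solve 2 (λ c z → (c :+ z) :+ (c :+ z) := (c :+ c) :+ con 2 :* z) refl c z ⟩
        (c + c) + 2 * z          ≤⟨ ℕ.+-monoˡ-≤ (2 * z) c+c≤n ⟩
        n + 2 * z                ∎)
      instance
        n≢0 : ℕ.NonZero n
        n≢0 = ℕ.>-nonZero (ℕ.≤-<-trans z≤n (Fin.toℕ<n v))
      a′c≤ : a′ * c ≤ 4 * b
      a′c≤ = ℕ.*-cancelʳ-≤ (a′ * c) (4 * b) n (begin
        a′ * c * n                   ≤⟨ ℕ.*-monoʳ-≤ (a′ * c) n≤2z ⟩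
        a′ * c * (2 * z)             ≡⟨ solve 3 (λ a c z → a :* c :* (con 2 :* z) := con 2 :* a :* (c :* z)) refl a′ c z ⟩
        2 * a′ * (c * z)             ≤⟨ ℕ.*-monoʳ-≤ (2 * a′) (ℕ.≤-trans cz≤ fewB) ⟩
        2 * a′ * (b * i)             ≡⟨ solve 3 (λ a b i → con 2 :* a :* (b :* i) := con 2 :* b :* (a :* i)) refl a′ b i ⟩
        2 * b * (a′ * i)             ≤⟨ ℕ.*-monoʳ-≤ (2 * b) (ℕ.≤-trans (ℕ.m≤m+n (a′ * i) _)
                                          (ℕ.≤-trans rounds (ℕ.+-monoʳ-≤ n (ℕ.≤-trans r≤a′ a′≤n)))) ⟩
        2 * b * (n + n)              ≡⟨ solve 2 (λ b n → con 2 :* b :* (n :+ n) := con 4 :* b :* n) refl b n ⟩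
        4 * b * n                    ∎)

    crossing-unclaimed : ∀ {w z e} → rep w ≢ rep z → Joins e w z → e ∉ breakers p → Free p e
    crossing-unclaimed rw≢rz j e∉B e∈ with ∈-++⁻ (makers p) e∈
    ... | inj₁ e∈M = rw≢rz (respects e∈M j)
    ... | inj₂ e∈B = e∉B e∈B

    -- Maker's edges stay inside classes, so without a free edge the whole cut around the class
    -- would be Breaker's. It contains all edges from `v` to the outside, which bounds the size of
    -- the outside by the degree of `v`; both counts together contradict `cut-not-full`.
    outgoing : ∀ {v} → Candidate rep v →
      ∃[ w ] ∃[ z ] ∃[ e ] rep w ≡ v × rep z ≢ v × Joins e w z × Free p e
    outgoing {v} cand with any? (λ e → ¬? (e ∈? breakers p)) (allBetween (class rep v) (complement rep v))
    ... | yes found =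
      let (e , e∈ , e∉B)        = find found
          (w , z , w∈ , z∈ , j) = ∈-allBetween⁻ e∈
          rw≡v                  = proj₂ (∈-filter⁻ (inClass? rep v) {xs = allFin n} w∈)
          rz≢v                  = proj₂ (∈-filter⁻ (λ x → ¬? (inClass? rep v x)) {xs = allFin n} z∈)
      in w , z , e , rw≡v , rz≢v , j , crossing-unclaimed (λ rw≡rz → rz≢v (trans (sym rw≡rz) rw≡v)) j e∉B
    ... | no none = contradiction
      (cut-size uniqC uniqZ C-disjoint-Z full)
      (cut-not-full cand
        (trans (count-complement (inClass? rep v) (allFin n)) (List.length-tabulate id))
        (proj₂ cand)
        (ℕ.≤-trans (ℕ.≤-reflexive (sym (ℕ.*-identityˡ _)))
          (cut-size {W = v ∷ []} ([] AllPairs.∷ AllPairs.[]) uniqZ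
            (λ { (here refl) → C-disjoint-Z v∈C })
            (λ { (here refl) z∈ j → ∈-filter⁺ (touches? v) (full v∈C z∈ j) (joins⇒touchesˡ j) }))))
      where
      uniqC : Unique (class rep v)
      uniqC = Unique.filter⁺ (inClass? rep v) (Unique.allFin⁺ n)
      uniqZ : Unique (complement rep v)
      uniqZ = Unique.filter⁺ (λ x → ¬? (inClass? rep v x)) (Unique.allFin⁺ n)
      v∈C : v ∈ class rep v
      v∈C = ∈-filter⁺ (inClass? rep v) (∈-allFin v) (proj₁ cand)
      C-disjoint-Z : ∀ {w} → w ∈ class rep v → w ∉ complement rep v
      C-disjoint-Z w∈C w∈Z = proj₂ (∈-filter⁻ (λ x → ¬? (inClass? rep v x)) {xs = allFin n} w∈Z)
        (proj₂ (∈-filter⁻ (inClass? rep v) {xs = allFin n} w∈C))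
      full : ∀ {e w z} → w ∈ class rep v → z ∈ complement rep v → Joins e w z → e ∈ breakers p
      full {e} w∈ z∈ j = decidable-stable (e ∈? breakers p) λ e∉B →
        none (lose (∈-allBetween w∈ z∈ j) e∉B)

    -- Of two distinct classes the smaller has at most half of the vertices, which makes its active
    -- vertex a candidate.
    no-candidates⇒connected : (∀ v → ¬ Candidate rep v) → Connected (makers p)
    no-candidates⇒connected none x y = subst (Star _ x) rx≡ry (reaches x) ◅◅ Star.reverse adjacent-sym (reaches y)
      where
      c = length (class rep (rep x))
      d = length (class rep (rep y))
      rx≡ry : rep x ≡ rep y
      rx≡ry = decidable-stable (rep x Fin.≟ rep y) λ rx≢ry →
        let c+d≤n = ℕ.≤-trans
              (count-disjoint (inClass? rep (rep x)) (inClass? rep (rep y)) (allFin n)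
                λ p q _ → rx≢ry (trans (sym p) q))
              (ℕ.≤-reflexive (List.length-tabulate id))
        in smaller c+d≤n (ℕ.≤-total c d)
        where
        smaller : c + d ≤ n → ¬ (c ≤ d ⊎ d ≤ c)
        smaller h (inj₁ c≤d) = none (rep x) (idempotent x , ℕ.≤-trans (ℕ.+-monoʳ-≤ c c≤d) h)
        smaller h (inj₂ d≤c) = none (rep y) (idempotent y , ℕ.≤-trans (ℕ.+-monoˡ-≤ d d≤c) h)

    maxCandidate : (∀ v → ¬ Candidate rep v) ⊎
                   ∃[ v ] Candidate rep v × (∀ {u} → Candidate rep u → degree p u ≤ degree p v)
    maxCandidate with any? (candidate? rep) (allFin n)
    ... | no none = inj₁ λ v cand → none (lose (∈-allFin v) cand)
    ... | yes some with find some
    ... | v₀ , _ , cand₀ = inj₂ (v , cand , λ cand′ → All.lookup (Extrema.f[xs]≤f[argmax] {f = degree p} v₀ candidates) (∈-filter⁺ (candidate? rep) (∈-allFin _) cand′))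
      where
      candidates = filter (candidate? rep) (allFin n)
      v = Extrema.argmax (degree p) v₀ candidates
      cand : Candidate rep v
      cand = Extrema.argmax-all (degree p) cand₀ (All.tabulate (proj₂ ∘ ∈-filter⁻ (candidate? rep) {xs = allFin n}))

  Reached : Position → List (Edge n) → Set
  Reached p xs = Unique xs × All (Free p) xs

  -- A move of Maker is planned edge by edge: `xs` collects the edges chosen so far, and invariants
  -- refer to the intermediate position in which they are already claimed. In the case `connected`
  -- the move may be too short and is padded afterwards.
  data Turn (p : Position) (rep : Fin n → Fin n) (i : ℕ) : Set where
    connected : ∀ {xs} → Reached p xs → length xs ≤ a → Connected (makers (claim maker xs p)) → Turn p rep i
    continue  : ∀ {xs rep′} → Reached p xs → length xs ≡ a → Invariant (claim maker xs p) rep′ i 0 →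
                #active rep′ < #active rep → Turn p rep i

  free-∷ : ∀ {p xs e} → Reached p xs → Free (claim maker xs p) e → Reached p (e ∷ xs)
  free-∷ {p} {xs} (uniq , free) fe =
    All.tabulate (λ x∈ e≡x → fe (claim⁺ˡ maker xs p (subst (_∈ xs) (sym e≡x) x∈))) AllPairs.∷ uniq ,
    (λ e∈ → fe (claim⁺ʳ maker xs p e∈)) ∷ free

  -- `t` edges of the move remain to be chosen. The last argument records that any edge chosen so
  -- far has lowered the number of active vertices since the start of the move; as `0 < a`, a
  -- completed move falls under its second case.
  turn : ∀ t {p rep₀ rep i xs} → Reached p xs → length xs + t ≡ a →
         Invariant (claim maker xs p) rep i (a′ ∸ length xs) →
         (xs ≡ [] × rep ≡ rep₀) ⊎ #active rep < #active rep₀ → Turn p rep₀ i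
  turn t {p} {xs = xs} reached len inv fewer with maxCandidate inv
  ... | inj₁ none = connected reached (ℕ.≤-trans (ℕ.m≤m+n (length xs) t) (ℕ.≤-reflexive len))
                      (no-candidates⇒connected inv none)
  turn zero {xs = xs} reached len inv fewer | inj₂ _ with trans (sym (ℕ.+-identityʳ (length xs))) len
  ... | len′ = continue reached len′
      (subst (Invariant _ _ _) (trans (cong (a′ ∸_) len′) (ℕ.m≤n⇒m∸n≡0 a′≤a)) inv) (progress fewer)
    where
    progress : _ → _
    progress (inj₁ (refl , _)) = contradiction len′ (ℕ.<⇒≢ 0<a)
    progress (inj₂ lt)         = lt
  turn (suc t) {p} {rep₀} {rep} {i} {xs} reached len inv fewer | inj₂ (v , cand , max) with outgoing inv cand
  ... | w , z , e , w∈ , z∉ , j , fe = turn t (free-∷ {p} reached fe) (trans (sym (ℕ.+-suc (length xs) t)) len)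
      (subst (Invariant _ _ i) r≡ merged) (inj₂ (fewer′ fewer))
    where
    open Merge inv cand max w∈ z∉ j using (merged; #active-decreases; rep′)
    r≡ : a′ ∸ length xs ∸ 1 ≡ a′ ∸ suc (length xs)
    r≡ = trans (ℕ.∸-+-assoc a′ (length xs) 1) (cong (a′ ∸_) (ℕ.+-comm (length xs) 1))
    fewer′ : (xs ≡ [] × rep ≡ rep₀) ⊎ #active rep < #active rep₀ → #active rep′ < #active rep₀
    fewer′ (inj₁ (_ , refl)) = #active-decreases
    fewer′ (inj₂ lt)         = ℕ.<-trans #active-decreases lt

  -- S grows by at most `b`, hence a′·S by at most a′·b, which is exactly the excess that resetting
  -- the counter from 0 to `a′` permits.
  breakerMoved : ∀ {p rep i xs} → Invariant p rep i 0 → Legal breaker p xs →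
                 Invariant (claim breaker xs p) rep (suc i) a′
  breakerMoved {p} {rep} {i} {xs} inv legal = record
    { reaches    = reaches
    ; idempotent = idempotent
    ; respects   = respects
    ; distinctB  = Unique.++⁺ (Legal.distinct legal) distinctB λ (x∈xs , x∈B) →
                     All.lookup (Legal.unclaimed legal) x∈xs (∈-++⁺ʳ (makers p) x∈B)
    ; fewB       = begin
        length (xs ++ breakers p)            ≡⟨ List.length-++ xs ⟩
        length xs + length (breakers p)      ≤⟨ ℕ.+-mono-≤ (legal-size legal) fewB ⟩
        b + b * i                            ≡⟨ ℕ.*-suc b i ⟨
        b * suc i                            ∎
    ; rounds     = begin
        a′ * suc i + #active rep             ≡⟨ cong (_+ #active rep) (ℕ.*-suc a′ i) ⟩
        a′ + a′ * i + #active rep            ≡⟨ ℕ.+-assoc a′ (a′ * i) _ ⟩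
        a′ + (a′ * i + #active rep)          ≤⟨ ℕ.+-monoʳ-≤ a′ rounds ⟩
        a′ + (n + 0)                         ≡⟨ cong (a′ +_) (ℕ.+-identityʳ n) ⟩
        a′ + n                               ≡⟨ ℕ.+-comm a′ n ⟩
        n + a′                               ∎
    ; r≤a′       = ℕ.≤-refl
    ; potential  = λ J uniq cands → begin
        a′ * S (claim breaker xs p) J        ≡⟨ cong (a′ *_) (count-++ (touchesAny? J) xs (breakers p)) ⟩
        a′ * (count (touchesAny? J) xs + S p J)
                                             ≤⟨ ℕ.*-monoʳ-≤ a′ (ℕ.+-monoˡ-≤ (S p J)
                                                  (ℕ.≤-trans (List.length-filter (touchesAny? J) xs) (legal-size legal))) ⟩
        a′ * (b + S p J)                     ≡⟨ ℕ.*-distribˡ-+ a′ b (S p J) ⟩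
        a′ * b + a′ * S p J                  ≤⟨ ℕ.+-monoʳ-≤ (a′ * b) (potential J uniq cands) ⟩
        a′ * b + (length J * G (length J) + b * 0)
                                             ≡⟨ solve 3 (λ a b g → a :* b :+ (g :+ b :* con 0) := g :+ b :* a) refl a′ b (length J * G (length J)) ⟩
        length J * G (length J) + b * a′     ∎
    }
    where
    open Invariant inv
    open ℕ.≤-Reasoning
    open +-*-Solver

  connected-⊆ : ∀ {E F : List (Edge n)} → E ⊆ F → Connected E → Connected F
  connected-⊆ E⊆F conn x y = Star.map (λ (e , e∈ , j) → e , E⊆F e∈ , j) (conn x y)

  0<bias : ∀ P → 0 < biases a b P
  0<bias maker   = 0<a
  0<bias breaker = 0<b

  stays-connected : ∀ {p} Q {xs} → Connected (makers p) → Legal Q p xs → Connected (makers (claim Q xs p))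
  stays-connected maker {xs} conn _ = connected-⊆ (∈-++⁺ʳ xs) conn
  stays-connected breaker    conn _ = conn

  connected⇒won : ∀ p → Connected (makers p) → Won maker p
  connected⇒won p conn = makers p , id , conn

  open Secured 0<bias maker (Connected ∘ makers) stays-connected connected⇒won

  -- Rounds that do not yet connect Maker's graph deactivate vertices, so `f`, a bound on the active
  -- ones, makes the recursion stop.
  wins : ∀ f {p rep i} → Invariant p rep i 0 → #active rep ≤ f → WinningToReply maker p
  wins f {p} {rep} inv h = reply λ ys legal → respond f h (turn a {rep₀ = rep} (AllPairs.[] , []) refl (breakerMoved inv legal) (inj₁ (refl , refl)))
    where
    respond : ∀ f {p i} → #active rep ≤ f → Turn p rep i → WinningToMove maker p
    respond f {p} h (connected {xs} (uniq , free) len conn) with extend maker p uniq free len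
    ... | ys , xs⊆ys , legal = move ys legal (toReply _ _ ℕ.≤-refl (connected-⊆ grow conn))
      where
      grow : xs ++ makers p ⊆ ys ++ makers p
      grow e∈ with ∈-++⁻ xs e∈
      ... | inj₁ e∈xs = ∈-++⁺ˡ (xs⊆ys e∈xs)
      ... | inj₂ e∈M  = ∈-++⁺ʳ ys e∈M
    respond zero    h (continue _ _ _ lt) = contradiction (ℕ.≤-trans lt h) λ ()
    respond (suc f) h (continue {xs} (uniq , free) len inv lt) = move xs
      (record { distinct = uniq ; unclaimed = free ; size = inj₁ len })
      (wins f inv (ℕ.≤-pred (ℕ.≤-trans lt h)))

  initial : Invariant start id 0 0
  initial = record
    { reaches    = λ _ → ε
    ; idempotent = λ _ → refl
    ; respects   = λ ()
    ; distinctB  = AllPairs.[]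
    ; fewB       = z≤n
    ; rounds     = ℕ.≤-trans (ℕ.≤-reflexive (cong (_+ #active id) (ℕ.*-zeroʳ a′)))
        (ℕ.≤-trans (List.length-filter (active? id) (allFin n))
          (ℕ.≤-reflexive (trans (List.length-tabulate id) (sym (ℕ.+-identityʳ n)))))
    ; r≤a′       = z≤n
    ; potential  = λ _ _ _ → ℕ.≤-trans (ℕ.≤-reflexive (ℕ.*-zeroʳ a′)) z≤n
    }

  makerWins : MakerWins a b n
  makerWins = wins _ initial ℕ.≤-refl

-- The number of edges Breaker can take at one vertex while Maker spoils a
-- vertices per round, starting from a R + 1 vertices.
boxes : (a b R : ℕ) → ℕ
boxes a b zero    = b
boxes a b (suc R) = b / suc (a ℕ.* suc R) ℕ.+ boxes a b R

-- Breaker's strategy: growing and shrinking a clique.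

module BreakerStrategy {n a b : ℕ} (0<a : 0 ℕ.< a) (0<b : 0 ℕ.< b) (1<n : 1 ℕ.< n) where

  open import Relation.Binary.Construct.Closure.ReflexiveTransitive using (ε)
  open ℕSolver using (module +-*-Solver)
  open import Data.Nat using (_+_; _*_; _∸_; _≤_; _<_)
  open Edges {n}
  open Lists
  open MakerBreaker (ContainsConnectedSpanningSubgraph {n}) (biases a b)
  open Play _≟_ edges edges-unique edges-complete (ContainsConnectedSpanningSubgraph {n}) (biases a b)
  open DecMembership (Fin._≟_ {n}) using (_∈?_)

  Untouched : Position → Fin n → Set
  Untouched p v = ∀ {e} → e ∈ makers p → ¬ Touches v e

  Isolated : Position → Fin n → Set
  Isolated p v = Untouched p v × (∀ {e} → Touches v e → e ∈ claimed p)

  otherVertex : ∀ {m} → 1 < m → (v : Fin m) → ∃[ w ] v ≢ w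
  otherVertex (s≤s (s≤s _)) Fin.zero    = Fin.suc Fin.zero , λ ()
  otherVertex (s≤s (s≤s _)) (Fin.suc _) = Fin.zero , λ ()

  isolated⇒won : ∀ v p → Isolated p v → Won breaker p
  isolated⇒won v p (untouched , _) (T , T⊆M , conn) with otherVertex 1<n v
  ... | w , v≢w = stuck v≢w (conn v w)
    where
    stuck : ∀ {w} → v ≢ w → ¬ Star (Adjacent T) v w
    stuck v≢v ε                                           = v≢v refl
    stuck _   ((e , e∈ , inj₁ (refl , _)) ◅ _)            = untouched (T⊆M e∈) atᵘ
    stuck _   ((e , e∈ , inj₂ (_ , refl)) ◅ _)            = untouched (T⊆M e∈) atᵛ

  untouched-maker : ∀ {p v xs} → Untouched p v → (∀ {e} → e ∈ xs → ¬ Touches v e) → Untouched (claim maker xs p) v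
  untouched-maker {xs = xs} untouched untouched′ e∈ with ∈-++⁻ xs e∈
  ... | inj₁ e∈xs = untouched′ e∈xs
  ... | inj₂ e∈M  = untouched e∈M

  0<bias : ∀ P → 0 < biases a b P
  0<bias maker   = 0<a
  0<bias breaker = 0<b

  stays-isolated : ∀ v {p} Q {xs} → Isolated p v → Legal Q p xs → Isolated (claim Q xs p) v
  stays-isolated v {p} maker   {xs} (untouched , full) legal =
    untouched-maker {p} {v} {xs} untouched (λ e∈ t → All.lookup (Legal.unclaimed legal) e∈ (full t)) ,
    claim⁺ʳ maker xs p ∘ full
  stays-isolated v {p} breaker {xs} (untouched , full) _     = untouched , claim⁺ʳ breaker xs p ∘ full

  module Isolate (v : Fin n) =
    Secured 0<bias breaker (λ p → Isolated p v) (stays-isolated v) (isolated⇒won v)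

  -- `joined` asks only for claimed edges; since no edge of Maker touches `Q`, they are Breaker's.
  record Clique (p : Position) (Q : List (Fin n)) : Set where
    field
      distinct  : Unique Q
      untouched : ∀ {v} → v ∈ Q → Untouched p v
      joined    : ∀ {x y e} → x ∈ Q → y ∈ Q → Joins e x y → e ∈ claimed p

  -- Every edge that touches two vertices of the clique is taken, so each of
  -- Maker's edges spoils at most one vertex.
  survivors : ∀ {p Q ys} k → Clique p Q → Legal maker p ys → k + a ≤ length Q →
              ∃[ Q′ ] Q′ ⊆ Q × length Q′ ≡ k × Clique (claim maker ys p) Q′
  survivors {p} {Q} {ys} k clique legal k+a≤ = Q′ , Q′⊆Q , length-take k≤ , record
    { distinct  = Unique.take⁺ k (Unique.filter⁺ (λ v → ¬? (hit? v)) distinct)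
    ; untouched = λ v∈ → untouched-maker {p} {xs = ys} (untouched (Q′⊆Q v∈)) λ e∈ t →
        proj₂ (∈-filter⁻ (λ v → ¬? (hit? v)) {xs = Q} (take-⊆ k _ v∈)) (lose e∈ t)
    ; joined    = λ x∈ y∈ j → claim⁺ʳ maker ys p (joined (Q′⊆Q x∈) (Q′⊆Q y∈) j)
    }
    where
    open Clique clique
    open ℕ.≤-Reasoning
    hit? : ∀ v → Dec (Any (Touches v) ys)
    hit? v = any? (touches? v) ys
    Q₁ = filter (λ v → ¬? (hit? v)) Q
    Q′ = take k Q₁
    Q′⊆Q : Q′ ⊆ Q
    Q′⊆Q v∈ = proj₁ (∈-filter⁻ (λ v → ¬? (hit? v)) (take-⊆ k Q₁ v∈))
    hits≤ : count hit? Q ≤ length ys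
    hits≤ = injective⇒length≤ (λ v e → Touches v e × Free p e) (Unique.filter⁺ hit? distinct)
      (λ v∈ → let (e , e∈ , t) = find (proj₂ (∈-filter⁻ hit? {xs = Q} v∈))
              in e , e∈ , t , All.lookup (Legal.unclaimed legal) e∈)
      (λ x∈ x′∈ (t , free) (t′ , _) → same (proj₁ (∈-filter⁻ hit? x∈)) (proj₁ (∈-filter⁻ hit? x′∈)) free t t′)
      where
      same : ∀ {x x′ e} → x ∈ Q → x′ ∈ Q → Free p e → Touches x e → Touches x′ e → x ≡ x′
      same {x} {x′} x∈ x′∈ free t t′ with x Fin.≟ x′
      ... | yes x≡x′ = x≡x′
      ... | no  x≢x′ = contradiction (joined x∈ x′∈ (touches-both x≢x′ t t′)) free
    k≤ : k ≤ length Q₁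
    k≤ = ℕ.+-cancelʳ-≤ (length ys) k (length Q₁) (begin
      k + length ys                    ≤⟨ ℕ.+-monoʳ-≤ k (legal-size legal) ⟩
      k + a                            ≤⟨ k+a≤ ⟩
      length Q                         ≡⟨ count-complement hit? Q ⟨
      count hit? Q + length Q₁         ≤⟨ ℕ.+-monoˡ-≤ (length Q₁) hits≤ ⟩
      length ys + length Q₁            ≡⟨ ℕ.+-comm (length ys) _ ⟩
      length Q₁ + length ys            ∎)

  clique-breaker : ∀ {p Q xs} → Clique p Q → Clique (claim breaker xs p) Q
  clique-breaker {p} {xs = xs} clique = record
    { distinct  = distinct
    ; untouched = untouched
    ; joined    = λ x∈ y∈ j → claim⁺ʳ breaker xs p (joined x∈ y∈ j)
    }
    where open Clique clique

  freeAt? : ∀ p v e → Dec (Touches v e × Free p e)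
  freeAt? p v e = touches? v e ×-dec free? p e

  freeAt : Position → Fin n → List (Edge n)
  freeAt p v = filter (freeAt? p v) edges

  freeAt-unique : ∀ p v → Unique (freeAt p v)
  freeAt-unique p v = Unique.filter⁺ (freeAt? p v) edges-unique

  freeAt-claim : ∀ P xs p v → length (freeAt (claim P xs p) v) ≤ length (freeAt p v)
  freeAt-claim P xs p v = count-mono (freeAt? (claim P xs p) v) (freeAt? p v) edges
    λ { _ (t , free) → t , free ∘ claim⁺ʳ P xs p }

  length-freeAt : ∀ p v → length (freeAt p v) ≤ n
  length-freeAt p v = ℕ.≤-trans
    (injective⇒length≤ (λ e w → Joins e v w) {ys = allFin n} (freeAt-unique p v)
      (λ e∈ → let (w , j) = touches⇒joins (proj₁ (proj₂ (∈-filter⁻ (freeAt? p v) {xs = edges} e∈)))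
              in w , ∈-allFin w , j)
      λ _ _ → joins-unique)
    (ℕ.≤-reflexive (List.length-tabulate id))

  finish : ∀ {p Q v} → Clique p Q → v ∈ Q → length (freeAt p v) ≤ b → WinningToMove breaker p
  finish {p} {v = v} clique v∈ len with cover breaker p (freeAt p v) len
  ... | ys , legal , covered = move ys legal (Isolate.toReply v _ _ ℕ.≤-refl (Clique.untouched clique v∈ , full))
    where
    full : ∀ {e} → Touches v e → e ∈ claimed (claim breaker ys p)
    full {e} t = ¬free⇒claimed (claim breaker ys p) λ free →
      free (covered (∈-filter⁺ (freeAt? p v) (edges-complete e) (t , free ∘ claim⁺ʳ breaker ys p)))

  -- `M` bounds the edges still free at any vertex of the clique, and `boxes a b R` is what Breaker
  -- can still take at the vertex that survives to the end. One round lowers both by the same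
  -- quotient `k`, rounded down so that `k` edges at each of the a(R + 1) + 1 vertices cost at most
  -- `b`. At a vertex with fewer than `k` free edges all of them are taken.
  shrink : ∀ R {M p Q} → Clique p Q → length Q ≡ suc (a * R) →
           (∀ {v} → v ∈ Q → length (freeAt p v) ≤ M) → M ≤ boxes a b R → WinningToMove breaker p
  shrink zero    {Q = v ∷ _} clique _   deg M≤ = finish clique (here refl) (ℕ.≤-trans (deg (here refl)) M≤)
  shrink (suc R) {M} {p} {Q} clique len deg M≤ with cover breaker p (concatMap (take k ∘ freeAt p) Q) cost
    where
    k = b / suc (a * suc R)
    cost : length (concatMap (take k ∘ freeAt p) Q) ≤ b
    cost = ℕ.≤-trans (length-concatMap-≤ (take k ∘ freeAt p) Q λ v →
        ℕ.≤-trans (ℕ.≤-reflexive (List.length-take k (freeAt p v))) (ℕ.m⊓n≤m k _))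
      (ℕ.≤-trans (ℕ.≤-reflexive (trans (cong (_* k) len) (ℕ.*-comm (suc (a * suc R)) k)))
        (m/n*n≤m b (suc (a * suc R))))
  ... | xs , legal , covered = move xs legal (reply λ ys legal′ →
      let (Q′ , Q′⊆Q , len′ , clique′) = survivors (suc (a * R)) (clique-breaker {xs = xs} clique) legal′ enough
      in shrink R clique′ len′ (λ v∈ → ℕ.≤-trans (freeAt-claim maker ys p₁ _) (deg′ (Q′⊆Q v∈))) M∸k≤)
    where
    k = b / suc (a * suc R)
    p₁ = claim breaker xs p
    enough : suc (a * R) + a ≤ length Q
    enough = ℕ.≤-reflexive (sym (trans len (cong suc (trans (ℕ.*-suc a R) (ℕ.+-comm a (a * R))))))
    M∸k≤ : M ∸ k ≤ boxes a b R
    M∸k≤ = ℕ.≤-trans (ℕ.∸-monoˡ-≤ k M≤) (ℕ.≤-reflexive (ℕ.m+n∸m≡n k (boxes a b R)))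
    deg′ : ∀ {v} → v ∈ Q → length (freeAt p₁ v) ≤ M ∸ k
    deg′ {v} v∈ = begin
      length (freeAt p₁ v)             ≤⟨ unique-⊆⇒length≤ (freeAt-unique p₁ v) remains ⟩
      length (drop k (freeAt p v))     ≡⟨ List.length-drop k (freeAt p v) ⟩
      length (freeAt p v) ∸ k          ≤⟨ ℕ.∸-monoˡ-≤ k (deg v∈) ⟩
      M ∸ k                            ∎
      where
      open ℕ.≤-Reasoning
      remains : freeAt p₁ v ⊆ drop k (freeAt p v)
      remains e∈ with ∈-filter⁻ (freeAt? p₁ v) {xs = edges} e∈
      ... | _ , t , free with ∈-take-or-drop k (∈-filter⁺ (freeAt? p v) (edges-complete _) (t , free ∘ claim⁺ʳ breaker xs p))
      ... | inj₁ e∈take = contradiction (covered (∈-concatMap⁺ (take k ∘ freeAt p) (lose v∈ e∈take))) free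
      ... | inj₂ e∈drop = e∈drop

  -- While the clique grows to `q` vertices, Maker has at most a·q edges with 2·a·q ends; `room`
  -- leaves `suc a` vertices besides those ends and the clique. `cheap` pays for joining the new
  -- vertices to each other and to the clique in one move.
  module _ (R : ℕ) (n≤boxes : n ≤ boxes a b R)
           (room : suc (a * R) + 2 * a * suc (a * R) + suc a ≤ n)
           (cheap : suc a * (suc a + suc (a * R)) ≤ b) where
    q = suc (a * R)

    module Extension {i p Q} (i<q : i < q) (clique : Clique p Q) (len : length Q ≡ i)
                     (made : length (makers p) ≤ a * i) where
      open Clique clique
      open ℕ.≤-Reasoning

      fresh? : ∀ v → Dec (¬ Any (Touches v) (makers p) × v ∉ Q)
      fresh? v = ¬? (any? (touches? v) (makers p)) ×-dec ¬? (v ∈? Q)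

      candidates N : List (Fin n)
      candidates = filter fresh? (allFin n)
      N          = take (suc a) candidates

      ends : Edge n → List (Fin n)
      ends e = Edge.u e ∷ Edge.v e ∷ []

      ∈-ends : ∀ {v e} → Touches v e → v ∈ ends e
      ∈-ends atᵘ = here refl
      ∈-ends atᵛ = there (here refl)

      spent : List (Fin n)
      spent = Q ++ concatMap ends (makers p)

      spent-or-fresh : allFin n ⊆ candidates ++ spent
      spent-or-fresh {v} v∈ with v ∈? Q
      ... | yes v∈Q = ∈-++⁺ʳ candidates (∈-++⁺ˡ v∈Q)
      ... | no  v∉Q with any? (touches? v) (makers p)
      ... | yes hit = ∈-++⁺ʳ candidates (∈-++⁺ʳ Q (∈-concatMap⁺ ends (Any.map ∈-ends hit)))
      ... | no ¬hit = ∈-++⁺ˡ (∈-filter⁺ fresh? v∈ (¬hit , v∉Q))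

      length-spent : length spent ≤ q + 2 * a * q
      length-spent = begin
        length spent                                      ≡⟨ List.length-++ Q ⟩
        length Q + length (concatMap ends (makers p))     ≤⟨ ℕ.+-mono-≤ (ℕ.≤-trans (ℕ.≤-reflexive len) (ℕ.<⇒≤ i<q))
                                                               (length-concatMap-≤ ends (makers p) (λ _ → ℕ.≤-refl)) ⟩
        q + length (makers p) * 2                         ≤⟨ ℕ.+-monoʳ-≤ q (ℕ.*-monoˡ-≤ 2 (ℕ.≤-trans made (ℕ.*-monoʳ-≤ a (ℕ.<⇒≤ i<q)))) ⟩
        q + a * q * 2                                     ≡⟨ cong (q +_) (solve 2 (λ a q → a :* q :* con 2 := con 2 :* a :* q) refl a q) ⟩
        q + 2 * a * q                                     ∎
        where open +-*-Solver

      length-N : length N ≡ suc a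
      length-N = length-take {xs = candidates} (ℕ.+-cancelˡ-≤ (q + 2 * a * q) (suc a) (length candidates) (begin
        q + 2 * a * q + suc a                ≤⟨ room ⟩
        n                                    ≡⟨ List.length-tabulate id ⟨
        length (allFin n)                    ≤⟨ unique-⊆⇒length≤ (Unique.allFin⁺ n) spent-or-fresh ⟩
        length (candidates ++ spent)         ≡⟨ List.length-++ candidates ⟩
        length candidates + length spent     ≤⟨ ℕ.+-monoʳ-≤ (length candidates) length-spent ⟩
        length candidates + (q + 2 * a * q)  ≡⟨ ℕ.+-comm (length candidates) _ ⟩
        q + 2 * a * q + length candidates    ∎))

      N-fresh : ∀ {v} → v ∈ N → ¬ Any (Touches v) (makers p) × v ∉ Q
      N-fresh v∈ = proj₂ (∈-filter⁻ fresh? {xs = allFin n} (take-⊆ (suc a) candidates v∈))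

      length-N++Q : length (N ++ Q) ≡ suc a + i
      length-N++Q = trans (List.length-++ N) (cong₂ _+_ length-N len)

      cost : length (allBetween N (N ++ Q)) ≤ b
      cost = begin
        length (allBetween N (N ++ Q))       ≤⟨ length-allBetween N (N ++ Q) ⟩
        length N * length (N ++ Q)           ≡⟨ cong₂ _*_ length-N length-N++Q ⟩
        suc a * (suc a + i)                  ≤⟨ ℕ.*-monoʳ-≤ (suc a) (ℕ.+-monoʳ-≤ (suc a) (ℕ.<⇒≤ i<q)) ⟩
        suc a * (suc a + q)                  ≤⟨ cheap ⟩
        b                                    ∎

      extended : ∀ {xs} → (∀ {e} → e ∈ allBetween N (N ++ Q) → e ∈ claimed (claim breaker xs p)) →
                 Clique (claim breaker xs p) (N ++ Q)
      extended {xs} covered = record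
        { distinct  = Unique.++⁺ (Unique.take⁺ (suc a) (Unique.filter⁺ fresh? (Unique.allFin⁺ n))) distinct
                        λ (v∈N , v∈Q) → proj₂ (N-fresh v∈N) v∈Q
        ; untouched = untouched′ ∘ ∈-++⁻ N
        ; joined    = λ x∈ y∈ j → joined′ (∈-++⁻ N x∈) (∈-++⁻ N y∈) j
        }
        where
        untouched′ : ∀ {v} → v ∈ N ⊎ v ∈ Q → Untouched p v
        untouched′ (inj₁ v∈N) e∈ t = proj₁ (N-fresh v∈N) (lose e∈ t)
        untouched′ (inj₂ v∈Q)      = untouched v∈Q
        joined′ : ∀ {x y e} → x ∈ N ⊎ x ∈ Q → y ∈ N ⊎ y ∈ Q → Joins e x y → e ∈ claimed (claim breaker xs p)
        joined′ (inj₁ x∈N) (inj₁ y∈N) j = covered (∈-allBetween x∈N (∈-++⁺ˡ y∈N) j)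
        joined′ (inj₁ x∈N) (inj₂ y∈Q) j = covered (∈-allBetween x∈N (∈-++⁺ʳ N y∈Q) j)
        joined′ (inj₂ x∈Q) (inj₁ y∈N) j = covered (∈-allBetween y∈N (∈-++⁺ʳ N x∈Q) (joins-sym j))
        joined′ (inj₂ x∈Q) (inj₂ y∈Q) j = claim⁺ʳ breaker xs p (joined x∈Q y∈Q j)

    grow : ∀ g i {p Q} → g + i ≡ q → Clique p Q → length Q ≡ i → length (makers p) ≤ a * i →
           WinningToMove breaker p
    grow zero    i {p} i≡q clique len _ =
      shrink R clique (trans len i≡q) (λ {v} _ → length-freeAt p v) n≤boxes
    grow (suc g) i {p} {Q} eq clique len made = play (cover breaker p (allBetween N (N ++ Q)) cost)
      where
      open Extension (ℕ.≤-trans (s≤s (ℕ.m≤n+m i g)) (ℕ.≤-reflexive eq)) clique len made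
      play : ∃[ xs ] Legal breaker p xs × (∀ {e} → e ∈ allBetween N (N ++ Q) → e ∈ claimed (claim breaker xs p)) →
             WinningToMove breaker p
      play (xs , legal , covered) = move xs legal (reply λ ys legal′ →
        let (Q′ , _ , len′ , clique′) = survivors (suc i) (extended covered) legal′
              (ℕ.≤-reflexive (trans (cong suc (ℕ.+-comm i a)) (sym length-N++Q)))
        in grow g (suc i) (trans (ℕ.+-suc g i) eq) clique′ len′ (made′ ys legal′))
        where
        made′ : ∀ ys → Legal maker (claim breaker xs p) ys → length (ys ++ makers p) ≤ a * suc i
        made′ ys legal′ = ℕ.≤-trans (ℕ.≤-reflexive (List.length-++ ys))
          (ℕ.≤-trans (ℕ.+-mono-≤ (legal-size legal′) made) (ℕ.≤-reflexive (sym (ℕ.*-suc a i))))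

    breakerWins : BreakerWins a b n
    breakerWins = grow q 0 (ℕ.+-identityʳ q)
      (record { distinct = AllPairs.[] ; untouched = λ () ; joined = λ () }) refl z≤n

  -- A single vertex is a clique on an empty board, and one move takes all of its edges.
  breakerWins-at-once : n ≤ b → BreakerWins a b n
  breakerWins-at-once n≤b = finish {Q = v₀ ∷ []}
    (record { distinct  = [] AllPairs.∷ AllPairs.[]
            ; untouched = λ _ ()
            ; joined    = λ { (here refl) (here refl) j → contradiction refl (joins⇒≢ j) } })
    (here refl) (ℕ.≤-trans (length-freeAt start v₀) n≤b)
    where
    v₀ : Fin n
    v₀ = Fin.fromℕ< (ℕ.<-trans (s≤s z≤n) 1<n)

-- Finite sums of natural numbers.

sum< : ℕ → (ℕ → ℕ) → ℕ
sum< zero    f = 0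
sum< (suc n) f = sum< n f ℕ.+ f n

sum<-suc : ∀ n f → sum< (suc n) f ≡ f 0 ℕ.+ sum< n (f ∘ suc)
sum<-suc zero    f = sym (ℕ.+-identityʳ (f 0))
sum<-suc (suc n) f = trans (cong (ℕ._+ f (suc n)) (sum<-suc n f)) (ℕ.+-assoc (f 0) _ _)

sum<-cong : ∀ n {f g} → (∀ i → f i ≡ g i) → sum< n f ≡ sum< n g
sum<-cong zero    h = refl
sum<-cong (suc n) h = cong₂ ℕ._+_ (sum<-cong n h) (h n)

sum<-mono : ∀ n {f g} → (∀ i → f i ℕ.≤ g i) → sum< n f ℕ.≤ sum< n g
sum<-mono zero    h = z≤n
sum<-mono (suc n) h = ℕ.+-mono-≤ (sum<-mono n h) (h n)

sum<-const : ∀ n c → sum< n (λ _ → c) ≡ n ℕ.* c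
sum<-const zero    c = refl
sum<-const (suc n) c = trans (cong (ℕ._+ c) (sum<-const n c)) (ℕ.+-comm (n ℕ.* c) c)

sum<-+ : ∀ m n f → sum< (m ℕ.+ n) f ≡ sum< m f ℕ.+ sum< n (λ i → f (m ℕ.+ i))
sum<-+ m zero    f = trans (cong (λ k → sum< k f) (ℕ.+-identityʳ m)) (sym (ℕ.+-identityʳ _))
sum<-+ m (suc n) f = trans (cong (λ k → sum< k f) (ℕ.+-suc m n))
  (trans (cong (ℕ._+ f (m ℕ.+ n)) (sum<-+ m n f)) (ℕ.+-assoc (sum< m f) _ _))

sum<-distrib : ∀ n f g → sum< n (λ i → f i ℕ.+ g i) ≡ sum< n f ℕ.+ sum< n g
sum<-distrib zero    f g = refl
sum<-distrib (suc n) f g = trans (cong (ℕ._+ (f n ℕ.+ g n)) (sum<-distrib n f g))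
  (interchange (sum< n f) (sum< n g) (f n) (g n))
  where
  interchange : ∀ a b c d → a ℕ.+ b ℕ.+ (c ℕ.+ d) ≡ a ℕ.+ c ℕ.+ (b ℕ.+ d)
  interchange = ℕ.solve-∀

sum<-extend : ∀ {m n} f → m ℕ.≤ n → sum< m f ℕ.≤ sum< n f
sum<-extend {m} f m≤n = subst (λ k → sum< m f ℕ.≤ sum< k f) (ℕ.m+[n∸m]≡n m≤n)
  (ℕ.≤-trans (ℕ.m≤m+n (sum< m f) _) (ℕ.≤-reflexive (sym (sum<-+ m _ f))))

-- Harmonic sums and the integer logarithm.

module Harmonic where
  open import Data.Rational using (_+_; _*_; _≤_; _<_)
  open Rational
  open ℚSolver.+-*-Solver

  0≤fromℕ : ∀ n → 0ℚ ≤ fromℕ n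
  0≤fromℕ n = 0≤/ n 0

  fromℕ-suc : ∀ n → fromℕ (suc n) ≡ 1ℚ + fromℕ n
  fromℕ-suc n = fromℕ-+ 1 n

  fromℕ-cancel : ∀ {m n} → fromℕ m < 1ℚ + fromℕ n → m ℕ.≤ n
  fromℕ-cancel {m} {n} lt with m ℕ.≤? n
  ... | yes m≤n = m≤n
  ... | no  m≰n = contradiction (ℚ.<-≤-trans lt (subst (_≤ fromℕ m) (fromℕ-suc n) (fromℕ-mono (ℕ.≰⇒> m≰n)))) (ℚ.<-irrefl refl)

  fromℕ-cancel-≤ : ∀ {m n} → fromℕ m ≤ fromℕ n → m ℕ.≤ n
  fromℕ-cancel-≤ {m} {n} h = fromℕ-cancel (ℚ.≤-<-trans h
    (subst (_< 1ℚ + fromℕ n) (ℚ.+-identityˡ (fromℕ n)) (ℚ.+-monoˡ-< (fromℕ n) (ℚ.positive⁻¹ 1ℚ))))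

  *-monoʳ : ∀ {p q} r → 0ℚ ≤ r → p ≤ q → p * r ≤ q * r
  *-monoʳ r 0≤r = ℚ.*-monoʳ-≤-nonNeg r {{ℚ.nonNegative 0≤r}}

  *-monoˡ : ∀ {p q} r → 0ℚ ≤ r → p ≤ q → r * p ≤ r * q
  *-monoˡ r 0≤r = ℚ.*-monoˡ-≤-nonNeg r {{ℚ.nonNegative 0≤r}}

  *-suc-*-recip : ∀ q t → fromℕ (q ℕ.* suc t) * recip t ≡ fromℕ q
  *-suc-*-recip q t = begin
    fromℕ (q ℕ.* suc t) * recip t          ≡⟨ cong (_* recip t) (fromℕ-* q (suc t)) ⟩
    fromℕ q * fromℕ (suc t) * recip t      ≡⟨ solve 3 (λ q s r → q :* s :* r := q :* (r :* s)) refl (fromℕ q) (fromℕ (suc t)) (recip t) ⟩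
    fromℕ q * (recip t * fromℕ (suc t))    ≡⟨ cong (fromℕ q *_) (recip*suc t) ⟩
    fromℕ q * 1ℚ                           ≡⟨ ℚ.*-identityʳ (fromℕ q) ⟩
    fromℕ q                                ∎
    where open ≡-Reasoning

  quotient≤ : ∀ b t → fromℕ (b / suc t) ≤ fromℕ b * recip t
  quotient≤ b t = subst (_≤ fromℕ b * recip t) (*-suc-*-recip (b / suc t) t)
    (*-monoʳ (recip t) (ℚ.<⇒≤ (0<recip t)) (fromℕ-mono (m/n*n≤m b (suc t))))

  ≤quotient+1 : ∀ b t → fromℕ b * recip t ≤ fromℕ (suc (b / suc t))
  ≤quotient+1 b t = subst (fromℕ b * recip t ≤_) (*-suc-*-recip (suc (b / suc t)) t)
    (*-monoʳ (recip t) (ℚ.<⇒≤ (0<recip t)) (fromℕ-mono (begin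
      b                                          ≡⟨ m≡m%n+[m/n]*n b (suc t) ⟩
      b % suc t ℕ.+ b / suc t ℕ.* suc t          ≤⟨ ℕ.+-monoˡ-≤ _ (ℕ.<⇒≤ (m%n<n b (suc t))) ⟩
      suc (b / suc t) ℕ.* suc t                  ∎)))
    where open ℕ.≤-Reasoning

  fromℕ-sum : ∀ n f → fromℕ (sum< n f) ≡ ∑< n (fromℕ ∘ f)
  fromℕ-sum zero    f = refl
  fromℕ-sum (suc n) f = trans (fromℕ-+ (sum< n f) (f n)) (cong (_+ fromℕ (f n)) (fromℕ-sum n f))

  *-∑ : ∀ n c f → ∑< n (λ i → c * f i) ≡ c * ∑< n f
  *-∑ zero    c f = sym (ℚ.*-zeroʳ c)
  *-∑ (suc n) c f = trans (cong (_+ c * f n) (*-∑ n c f)) (sym (ℚ.*-distribˡ-+ c (∑< n f) (f n)))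

  0≤∑ : ∀ n {f} → (∀ i → 0ℚ ≤ f i) → 0ℚ ≤ ∑< n f
  0≤∑ zero    h = ℚ.≤-refl
  0≤∑ (suc n) h = ℚ.+-mono-≤ (0≤∑ n h) (h n)

  H : ℕ → ℚ
  H n = ∑< n recip

  H-+ : ∀ m n → H (m ℕ.+ n) ≡ H m + ∑< n (λ i → recip (m ℕ.+ i))
  H-+ m n = ∑-+ m n recip

  H-mono : ∀ {m n} → m ℕ.≤ n → H m ≤ H n
  H-mono {m} {n} m≤n = subst (λ k → H m ≤ H k) (ℕ.m+[n∸m]≡n m≤n) (begin
    H m                                                  ≡⟨ ℚ.+-identityʳ (H m) ⟨
    H m + 0ℚ                                             ≤⟨ ℚ.+-monoʳ-≤ (H m) (0≤∑ (n ℕ.∸ m) λ i → ℚ.<⇒≤ (0<recip (m ℕ.+ i))) ⟩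
    H m + ∑< (n ℕ.∸ m) (λ i → recip (m ℕ.+ i))           ≡⟨ H-+ m (n ℕ.∸ m) ⟨
    H (m ℕ.+ (n ℕ.∸ m))                                  ∎)
    where open ℚ.≤-Reasoning

  -- The m new terms lie between 1/(2m) and 1/m, so doubling the length adds at least one half and
  -- at most one. This ties harmonic sums to powers of two.
  H-double-≤ : ∀ m → H (m ℕ.+ m) ≤ H m + 1ℚ
  H-double-≤ zero    = ℚ.<⇒≤ (ℚ.positive⁻¹ 1ℚ)
  H-double-≤ (suc m) = begin
    H (suc m ℕ.+ suc m)                                       ≡⟨ H-+ (suc m) (suc m) ⟩
    H (suc m) + ∑< (suc m) (λ i → recip (suc m ℕ.+ i))        ≤⟨ ℚ.+-monoʳ-≤ (H (suc m)) (∑-mono (suc m) λ i _ →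
                                                                   recip-antimono (ℕ.≤-trans (ℕ.n≤1+n m) (ℕ.m≤m+n (suc m) i))) ⟩
    H (suc m) + ∑< (suc m) (λ _ → recip m)                    ≡⟨ cong (H (suc m) +_) (∑-const (suc m) (recip m)) ⟩
    H (suc m) + fromℕ (suc m) * recip m                       ≡⟨ cong (H (suc m) +_) (trans (ℚ.*-comm (fromℕ (suc m)) (recip m)) (recip*suc m)) ⟩
    H (suc m) + 1ℚ                                            ∎
    where open ℚ.≤-Reasoning

  H-double-≥ : ∀ m → 0 ℕ.< m → 1ℚ + fromℕ 2 * H m ≤ fromℕ 2 * H (m ℕ.+ m)
  H-double-≥ (suc m) _ = begin
    1ℚ + fromℕ 2 * H (suc m)                                  ≡⟨ ℚ.+-comm 1ℚ (fromℕ 2 * H (suc m)) ⟩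
    fromℕ 2 * H (suc m) + 1ℚ                                  ≡⟨ cong (fromℕ 2 * H (suc m) +_) one ⟨
    fromℕ 2 * H (suc m) + fromℕ 2 * (fromℕ (suc m) * r)       ≡⟨ ℚ.*-distribˡ-+ (fromℕ 2) (H (suc m)) _ ⟨
    fromℕ 2 * (H (suc m) + fromℕ (suc m) * r)                 ≤⟨ *-monoˡ (fromℕ 2) (0≤fromℕ 2) (ℚ.+-monoʳ-≤ (H (suc m)) (begin
      fromℕ (suc m) * r                                         ≡⟨ ∑-const (suc m) r ⟨
      ∑< (suc m) (λ _ → r)                                      ≤⟨ ∑-mono (suc m) (λ i i≤m → recip-antimono {suc m ℕ.+ i} (index i≤m)) ⟩
      ∑< (suc m) (λ i → recip (suc m ℕ.+ i))                    ∎)) ⟩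
    fromℕ 2 * (H (suc m) + ∑< (suc m) (λ i → recip (suc m ℕ.+ i)))
                                                              ≡⟨ cong (fromℕ 2 *_) (H-+ (suc m) (suc m)) ⟨
    fromℕ 2 * H (suc m ℕ.+ suc m)                             ∎
    where
    open ℚ.≤-Reasoning
    r = recip (m ℕ.+ 1 ℕ.* suc m)
    one : fromℕ 2 * (fromℕ (suc m) * r) ≡ 1ℚ
    one = trans (solve 3 (λ t s r → t :* (s :* r) := (t :* r) :* s) refl (fromℕ 2) (fromℕ (suc m)) r)
      (trans (cong (_* fromℕ (suc m)) (RiemannSum.k*recip 1 m)) (recip*suc m))
    index : ∀ {i} → i ℕ.< suc m → suc m ℕ.+ i ℕ.≤ m ℕ.+ 1 ℕ.* suc m
    index {i} (s≤s i≤m) = ℕ.≤-trans (ℕ.≤-reflexive (sym (ℕ.+-suc m i)))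
      (ℕ.+-monoʳ-≤ m (ℕ.≤-trans (s≤s i≤m) (ℕ.≤-reflexive (sym (ℕ.*-identityˡ (suc m))))))

  2^suc : ∀ j m → 2 ℕ.^ suc j ℕ.* m ≡ 2 ℕ.^ j ℕ.* m ℕ.+ 2 ℕ.^ j ℕ.* m
  2^suc j m = trans (ℕ.*-assoc 2 (2 ℕ.^ j) m) (cong (2 ℕ.^ j ℕ.* m ℕ.+_) (ℕ.+-identityʳ _))

  H-2^-≤ : ∀ j m → H (2 ℕ.^ j ℕ.* m) ≤ H m + fromℕ j
  H-2^-≤ zero    m = ℚ.≤-reflexive (trans (cong H (ℕ.*-identityˡ m)) (sym (ℚ.+-identityʳ (H m))))
  H-2^-≤ (suc j) m = begin
    H (2 ℕ.^ suc j ℕ.* m)                      ≡⟨ cong H (2^suc j m) ⟩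
    H (2 ℕ.^ j ℕ.* m ℕ.+ 2 ℕ.^ j ℕ.* m)        ≤⟨ H-double-≤ (2 ℕ.^ j ℕ.* m) ⟩
    H (2 ℕ.^ j ℕ.* m) + 1ℚ                     ≤⟨ ℚ.+-monoˡ-≤ 1ℚ (H-2^-≤ j m) ⟩
    H m + fromℕ j + 1ℚ                         ≡⟨ trans (ℚ.+-assoc (H m) (fromℕ j) 1ℚ) (cong (H m +_) (ℚ.+-comm (fromℕ j) 1ℚ)) ⟩
    H m + (1ℚ + fromℕ j)                       ≡⟨ cong (H m +_) (fromℕ-suc j) ⟨
    H m + fromℕ (suc j)                        ∎
    where open ℚ.≤-Reasoning

  H-2^-≥ : ∀ j → fromℕ (2 ℕ.+ j) ≤ fromℕ 2 * H (2 ℕ.^ j)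
  H-2^-≥ zero    = ℚ.≤-refl
  H-2^-≥ (suc j) = begin
    fromℕ (suc (2 ℕ.+ j))                      ≡⟨ fromℕ-suc (2 ℕ.+ j) ⟩
    1ℚ + fromℕ (2 ℕ.+ j)                       ≤⟨ ℚ.+-monoʳ-≤ 1ℚ (H-2^-≥ j) ⟩
    1ℚ + fromℕ 2 * H (2 ℕ.^ j)                 ≤⟨ H-double-≥ (2 ℕ.^ j) (ℕ.m^n>0 2 j) ⟩
    fromℕ 2 * H (2 ℕ.^ j ℕ.+ 2 ℕ.^ j)          ≡⟨ cong (λ k → fromℕ 2 * H (2 ℕ.^ j ℕ.+ k)) (ℕ.+-identityʳ (2 ℕ.^ j)) ⟨
    fromℕ 2 * H (2 ℕ.^ suc j)                  ∎
    where open ℚ.≤-Reasoning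

  -- A term between 0 and 1 raises the integer part by at most one, which allows it to be found by
  -- induction along the sum.
  floor-∑ : ∀ n f → (∀ i → 0ℚ ≤ f i) → (∀ i → f i ≤ 1ℚ) →
            ∃[ k ] fromℕ k ≤ ∑< n f × ∑< n f ≤ fromℕ (suc k)
  floor-∑ zero    f 0≤f f≤1 = 0 , ℚ.≤-refl , 0≤fromℕ 1
  floor-∑ (suc n) f 0≤f f≤1 with floor-∑ n f 0≤f f≤1
  ... | k , k≤ , ≤k+1 with ℚ.≤-total (fromℕ (suc k)) (∑< (suc n) f)
  ... | inj₁ k+1≤ = suc k , k+1≤ , (begin
        ∑< n f + f n                 ≤⟨ ℚ.+-mono-≤ ≤k+1 (f≤1 n) ⟩
        fromℕ (suc k) + 1ℚ           ≡⟨ ℚ.+-comm (fromℕ (suc k)) 1ℚ ⟩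
        1ℚ + fromℕ (suc k)           ≡⟨ fromℕ-suc (suc k) ⟨
        fromℕ (suc (suc k))          ∎)
    where open ℚ.≤-Reasoning
  ... | inj₂ ≤k+1′ = k , ℚ.≤-trans k≤ (subst (_≤ ∑< (suc n) f) (ℚ.+-identityʳ (∑< n f)) (ℚ.+-monoʳ-≤ (∑< n f) (0≤f n))) , ≤k+1′

  -- ℓ is the integer part of H n − 1 = 1/2 + ⋯ + 1/n.
  record LogFloor (n ℓ : ℕ) : Set where
    field
      ℓ≤ln  : ∀ m → fromℕ ℓ ≤ seq (ln n) m
      ln≤   : ∀ m → seq (ln n) m ≤ fromℕ (2 ℕ.+ ℓ)
      ℓ<H   : fromℕ (suc ℓ) ≤ H n
      H≤    : H n ≤ fromℕ (2 ℕ.+ ℓ)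
      tail≤ : ∑< (n ℕ.∸ 1) (λ i → recip (1 ℕ.+ i)) ≤ fromℕ (suc ℓ)

  logFloor : ∀ n → 0 ℕ.< n → ∃[ ℓ ] LogFloor n ℓ
  logFloor (suc k) _ with floor-∑ k (λ i → recip (1 ℕ.+ i)) (λ i → ℚ.<⇒≤ (0<recip (1 ℕ.+ i)))
                            (λ i → recip-antimono {0} {1 ℕ.+ i} z≤n)
  ... | ℓ , ℓ≤ , ≤ℓ+1 = ℓ , record
    { ℓ≤ln  = λ m → ℚ.≤-trans (ℚ.≤-trans ℓ≤ (ℚ.≤-reflexive (sym lower≡)))
        (subst (λ M → RiemannSum.lower k 1 ≤ RiemannSum.lower k M) (ℕ.*-identityˡ (suc m)) (RiemannSum.lower-refine k 1 m))
    ; ln≤   = λ m → ℚ.≤-trans (RiemannSum.lower-close k m 0) (ℚ.≤-trans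
        (ℚ.+-monoˡ-≤ 1ℚ (ℚ.≤-trans (ℚ.≤-reflexive lower≡) ≤ℓ+1)) (ℚ.≤-reflexive step))
    ; ℓ<H   = ℚ.≤-trans (ℚ.≤-reflexive (fromℕ-suc ℓ)) (ℚ.≤-trans (ℚ.+-monoʳ-≤ 1ℚ ℓ≤) (ℚ.≤-reflexive (sym H≡)))
    ; H≤    = ℚ.≤-trans (ℚ.≤-reflexive H≡) (ℚ.≤-trans (ℚ.+-monoʳ-≤ 1ℚ ≤ℓ+1) (ℚ.≤-reflexive (sym (fromℕ-suc (suc ℓ)))))
    ; tail≤ = ≤ℓ+1
    }
    where
    lower≡ : RiemannSum.lower k 1 ≡ ∑< k (λ i → recip (1 ℕ.+ i))
    lower≡ = cong (λ N → ∑< N (λ i → recip (1 ℕ.+ i))) (ℕ.*-identityʳ k)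
    H≡ : H (suc k) ≡ 1ℚ + ∑< k (λ i → recip (1 ℕ.+ i))
    H≡ = RiemannSum.telescope k 0
    step : fromℕ (suc ℓ) + 1ℚ ≡ fromℕ (2 ℕ.+ ℓ)
    step = trans (ℚ.+-comm (fromℕ (suc ℓ)) 1ℚ) (sym (fromℕ-suc (suc ℓ)))

  module _ {n ℓ} (log : LogFloor n ℓ) where
    open LogFloor log
    open ℚ.≤-Reasoning

    2^≤⇒≤2ℓ : ∀ {j} → 2 ℕ.^ j ℕ.≤ n → j ℕ.≤ 2 ℕ.* ℓ ℕ.+ 2
    2^≤⇒≤2ℓ {j} h = ℕ.≤-pred (ℕ.≤-pred (fromℕ-cancel-≤ (begin
      fromℕ (2 ℕ.+ j)                 ≤⟨ H-2^-≥ j ⟩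
      fromℕ 2 * H (2 ℕ.^ j)           ≤⟨ *-monoˡ (fromℕ 2) (0≤fromℕ 2) (ℚ.≤-trans (H-mono h) H≤) ⟩
      fromℕ 2 * fromℕ (2 ℕ.+ ℓ)       ≡⟨ fromℕ-* 2 (2 ℕ.+ ℓ) ⟨
      fromℕ (2 ℕ.* (2 ℕ.+ ℓ))         ≡⟨ cong fromℕ (2*[2+ℓ] ℓ) ⟩
      fromℕ (2 ℕ.+ (2 ℕ.* ℓ ℕ.+ 2))   ∎)))
      where
      2*[2+ℓ] : ∀ l → 2 ℕ.* (2 ℕ.+ l) ≡ 2 ℕ.+ (2 ℕ.* l ℕ.+ 2)
      2*[2+ℓ] = ℕ.solve-∀

    <2^⇒ℓ≤ : ∀ {j} → n ℕ.≤ 2 ℕ.^ j → ℓ ℕ.≤ j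
    <2^⇒ℓ≤ {j} h = ℕ.≤-pred (fromℕ-cancel-≤ (begin
      fromℕ (suc ℓ)                   ≤⟨ ℓ<H ⟩
      H n                             ≤⟨ H-mono (ℕ.≤-trans h (ℕ.≤-reflexive (sym (ℕ.*-identityʳ (2 ℕ.^ j))))) ⟩
      H (2 ℕ.^ j ℕ.* 1)               ≤⟨ H-2^-≤ j 1 ⟩
      H 1 + fromℕ j                   ≡⟨ fromℕ-suc j ⟨
      fromℕ (suc j)                   ∎))

    sum-quotients≤ : ∀ b {k} → k ℕ.≤ n → sum< (k ℕ.∸ 1) (λ i → b / (2 ℕ.+ i)) ℕ.≤ b ℕ.* suc ℓ
    sum-quotients≤ b {k} k≤n = ℕ.≤-trans (sum<-extend (λ i → b / (2 ℕ.+ i)) (ℕ.∸-monoˡ-≤ 1 k≤n)) (fromℕ-cancel-≤ (begin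
      fromℕ (sum< (n ℕ.∸ 1) (λ i → b / (2 ℕ.+ i)))           ≡⟨ fromℕ-sum (n ℕ.∸ 1) _ ⟩
      ∑< (n ℕ.∸ 1) (λ i → fromℕ (b / (2 ℕ.+ i)))             ≤⟨ ∑-mono (n ℕ.∸ 1) (λ i _ → quotient≤ b (1 ℕ.+ i)) ⟩
      ∑< (n ℕ.∸ 1) (λ i → fromℕ b * recip (1 ℕ.+ i))         ≡⟨ *-∑ (n ℕ.∸ 1) (fromℕ b) (λ i → recip (1 ℕ.+ i)) ⟩
      fromℕ b * ∑< (n ℕ.∸ 1) (λ i → recip (1 ℕ.+ i))         ≤⟨ *-monoˡ (fromℕ b) (0≤fromℕ b) tail≤ ⟩
      fromℕ b * fromℕ (suc ℓ)                                ≡⟨ fromℕ-* b (suc ℓ) ⟨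
      fromℕ (b ℕ.* suc ℓ)                                    ∎))

    -- The sum over reciprocals is H(a + N) - H(a), compared with H(n). The missing first a terms
    -- amount to at most j + 1 because a ≤ 2^j, and the terms beyond a + N to at most j + 1 because
    -- j + 1 doublings reach n. The summand `N` pays for rounding each quotient down.
    sum-quotients≥ : ∀ b {a N j} → a ℕ.≤ 2 ℕ.^ j → n ℕ.≤ 2 ℕ.^ suc j ℕ.* (a ℕ.+ N) →
      b ℕ.* ℓ ℕ.≤ sum< N (λ i → b / suc (a ℕ.+ i)) ℕ.+ N ℕ.+ b ℕ.* (2 ℕ.* j ℕ.+ 2)
    sum-quotients≥ b {a} {N} {j} a≤ n≤ = fromℕ-cancel-≤ (begin
      fromℕ (b ℕ.* ℓ)                                       ≡⟨ fromℕ-* b ℓ ⟩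
      fromℕ b * fromℕ ℓ                                     ≤⟨ *-monoˡ (fromℕ b) (0≤fromℕ b) ℓ≤ ⟩
      fromℕ b * (T + (D + D))                               ≡⟨ ℚ.*-distribˡ-+ (fromℕ b) T (D + D) ⟩
      fromℕ b * T + fromℕ b * (D + D)                       ≤⟨ ℚ.+-monoˡ-≤ (fromℕ b * (D + D)) bT≤ ⟩
      fromℕ (Q ℕ.+ N) + fromℕ b * (D + D)                   ≡⟨ cong (λ x → fromℕ (Q ℕ.+ N) + fromℕ b * x) D+D ⟩
      fromℕ (Q ℕ.+ N) + fromℕ b * fromℕ (2 ℕ.* j ℕ.+ 2)     ≡⟨ cong (fromℕ (Q ℕ.+ N) +_) (fromℕ-* b _) ⟨
      fromℕ (Q ℕ.+ N) + fromℕ (b ℕ.* (2 ℕ.* j ℕ.+ 2))       ≡⟨ fromℕ-+ (Q ℕ.+ N) _ ⟨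
      fromℕ (Q ℕ.+ N ℕ.+ b ℕ.* (2 ℕ.* j ℕ.+ 2))             ∎)
      where
      T = ∑< N (λ i → recip (a ℕ.+ i))
      Q = sum< N (λ i → b / suc (a ℕ.+ i))
      D = fromℕ (suc j)
      D+D : D + D ≡ fromℕ (2 ℕ.* j ℕ.+ 2)
      D+D = trans (sym (fromℕ-+ (suc j) (suc j))) (cong fromℕ (double j))
        where
        double : ∀ j → suc j ℕ.+ suc j ≡ 2 ℕ.* j ℕ.+ 2
        double = ℕ.solve-∀
      Ha≤ : H a ≤ D
      Ha≤ = begin
        H a                           ≤⟨ H-mono (ℕ.≤-trans a≤ (ℕ.≤-reflexive (sym (ℕ.*-identityʳ (2 ℕ.^ j))))) ⟩
        H (2 ℕ.^ j ℕ.* 1)             ≤⟨ H-2^-≤ j 1 ⟩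
        1ℚ + fromℕ j                  ≡⟨ fromℕ-suc j ⟨
        D                             ∎
      ℓ≤ : fromℕ ℓ ≤ T + (D + D)
      ℓ≤ = begin
        fromℕ ℓ                       ≤⟨ fromℕ-mono (ℕ.n≤1+n ℓ) ⟩
        fromℕ (suc ℓ)                 ≤⟨ ℓ<H ⟩
        H n                           ≤⟨ H-mono n≤ ⟩
        H (2 ℕ.^ suc j ℕ.* (a ℕ.+ N)) ≤⟨ H-2^-≤ (suc j) (a ℕ.+ N) ⟩
        H (a ℕ.+ N) + D               ≡⟨ cong (_+ D) (H-+ a N) ⟩
        H a + T + D                   ≤⟨ ℚ.+-monoˡ-≤ D (ℚ.+-monoˡ-≤ T Ha≤) ⟩
        D + T + D                     ≡⟨ solve 2 (λ j t → j :+ t :+ j := t :+ (j :+ j)) refl D T ⟩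
        T + (D + D)                   ∎
      bT≤ : fromℕ b * T ≤ fromℕ (Q ℕ.+ N)
      bT≤ = begin
        fromℕ b * T                                               ≡⟨ *-∑ N (fromℕ b) (λ i → recip (a ℕ.+ i)) ⟨
        ∑< N (λ i → fromℕ b * recip (a ℕ.+ i))                    ≤⟨ ∑-mono N (λ i _ → ≤quotient+1 b (a ℕ.+ i)) ⟩
        ∑< N (λ i → fromℕ (suc (b / suc (a ℕ.+ i))))              ≡⟨ fromℕ-sum N (λ i → suc (b / suc (a ℕ.+ i))) ⟨
        fromℕ (sum< N (λ i → 1 ℕ.+ b / suc (a ℕ.+ i)))            ≡⟨ cong fromℕ (sum<-distrib N (λ _ → 1) (λ i → b / suc (a ℕ.+ i))) ⟩
        fromℕ (sum< N (λ _ → 1) ℕ.+ Q)                            ≡⟨ cong (λ x → fromℕ (x ℕ.+ Q)) (trans (sum<-const N 1) (ℕ.*-identityʳ N)) ⟩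
        fromℕ (N ℕ.+ Q)                                           ≡⟨ cong fromℕ (ℕ.+-comm N Q) ⟩
        fromℕ (Q ℕ.+ N)                                           ∎

-- Biases with which Maker's potential stays small.

module MakerThreshold where
  open import Data.Nat using (_+_; _*_; _∸_; _≤_; _<_)
  open Harmonic using (LogFloor; sum-quotients≤)

  -- For j ≥ k the number of Breaker's edges bounds the potential; below k it
  -- is governed by the box game.
  module Potential (a′ b k c : ℕ) where

    -- With s = j + i, this is the price of descending from s + 1 vertices to s: the 1 rounds b/(s +
    -- 1) up, and `a′` pays for the edges counted twice.
    step : ℕ → ℕ → ℕ
    step j i = b / suc (j + i) + suc a′

    G : ℕ → ℕ
    G j = c * b + sum< (k ∸ j) (step j)

    G-step : ∀ {n} → n ≤ c * k → ∀ j → 0 < j →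
             b * n ≤ j * G j ⊎ suc j * G (suc j) + b + suc j * a′ ≤ suc j * G j
    G-step {n} n≤ck j _ with k ℕ.≤? j
    ... | yes k≤j = inj₁ (begin
      b * n                ≤⟨ ℕ.*-monoʳ-≤ b (ℕ.≤-trans n≤ck (ℕ.*-monoʳ-≤ c k≤j)) ⟩
      b * (c * j)          ≡⟨ rearrange b c j ⟩
      j * (c * b)          ≤⟨ ℕ.*-monoʳ-≤ j (ℕ.m≤m+n (c * b) _) ⟩
      j * G j              ∎)
      where
      open ℕ.≤-Reasoning
      rearrange : ∀ b c j → b * (c * j) ≡ j * (c * b)
      rearrange = ℕ.solve-∀
    ... | no  k≰j = inj₂ (begin
      suc j * G (suc j) + b + suc j * a′                        ≤⟨ ℕ.+-monoˡ-≤ (suc j * a′) (ℕ.+-monoʳ-≤ (suc j * G (suc j)) b≤) ⟩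
      suc j * G (suc j) + suc q * suc j + suc j * a′            ≡⟨ rearrange j (G (suc j)) q a′ ⟩
      suc j * (G (suc j) + (q + suc a′))                        ≡⟨ cong (suc j *_) (sym G≡) ⟩
      suc j * G j                                               ∎)
      where
      open ℕ.≤-Reasoning
      q = b / suc j
      rearrange : ∀ j g q a → suc j * g + suc q * suc j + suc j * a ≡ suc j * (g + (q + suc a))
      rearrange = ℕ.solve-∀
      b≤ : b ≤ suc q * suc j
      b≤ = ℕ.≤-trans (ℕ.≤-reflexive (m≡m%n+[m/n]*n b (suc j))) (ℕ.+-monoˡ-≤ (q * suc j) (ℕ.<⇒≤ (m%n<n b (suc j))))
      G≡ : G j ≡ G (suc j) + (q + suc a′)
      G≡ = begin-equality
        c * b + sum< (k ∸ j) (step j)                           ≡⟨ cong (λ d → c * b + sum< d (step j)) (ℕ.+-∸-assoc 1 (ℕ.≰⇒> k≰j)) ⟩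
        c * b + sum< (suc (k ∸ suc j)) (step j)                 ≡⟨ cong (c * b +_) (sum<-suc (k ∸ suc j) (step j)) ⟩
        c * b + (step j 0 + sum< (k ∸ suc j) (step j ∘ suc))    ≡⟨ cong₂ (λ x y → c * b + (x + y))
                                                                     (cong (λ x → b / suc x + suc a′) (ℕ.+-identityʳ j))
                                                                     (sum<-cong (k ∸ suc j) (λ i → cong (λ x → b / suc x + suc a′) (ℕ.+-suc j i))) ⟩
        c * b + (q + suc a′ + sum< (k ∸ suc j) (step (suc j)))  ≡⟨ swap (c * b) (q + suc a′) _ ⟩
        c * b + sum< (k ∸ suc j) (step (suc j)) + (q + suc a′)  ∎
        where
        swap : ∀ x y z → x + (y + z) ≡ x + z + y
        swap = ℕ.solve-∀

    G1≤ : ∀ {n ℓ} → LogFloor n ℓ → k ≤ n → 0 < a′ → G 1 ≤ c * b + (b * suc ℓ + k * (2 * a′))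
    G1≤ {n} {ℓ} log k≤n 0<a′ = ℕ.+-monoʳ-≤ (c * b) (begin
      sum< (k ∸ 1) (step 1)                                              ≡⟨ sum<-distrib (k ∸ 1) (λ i → b / (2 + i)) (λ _ → suc a′) ⟩
      sum< (k ∸ 1) (λ i → b / (2 + i)) + sum< (k ∸ 1) (λ _ → suc a′)     ≤⟨ ℕ.+-mono-≤ (sum-quotients≤ log b k≤n)
                                                                              (ℕ.≤-reflexive (sum<-const (k ∸ 1) (suc a′))) ⟩
      b * suc ℓ + (k ∸ 1) * suc a′                                       ≤⟨ ℕ.+-monoʳ-≤ (b * suc ℓ) (ℕ.*-mono-≤ (ℕ.m∸n≤m k 1)
                                                                              (ℕ.≤-trans (ℕ.+-monoˡ-≤ a′ 0<a′) (ℕ.≤-reflexive (double a′)))) ⟩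
      b * suc ℓ + k * (2 * a′)                                           ∎)
      where
      open ℕ.≤-Reasoning
      double : ∀ x → x + x ≡ 2 * x
      double = ℕ.solve-∀

  -- The last hypothesis reads b (a′ + ℓ + 22 E) ≤ (1 - 3/(4E)) a′ n. The cutoff k = n/(8E) keeps
  -- the price of double counting, 2 a′ k, within a′ n/(4E). It forces c = 16 E, as only n ≤ 16 E k
  -- is certain after rounding. The term 22 E collects this 16 E, the 1 of `suc ℓ` and the 4 of
  -- `4 * b`.
  makerWins-below : ∀ {n ℓ a a′ b} e → let E = suc e in LogFloor n ℓ → 0 < a′ → a′ ≤ a → a′ ≤ n → 0 < b →
    8 * E ≤ n → 4 * E * (b * (a′ + ℓ + 22 * E)) + 3 * (a′ * n) ≤ 4 * E * (a′ * n) → MakerWins a b n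
  makerWins-below {n} {ℓ} {a} {a′} {b} e log 0<a′ a′≤a a′≤n 0<b 8E≤n bound =
    MakerStrategy.makerWins {n} {a} {b} {a′} (ℕ.≤-trans 0<a′ a′≤a) 0<b a′≤a a′≤n G (G-step n≤16Ek)
      (ℕ.≤-<-trans (ℕ.+-monoˡ-≤ (4 * b) (ℕ.+-monoˡ-≤ (b * a′) (G1≤ log k≤n 0<a′))) small)
    where
    E = suc e
    k = n / (8 * E)
    open Potential a′ b k (16 * E)
    open ℕ.≤-Reasoning
    8Ek≤n : k * (8 * E) ≤ n
    8Ek≤n = m/n*n≤m n (8 * E)
    k≤n : k ≤ n
    k≤n = ℕ.≤-trans (ℕ.m≤m*n k (8 * E)) 8Ek≤n
    n≤16Ek : n ≤ 16 * E * k
    n≤16Ek = begin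
      n                                    ≡⟨ m≡m%n+[m/n]*n n (8 * E) ⟩
      n % (8 * E) + k * (8 * E)            ≤⟨ ℕ.+-monoˡ-≤ (k * (8 * E)) (ℕ.<⇒≤ (m%n<n n (8 * E))) ⟩
      8 * E + k * (8 * E)                  ≤⟨ ℕ.+-monoˡ-≤ (k * (8 * E)) (ℕ.m≤n*m (8 * E) k {{ℕ.>-nonZero (m≥n⇒m/n>0 8E≤n)}}) ⟩
      k * (8 * E) + k * (8 * E)            ≡⟨ lem E k ⟩
      16 * E * k                           ∎
      where
      lem : ∀ E k → k * (8 * E) + k * (8 * E) ≡ 16 * E * k
      lem = ℕ.solve-∀
    small : 16 * E * b + (b * suc ℓ + k * (2 * a′)) + b * a′ + 4 * b < a′ * n
    small = ℕ.*-cancelˡ-< (4 * E) _ _ (begin-strict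
      4 * E * (16 * E * b + (b * suc ℓ + k * (2 * a′)) + b * a′ + 4 * b)     ≤⟨ ℕ.m≤m+n _ (4 * E * (b * (1 + 6 * e))) ⟩
      4 * E * (16 * E * b + (b * suc ℓ + k * (2 * a′)) + b * a′ + 4 * b) + 4 * E * (b * (1 + 6 * e))
                                                                           ≡⟨ lem e b a′ ℓ k ⟩
      4 * E * (b * (a′ + ℓ + 22 * E)) + a′ * (k * (8 * E))                 ≤⟨ ℕ.+-monoʳ-≤ _ (ℕ.*-monoʳ-≤ a′ 8Ek≤n) ⟩
      4 * E * (b * (a′ + ℓ + 22 * E)) + a′ * n                             <⟨ ℕ.+-monoʳ-< (4 * E * (b * (a′ + ℓ + 22 * E))) (ℕ.m<m+n (a′ * n) (ℕ.≤-trans 0<a′n (ℕ.m≤m+n _ _))) ⟩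
      4 * E * (b * (a′ + ℓ + 22 * E)) + 3 * (a′ * n)                       ≤⟨ bound ⟩
      4 * E * (a′ * n)                                                     ∎)
      where
      0<a′n : 0 < a′ * n
      0<a′n = ℕ.*-mono-≤ 0<a′ (ℕ.≤-trans 0<a′ a′≤n)
      lem : ∀ e b a l k →
        4 * suc e * (16 * suc e * b + (b * suc l + k * (2 * a)) + b * a + 4 * b) + 4 * suc e * (b * (1 + 6 * e))
        ≡ 4 * suc e * (b * (a + l + 22 * suc e)) + a * (k * (8 * suc e))
      lem = ℕ.solve-∀

  -- Three quarters of the slack a n/E in the last hypothesis are passed on. The last quarter
  -- absorbs 22 E: from b ℓ ≤ a n and 88 E² ≤ ℓ follows 22 E b ≤ a n/(4E).
  makerWins-small : ∀ {n ℓ a b} e → let E = suc e in LogFloor n ℓ → 0 < a → a ≤ n → 0 < b → 8 * E ≤ n →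
    88 * (E * E) ≤ ℓ → E * (b * (a + ℓ)) + a * n ≤ E * (a * n) → MakerWins a b n
  makerWins-small {n} {ℓ} {a} {b} e log 0<a a≤n 0<b 8E≤n ℓ-large bound =
    makerWins-below e log 0<a ℕ.≤-refl a≤n 0<b 8E≤n (begin
      4 * E * (b * (a + ℓ + 22 * E)) + 3 * (a * n)                ≡⟨ lem₁ E a b ℓ n ⟩
      4 * (E * (b * (a + ℓ))) + b * (88 * (E * E)) + 3 * (a * n)  ≤⟨ ℕ.+-monoˡ-≤ (3 * (a * n)) (ℕ.+-monoʳ-≤ (4 * (E * (b * (a + ℓ)))) b88≤) ⟩
      4 * (E * (b * (a + ℓ))) + a * n + 3 * (a * n)               ≡⟨ lem₂ (E * (b * (a + ℓ))) (a * n) ⟩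
      4 * (E * (b * (a + ℓ)) + a * n)                             ≤⟨ ℕ.*-monoʳ-≤ 4 bound ⟩
      4 * (E * (a * n))                                           ≡⟨ ℕ.*-assoc 4 E (a * n) ⟨
      4 * E * (a * n)                                             ∎)
    where
    E = suc e
    open ℕ.≤-Reasoning
    lem₁ : ∀ E a b l n → 4 * E * (b * (a + l + 22 * E)) + 3 * (a * n) ≡ 4 * (E * (b * (a + l))) + b * (88 * (E * E)) + 3 * (a * n)
    lem₁ = ℕ.solve-∀
    lem₂ : ∀ x y → 4 * x + y + 3 * y ≡ 4 * (x + y)
    lem₂ = ℕ.solve-∀
    b88≤ : b * (88 * (E * E)) ≤ a * n
    b88≤ = ℕ.*-cancelˡ-≤ E (begin
      E * (b * (88 * (E * E)))         ≤⟨ ℕ.*-monoʳ-≤ E (ℕ.*-monoʳ-≤ b (ℕ.≤-trans ℓ-large (ℕ.m≤n+m ℓ a))) ⟩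
      E * (b * (a + ℓ))                ≤⟨ ℕ.m≤m+n _ (a * n) ⟩
      E * (b * (a + ℓ)) + a * n        ≤⟨ bound ⟩
      E * (a * n)                      ∎)

  -- With a′ the minimum of `a` and `n`, both lower bounds make a′ so large that, since b ≤ n, the
  -- summand b (22 E + ℓ) costs at most a′ n/(4E), one quarter of the slack.
  makerWins-large : ∀ {n ℓ a b} e → let E = suc e in LogFloor n ℓ → 0 < b → 8 * E ≤ n →
    4 * E * (22 * E + ℓ) ≤ a → 4 * E * (22 * E + ℓ) ≤ n → E * b + n ≤ E * n → MakerWins a b n
  makerWins-large {n} {ℓ} {a} {b} e log 0<b 8E≤n ≤a ≤n bound =
    makerWins-below e log (ℕ.≤-trans (s≤s z≤n) large) (ℕ.m⊓n≤m a n) (ℕ.m⊓n≤n a n) 0<b 8E≤n (begin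
      4 * E * (b * (a′ + ℓ + 22 * E)) + 3 * (a′ * n)                       ≡⟨ lem₁ E a′ b ℓ n ⟩
      4 * (E * b) * a′ + b * (4 * E * (22 * E + ℓ)) + 3 * (a′ * n)         ≤⟨ ℕ.+-monoˡ-≤ (3 * (a′ * n)) (ℕ.+-monoʳ-≤ (4 * (E * b) * a′) (ℕ.*-mono-≤ b≤n large)) ⟩
      4 * (E * b) * a′ + n * a′ + 3 * (a′ * n)                             ≡⟨ lem₂ (E * b) a′ n ⟩
      4 * (E * b + n) * a′                                                 ≤⟨ ℕ.*-monoˡ-≤ a′ (ℕ.*-monoʳ-≤ 4 bound) ⟩
      4 * (E * n) * a′                                                     ≡⟨ lem₃ E n a′ ⟩
      4 * E * (a′ * n)                                                     ∎)
    where
    E = suc e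
    a′ = a ℕ.⊓ n
    open ℕ.≤-Reasoning
    large : 4 * E * (22 * E + ℓ) ≤ a′
    large = ℕ.⊓-glb ≤a ≤n
    b≤n : b ≤ n
    b≤n = ℕ.*-cancelˡ-≤ E (ℕ.≤-trans (ℕ.m≤m+n (E * b) n) bound)
    lem₁ : ∀ E a b l n → 4 * E * (b * (a + l + 22 * E)) + 3 * (a * n) ≡ 4 * (E * b) * a + b * (4 * E * (22 * E + l)) + 3 * (a * n)
    lem₁ = ℕ.solve-∀
    lem₂ : ∀ x a n → 4 * x * a + n * a + 3 * (a * n) ≡ 4 * (x + n) * a
    lem₂ = ℕ.solve-∀
    lem₃ : ∀ E n a → 4 * (E * n) * a ≡ 4 * E * (a * n)
    lem₃ = ℕ.solve-∀

-- Biases with which Breaker's clique suffices.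

module BreakerThreshold where
  open import Data.Nat using (_+_; _*_; _∸_; _^_; _≤_; _<_)
  open Harmonic using (LogFloor; sum-quotients≥; <2^⇒ℓ≤)

  -- The quotients b/t with a < t ≤ a + a R fall into R blocks of length a. In the last block of the
  -- sum for R + 1 every t is at least a (R + 1) + 1, so each quotient is at most the new term of
  -- `boxes`. The summand a b is a times the final move at the last vertex.
  sum-quotients≤boxes : ∀ a b R → a * b + sum< (a * R) (λ i → b / suc (a + i)) ≤ a * boxes a b R
  sum-quotients≤boxes a b zero    = ℕ.≤-reflexive (trans (cong (λ N → a * b + sum< N (λ i → b / suc (a + i))) (ℕ.*-zeroʳ a)) (ℕ.+-identityʳ (a * b)))
  sum-quotients≤boxes a b (suc R) = begin
    a * b + sum< (a * suc R) f                                         ≡⟨ cong (λ N → a * b + sum< N f) (trans (ℕ.*-suc a R) (ℕ.+-comm a (a * R))) ⟩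
    a * b + sum< (a * R + a) f                                         ≡⟨ cong (a * b +_) (sum<-+ (a * R) a f) ⟩
    a * b + (sum< (a * R) f + sum< a (λ i → f (a * R + i)))            ≡⟨ ℕ.+-assoc (a * b) _ _ ⟨
    a * b + sum< (a * R) f + sum< a (λ i → f (a * R + i))              ≤⟨ ℕ.+-mono-≤ (sum-quotients≤boxes a b R) (begin
      sum< a (λ i → f (a * R + i))                                       ≤⟨ sum<-mono a (λ i → /-antimono (s≤s (index i))) ⟩
      sum< a (λ _ → b / suc (a * suc R))                                 ≡⟨ sum<-const a _ ⟩
      a * (b / suc (a * suc R))                                          ∎) ⟩
    a * boxes a b R + a * (b / suc (a * suc R))                        ≡⟨ ℕ.+-comm (a * boxes a b R) _ ⟩
    a * (b / suc (a * suc R)) + a * boxes a b R                        ≡⟨ ℕ.*-distribˡ-+ a _ _ ⟨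
    a * boxes a b (suc R)                                              ∎
    where
    open ℕ.≤-Reasoning
    f : ℕ → ℕ
    f i = b / suc (a + i)
    /-antimono : ∀ {s t} → suc s ≤ suc t → b / suc t ≤ b / suc s
    /-antimono s≤t = /-monoʳ-≤ b s≤t
    index : ∀ i → a * suc R ≤ a + (a * R + i)
    index i = ℕ.≤-trans (ℕ.≤-reflexive (ℕ.*-suc a R)) (ℕ.+-monoʳ-≤ a (ℕ.m≤m+n (a * R) i))

  -- `L` is the binary logarithm of n, and `l` a small fraction of it still to be fixed; the clique
  -- gets a R + 1 vertices with R + 1 = 2^(L - l). `l-large` lets 2^l outgrow all factors polynomial
  -- in a and L, so that building the clique is cheap. `ℓ-large` keeps what is lost by starting with
  -- fewer than n vertices within 1/(4E) of b (ℓ + 2).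
  module _ {n ℓ a b L l} e (log : LogFloor n ℓ) (0<a : 0 < a) (0<b : 0 < b) (1<n : 1 < n)
           (2^L≤n : 2 ^ L ≤ n) (n≤2^L+1 : n ≤ 2 ^ suc L) (l≤L : l ≤ L)
           (ℓ-large : 4 * suc e * (2 * l + 4) ≤ ℓ + 2)
           (l-large : 6 * (suc e * suc (suc e)) * ((L + 3) * (L + 3)) ≤ 2 ^ l)
           (bound : suc (suc e) * (a * n) ≤ suc e * (b * (a + (ℓ + 2)))) where
    open ℕ.≤-Reasoning

    private
      E y R P W : ℕ
      E = suc e
      y = 2 ^ (L ∸ l)
      R = ℕ.pred y
      P = L + 3
      W = a + (ℓ + 2)

      0<y : 0 < y
      0<y = ℕ.m^n>0 2 (L ∸ l)

      1+R≡y : suc R ≡ y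
      1+R≡y = ℕ.suc-pred y {{ℕ.>-nonZero 0<y}}

      2^l*y : 2 ^ l * y ≡ 2 ^ L
      2^l*y = trans (sym (ℕ.^-distribˡ-+-* 2 l (L ∸ l))) (cong (2 ^_) (ℕ.m+[n∸m]≡n l≤L))

      2^l*y≤n : 2 ^ l * y ≤ n
      2^l*y≤n = ℕ.≤-trans (ℕ.≤-reflexive 2^l*y) 2^L≤n

      1≤P : 1 ≤ P
      1≤P = ℕ.≤-trans (s≤s z≤n) (ℕ.m≤n+m 3 L)

      1≤[1+E]P : 1 ≤ suc E * P
      1≤[1+E]P = ℕ.≤-trans 1≤P (ℕ.m≤n*m P (suc E))

      ℓ+2≤P : ℓ + 2 ≤ P
      ℓ+2≤P = ℕ.≤-trans (ℕ.+-monoˡ-≤ 2 (<2^⇒ℓ≤ log n≤2^L+1)) (ℕ.≤-reflexive (lem L))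
        where
        lem : ∀ L → suc L + 2 ≡ L + 3
        lem = ℕ.solve-∀

      an≤bW : a * n ≤ b * W
      an≤bW = ℕ.*-cancelˡ-≤ E (ℕ.≤-trans (ℕ.m≤n+m (E * (a * n)) (a * n)) bound)

      aR+1≤ay : suc (a * R) ≤ a * y
      aR+1≤ay = begin
        suc (a * R)                  ≤⟨ ℕ.+-monoˡ-≤ (a * R) 0<a ⟩
        a + a * R                    ≡⟨ ℕ.*-suc a R ⟨
        a * suc R                    ≡⟨ cong (a *_) 1+R≡y ⟩
        a * y                        ∎

      a≤ay : a ≤ a * y
      a≤ay = ℕ.m≤m*n a y {{ℕ.>-nonZero 0<y}}

      1+a≤2a : suc a ≤ 2 * a
      1+a≤2a = ℕ.≤-trans (ℕ.+-monoˡ-≤ a 0<a) (ℕ.≤-reflexive (lem a))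
        where
        lem : ∀ a → a + a ≡ 2 * a
        lem = ℕ.solve-∀

      module _ (b≤n : b ≤ n) where

        -- With b ≤ n, `bound` yields (E + 1) a ≤ E (a + ℓ + 2), hence a ≤ E (ℓ + 2). So whenever
        -- Breaker cannot win in one move, a is at most logarithmic.
        a≤EP : a ≤ E * P
        a≤EP = ℕ.≤-trans (ℕ.+-cancelʳ-≤ (E * a) a (E * (ℓ + 2)) (ℕ.*-cancelˡ-≤ n {{ℕ.>-nonZero (ℕ.<-trans (s≤s z≤n) 1<n)}} (begin
          n * (a + E * a)              ≡⟨ lem₁ n a E ⟩
          suc E * (a * n)              ≤⟨ bound ⟩
          E * (b * W)                  ≤⟨ ℕ.*-monoʳ-≤ E (ℕ.*-monoˡ-≤ W b≤n) ⟩
          E * (n * W)                  ≡⟨ lem₂ E n a (ℓ + 2) ⟩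
          n * (E * (ℓ + 2) + E * a)    ∎))) (ℕ.*-monoʳ-≤ E ℓ+2≤P)
          where
          lem₁ : ∀ n a E → n * (a + E * a) ≡ suc E * (a * n)
          lem₁ = ℕ.solve-∀
          lem₂ : ∀ E n a l → E * (n * (a + l)) ≡ n * (E * l + E * a)
          lem₂ = ℕ.solve-∀

        W≤ : W ≤ suc E * P
        W≤ = ℕ.≤-trans (ℕ.+-mono-≤ a≤EP ℓ+2≤P) (ℕ.≤-reflexive (ℕ.+-comm (E * P) P))

        6aEP≤2^l : 6 * a * (suc E * P) ≤ 2 ^ l
        6aEP≤2^l = begin
          6 * a * (suc E * P)          ≤⟨ ℕ.*-monoˡ-≤ (suc E * P) (ℕ.*-monoʳ-≤ 6 a≤EP) ⟩
          6 * (E * P) * (suc E * P)    ≡⟨ lem E P ⟩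
          6 * (E * suc E) * (P * P)    ≤⟨ l-large ⟩
          2 ^ l                        ∎
          where
          lem : ∀ E P → 6 * (E * P) * (suc E * P) ≡ 6 * (E * suc E) * (P * P)
          lem = ℕ.solve-∀

        6a≤2^l : 6 * a ≤ 2 ^ l
        6a≤2^l = ℕ.≤-trans (ℕ.m≤m*n (6 * a) (suc E * P) {{ℕ.>-nonZero 1≤[1+E]P}}) 6aEP≤2^l

        5aa≤2^l : 5 * (a * a) ≤ 2 ^ l
        5aa≤2^l = begin
          5 * (a * a)                                ≤⟨ ℕ.*-monoˡ-≤ (a * a) (ℕ.n≤1+n 5) ⟩
          6 * (a * a)                                ≡⟨ ℕ.*-assoc 6 a a ⟨
          6 * a * a                                  ≤⟨ ℕ.*-monoʳ-≤ (6 * a) (ℕ.≤-trans a≤EP (ℕ.*-monoˡ-≤ P (ℕ.n≤1+n E))) ⟩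
          6 * a * (suc E * P)                        ≤⟨ 6aEP≤2^l ⟩
          2 ^ l                                      ∎

        -- The only lower bound on b is a n/W; multiplication by (E + 1) P, which is at least W,
        -- brings it into play.
        cheap : suc a * (suc a + suc (a * R)) ≤ b
        cheap = ℕ.*-cancelʳ-≤ _ b (suc E * P) {{ℕ.>-nonZero 1≤[1+E]P}} (begin
          suc a * (suc a + suc (a * R)) * (suc E * P)    ≤⟨ ℕ.*-monoˡ-≤ (suc E * P) (ℕ.*-mono-≤ 1+a≤2a (ℕ.+-mono-≤ (ℕ.≤-trans 1+a≤2a (ℕ.*-monoʳ-≤ 2 a≤ay)) aR+1≤ay)) ⟩
          2 * a * (2 * (a * y) + a * y) * (suc E * P)    ≡⟨ lem₁ a y (suc E * P) ⟩
          a * (6 * a * (suc E * P) * y)                  ≤⟨ ℕ.*-monoʳ-≤ a (ℕ.≤-trans (ℕ.*-monoˡ-≤ y 6aEP≤2^l) 2^l*y≤n) ⟩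
          a * n                                          ≤⟨ an≤bW ⟩
          b * W                                          ≤⟨ ℕ.*-monoʳ-≤ b W≤ ⟩
          b * (suc E * P)                                ∎)
          where
          lem₁ : ∀ a y x → 2 * a * (2 * (a * y) + a * y) * x ≡ a * (6 * a * x * y)
          lem₁ = ℕ.solve-∀

        room : suc (a * R) + 2 * a * suc (a * R) + suc a ≤ n
        room = begin
          suc (a * R) + 2 * a * suc (a * R) + suc a      ≤⟨ ℕ.+-mono-≤ (ℕ.+-mono-≤ aR+1≤ay (ℕ.*-monoʳ-≤ (2 * a) aR+1≤ay)) (ℕ.≤-trans 1+a≤2a (ℕ.*-monoʳ-≤ 2 a≤ay)) ⟩
          a * y + 2 * a * (a * y) + 2 * (a * y)          ≡⟨ lem₁ a y ⟩
          (3 * a * 1 + 2 * (a * a)) * y                  ≤⟨ ℕ.*-monoˡ-≤ y (ℕ.+-monoˡ-≤ (2 * (a * a)) (ℕ.*-monoʳ-≤ (3 * a) 0<a)) ⟩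
          (3 * a * a + 2 * (a * a)) * y                  ≡⟨ cong (_* y) (lem₂ a) ⟩
          5 * (a * a) * y                                ≤⟨ ℕ.*-monoˡ-≤ y 5aa≤2^l ⟩
          2 ^ l * y                                      ≤⟨ 2^l*y≤n ⟩
          n                                              ∎
          where
          lem₁ : ∀ a y → a * y + 2 * a * (a * y) + 2 * (a * y) ≡ (3 * a * 1 + 2 * (a * a)) * y
          lem₁ = ℕ.solve-∀
          lem₂ : ∀ a → 3 * a * a + 2 * (a * a) ≡ 5 * (a * a)
          lem₂ = ℕ.solve-∀

        4Ey≤n : 4 * E * y ≤ n
        4Ey≤n = ℕ.≤-trans (ℕ.*-monoˡ-≤ y (begin
          4 * E                              ≤⟨ ℕ.*-monoˡ-≤ E (ℕ.m≤n+m 4 2) ⟩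
          6 * E                              ≤⟨ ℕ.*-monoʳ-≤ 6 (ℕ.m≤m*n E (suc E)) ⟩
          6 * (E * suc E)                    ≤⟨ ℕ.m≤m*n _ (P * P) {{ℕ.>-nonZero (ℕ.*-mono-≤ 1≤P 1≤P)}} ⟩
          6 * (E * suc E) * (P * P)          ≤⟨ l-large ⟩
          2 ^ l                              ∎)) 2^l*y≤n

        -- In other words a n + a n/(4E) + b W/(4E) ≤ b W: the advantage 1/E of Breaker leaves room
        -- for two losses, used in `main` for a y and for b (2 l + 4).
        slack : suc (4 * E) * (a * n) + b * W ≤ 4 * E * (b * W)
        slack = ℕ.*-cancelˡ-≤ E (begin
          -- The added multiple of x comes from (4E - 1)(E + 1) = E (4E + 1) + 2E - 1, which makes
          -- `bound` applicable 4E - 1 times.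
          E * (suc (4 * E) * x + w)                                ≤⟨ ℕ.m≤m+n _ (suc (2 * e) * x) ⟩
          E * (suc (4 * E) * x + w) + suc (2 * e) * x              ≡⟨ lem₁ e x w ⟩
          (3 + 4 * e) * (suc E * x) + E * w                        ≤⟨ ℕ.+-monoˡ-≤ (E * w) (ℕ.*-monoʳ-≤ (3 + 4 * e) bound) ⟩
          (3 + 4 * e) * (E * w) + E * w                            ≡⟨ lem₂ e w ⟩
          E * (4 * E * w)                                          ∎)
          where
          x = a * n
          w = b * W
          lem₁ : ∀ e x w → suc e * (suc (4 * suc e) * x + w) + suc (2 * e) * x ≡ (3 + 4 * e) * (suc (suc e) * x) + suc e * w
          lem₁ = ℕ.solve-∀
          lem₂ : ∀ e w → (3 + 4 * e) * (suc e * w) + suc e * w ≡ suc e * (4 * suc e * w)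
          lem₂ = ℕ.solve-∀

        main : a * n + a * y + b * (2 * l + 4) ≤ b * W
        main = ℕ.*-cancelˡ-≤ (4 * E) (begin
          4 * E * (a * n + a * y + b * (2 * l + 4))                          ≡⟨ lem₁ E a n y b (2 * l + 4) ⟩
          4 * E * (a * n) + a * (4 * E * y) + b * (4 * E * (2 * l + 4))      ≤⟨ ℕ.+-mono-≤ (ℕ.+-monoʳ-≤ (4 * E * (a * n)) (ℕ.*-monoʳ-≤ a 4Ey≤n))
                                                                                  (ℕ.*-monoʳ-≤ b (ℕ.≤-trans ℓ-large (ℕ.m≤n+m (ℓ + 2) a))) ⟩
          4 * E * (a * n) + a * n + b * W                                    ≡⟨ cong (_+ b * W) (ℕ.+-comm (4 * E * (a * n)) (a * n)) ⟩
          suc (4 * E) * (a * n) + b * W                                      ≤⟨ slack ⟩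
          4 * E * (b * W)                                                    ∎)
          where
          lem₁ : ∀ E a n y b x → 4 * E * (a * n + a * y + b * x) ≡ 4 * E * (a * n) + a * (4 * E * y) + b * (4 * E * x)
          lem₁ = ℕ.solve-∀

        -- Three losses separate b W from a times `boxes`: a R from rounding the quotients, b (2 l +
        -- 2) from the two ends missing in the harmonic sum, and 2 b because W contains ℓ + 2 in
        -- place of ℓ. `main` covers them all.
        n≤boxes : n ≤ boxes a b R
        n≤boxes = ℕ.*-cancelˡ-≤ a {{ℕ.>-nonZero 0<a}} (ℕ.+-cancelʳ-≤ (a * y + b * (2 * l + 4)) _ _ (begin
          a * n + (a * y + b * (2 * l + 4))                            ≡⟨ ℕ.+-assoc (a * n) _ _ ⟨
          a * n + a * y + b * (2 * l + 4)                              ≤⟨ main ⟩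
          b * (a + (ℓ + 2))                                            ≡⟨ lem₁ a b ℓ ⟩
          a * b + b * ℓ + 2 * b                                        ≤⟨ ℕ.+-monoˡ-≤ (2 * b) (ℕ.+-monoʳ-≤ (a * b) quotients) ⟩
          a * b + (Q + a * R + b * (2 * l + 2)) + 2 * b                ≡⟨ lem₂ (a * b) Q (a * R) b l ⟩
          a * b + Q + (a * R + b * (2 * l + 4))                        ≤⟨ ℕ.+-mono-≤ (sum-quotients≤boxes a b R) (ℕ.+-monoˡ-≤ (b * (2 * l + 4)) (ℕ.<⇒≤ aR+1≤ay)) ⟩
          a * boxes a b R + (a * y + b * (2 * l + 4))                  ∎))
          where
          Q = sum< (a * R) (λ i → b / suc (a + i))
          quotients : b * ℓ ≤ Q + a * R + b * (2 * l + 2)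
          quotients = sum-quotients≥ log b {a} {a * R} {l} (ℕ.≤-trans (ℕ.m≤n*m a 6) 6a≤2^l) (begin
            n                                 ≤⟨ n≤2^L+1 ⟩
            2 * 2 ^ L                         ≡⟨ cong (2 *_) 2^l*y ⟨
            2 * (2 ^ l * y)                   ≡⟨ ℕ.*-assoc 2 (2 ^ l) y ⟨
            2 ^ suc l * y                     ≤⟨ ℕ.*-monoʳ-≤ (2 ^ suc l) (ℕ.m≤n*m y a {{ℕ.>-nonZero 0<a}}) ⟩
            2 ^ suc l * (a * y)               ≡⟨ cong (λ z → 2 ^ suc l * (a * z)) 1+R≡y ⟨
            2 ^ suc l * (a * suc R)           ≡⟨ cong (2 ^ suc l *_) (ℕ.*-suc a R) ⟩
            2 ^ suc l * (a + a * R)           ∎)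
          lem₁ : ∀ a b l → b * (a + (l + 2)) ≡ a * b + b * l + 2 * b
          lem₁ = ℕ.solve-∀
          lem₂ : ∀ x q r b l → x + (q + r + b * (2 * l + 2)) + 2 * b ≡ x + q + (r + b * (2 * l + 4))
          lem₂ = ℕ.solve-∀

    breakerWins-above : BreakerWins a b n
    breakerWins-above with ℕ.≤-total n b
    ... | inj₁ n≤b = BreakerStrategy.breakerWins-at-once 0<a 0<b 1<n n≤b
    ... | inj₂ b≤n = BreakerStrategy.breakerWins 0<a 0<b 1<n R (n≤boxes b≤n) (room b≤n) (cheap b≤n)

-- Powers of two against cubes.

module Growth where
  open import Data.Nat using (_+_; _*_; _^_; _≤_; _<_)

  n<2^n : ∀ n → n < 2 ^ n
  n<2^n zero    = s≤s z≤n
  n<2^n (suc n) = begin-strict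
    suc n              ≤⟨ n<2^n n ⟩
    2 ^ n              <⟨ ℕ.m<m+n (2 ^ n) (ℕ.≤-trans (ℕ.m^n>0 2 n) (ℕ.m≤m+n (2 ^ n) 0)) ⟩
    2 ^ suc n          ∎
    where open ℕ.≤-Reasoning

  ≤[1+m/n]*n : ∀ m n .{{_ : ℕ.NonZero n}} → suc m ≤ suc (m / n) * n
  ≤[1+m/n]*n m n = begin
    suc m                          ≡⟨ cong suc (m≡m%n+[m/n]*n m n) ⟩
    suc (m % n) + m / n * n        ≤⟨ ℕ.+-monoˡ-≤ (m / n * n) (m%n<n m n) ⟩
    suc (m / n) * n                ∎
    where open ℕ.≤-Reasoning

  cube : ℕ → ℕ
  cube m = m * m * m

  cube-mono : ∀ {m n} → m ≤ n → cube m ≤ cube n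
  cube-mono m≤n = ℕ.*-mono-≤ (ℕ.*-mono-≤ m≤n m≤n) m≤n

  -- Let i = ⌊m/4⌋ + 1. Then m + 1 ≤ 4 i bounds the left side by 64 c i³, the hypothesis gives 64 c
  -- ≤ i, and i⁴ ≤ 2^m because i ≤ 2^⌊m/4⌋.
  c*cube≤2^ : ∀ c m → 256 * c ≤ m → c * cube (suc m) ≤ 2 ^ m
  c*cube≤2^ c m c≤m = begin
    c * cube (suc m)               ≤⟨ ℕ.*-monoʳ-≤ c (cube-mono (≤[1+m/n]*n m 4)) ⟩
    c * cube (i * 4)               ≡⟨ lem₁ c i ⟩
    64 * c * cube i                ≤⟨ ℕ.*-monoˡ-≤ (cube i) 64c≤i ⟩
    i * cube i                     ≡⟨ lem₂ i ⟩
    i * i * (i * i)                ≤⟨ ℕ.*-mono-≤ (ℕ.*-mono-≤ (n<2^n j) (n<2^n j)) (ℕ.*-mono-≤ (n<2^n j) (n<2^n j)) ⟩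
    2 ^ j * 2 ^ j * (2 ^ j * 2 ^ j)
                                   ≡⟨ cong₂ _*_ (ℕ.^-distribˡ-+-* 2 j j) (ℕ.^-distribˡ-+-* 2 j j) ⟨
    2 ^ (j + j) * 2 ^ (j + j)      ≡⟨ ℕ.^-distribˡ-+-* 2 (j + j) (j + j) ⟨
    2 ^ (j + j + (j + j))          ≤⟨ ℕ.^-monoʳ-≤ 2 (ℕ.≤-trans (ℕ.≤-reflexive (lem₃ j)) (m/n*n≤m m 4)) ⟩
    2 ^ m                          ∎
    where
    open ℕ.≤-Reasoning
    j = m / 4
    i = suc j
    lem₁ : ∀ c i → c * (i * 4 * (i * 4) * (i * 4)) ≡ 64 * c * (i * i * i)
    lem₁ = ℕ.solve-∀
    lem₂ : ∀ i → i * (i * i * i) ≡ i * i * (i * i)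
    lem₂ = ℕ.solve-∀
    lem₃ : ∀ j → j + j + (j + j) ≡ j * 4
    lem₃ = ℕ.solve-∀
    lem₄ : ∀ c → 64 * c * 4 ≡ 256 * c
    lem₄ = ℕ.solve-∀
    64c≤i : 64 * c ≤ i
    64c≤i = ℕ.*-cancelʳ-≤ (64 * c) i 4 (ℕ.≤-trans (ℕ.≤-reflexive (lem₄ c))
      (ℕ.≤-trans c≤m (ℕ.≤-trans (ℕ.n≤1+n m) (≤[1+m/n]*n m 4))))

  log₂ : ∀ n → 0 < n → ∃[ L ] 2 ^ L ≤ n × n < 2 ^ suc L
  log₂ (suc zero)    _ = 0 , s≤s z≤n , s≤s (s≤s z≤n)
  log₂ (suc (suc n)) _ with log₂ (suc n) (s≤s z≤n)
  ... | L , lo , hi with 2 ^ suc L ℕ.≤? suc (suc n)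
  ... | yes h = suc L , h , ℕ.≤-<-trans hi (ℕ.^-monoʳ-< 2 (s≤s (s≤s z≤n)) (ℕ.n<1+n (suc L)))
  ... | no ¬h = L , ℕ.≤-trans lo (ℕ.n≤1+n (suc n)) , ℕ.≰⇒> ¬h

-- Choice of the constants for large n.

module Asymptotics where
  open import Data.Nat using (_+_; _*_; _∸_; _^_; _≤_; _<_)
  open Growth
  open Harmonic using (LogFloor; logFloor; 2^≤⇒≤2ℓ; <2^⇒ℓ≤)
  open MakerThreshold
  open BreakerThreshold

  record Scale (L₀ n ℓ : ℕ) : Set where
    field
      log     : LogFloor n ℓ
      L       : ℕ
      L₀≤L    : L₀ ≤ L
      2^L≤n   : 2 ^ L ≤ n
      n≤2^L+1 : n ≤ 2 ^ suc L
      L≤2ℓ+2  : L ≤ 2 * ℓ + 2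
      ℓ≤1+L   : ℓ ≤ suc L

  scale : ∀ L₀ n → 2 ^ L₀ ≤ n → ∃[ ℓ ] Scale L₀ n ℓ
  scale L₀ n 2^L₀≤n with ℕ.≤-trans (ℕ.m^n>0 2 L₀) 2^L₀≤n
  ... | 0<n with logFloor n 0<n | log₂ n 0<n
  ... | ℓ , log | L , lo , hi = ℓ , record
    { log     = log
    ; L       = L
    ; L₀≤L    = ℕ.≮⇒≥ λ L<L₀ → ℕ.<⇒≱ hi (ℕ.≤-trans (ℕ.^-monoʳ-≤ 2 L<L₀) 2^L₀≤n)
    ; 2^L≤n   = lo
    ; n≤2^L+1 = ℕ.<⇒≤ hi
    ; L≤2ℓ+2  = 2^≤⇒≤2ℓ log lo
    ; ℓ≤1+L   = <2^⇒ℓ≤ log (ℕ.<⇒≤ hi)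
    }

  module _ (e : ℕ) where
    open ℕ.≤-Reasoning

    private
      E K : ℕ
      E = suc e
      -- The coefficient is 88 + 4 + 3, from expanding 4 E (22 E + L + 1) + 3 and bounding each
      -- summand by a multiple of E² (L + 1).
      K = 95 * (E * E)

    module _ {L₀ n ℓ} (s : Scale L₀ n ℓ) (256K≤L₀ : 256 * K ≤ L₀) where
      open Scale s

      private
        1≤EE : 1 ≤ E * E
        1≤EE = s≤s z≤n

        K*[1+L]≤n : K * suc L ≤ n
        K*[1+L]≤n = begin
          K * suc L                          ≤⟨ ℕ.*-monoʳ-≤ K (ℕ.m≤n*m (suc L) (suc L * suc L)) ⟩
          K * cube (suc L)                   ≤⟨ c*cube≤2^ K L (ℕ.≤-trans 256K≤L₀ L₀≤L) ⟩
          2 ^ L                              ≤⟨ 2^L≤n ⟩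
          n                                  ∎

      cost≤K : 4 * E * (22 * E + ℓ) + 3 ≤ K * suc L
      cost≤K = begin
        4 * E * (22 * E + ℓ) + 3                                                     ≤⟨ ℕ.+-monoˡ-≤ 3 (ℕ.*-monoʳ-≤ (4 * E) (ℕ.+-monoʳ-≤ (22 * E) ℓ≤1+L)) ⟩
        4 * E * (22 * E + suc L) + 3                                                 ≡⟨ lem₁ E (suc L) ⟩
        88 * (E * E) * 1 + 4 * (E * 1 * suc L) + 3 * (1 * 1)                         ≤⟨ ℕ.+-mono-≤ (ℕ.+-mono-≤ (ℕ.*-monoʳ-≤ (88 * (E * E)) 1≤1+L)
                                                                                          (ℕ.*-monoʳ-≤ 4 (ℕ.*-monoˡ-≤ (suc L) (ℕ.*-monoʳ-≤ E 1≤E))))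
                                                                                          (ℕ.*-monoʳ-≤ 3 (ℕ.*-mono-≤ 1≤EE 1≤1+L)) ⟩
        88 * (E * E) * suc L + 4 * (E * E * suc L) + 3 * (E * E * suc L)             ≡⟨ lem₂ (E * E) (suc L) ⟩
        K * suc L                                                                    ∎
        where
        1≤1+L : 1 ≤ suc L
        1≤1+L = s≤s z≤n
        1≤E : 1 ≤ E
        1≤E = s≤s z≤n
        lem₁ : ∀ E X → 4 * E * (22 * E + X) + 3 ≡ 88 * (E * E) * 1 + 4 * (E * 1 * X) + 3 * (1 * 1)
        lem₁ = ℕ.solve-∀
        lem₂ : ∀ x X → 88 * x * X + 4 * (x * X) + 3 * (x * X) ≡ 95 * x * X
        lem₂ = ℕ.solve-∀

      cost≤n : 4 * E * (22 * E + ℓ) ≤ n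
      cost≤n = ℕ.≤-trans (ℕ.m≤m+n _ 3) (ℕ.≤-trans cost≤K K*[1+L]≤n)

      8E≤n : 8 * E ≤ n
      8E≤n = begin
        8 * E                     ≤⟨ ℕ.*-monoˡ-≤ E (ℕ.m≤m+n 8 80) ⟩
        88 * E                    ≤⟨ ℕ.m≤m*n (88 * E) E ⟩
        88 * E * E                ≤⟨ ℕ.m≤m+n _ (4 * E * ℓ) ⟩
        88 * E * E + 4 * E * ℓ    ≡⟨ lem E ℓ ⟩
        4 * E * (22 * E + ℓ)      ≤⟨ cost≤n ⟩
        n                         ∎
        where
        lem : ∀ E l → 88 * E * E + 4 * E * l ≡ 4 * E * (22 * E + l)
        lem = ℕ.solve-∀

      88EE≤ℓ : 88 * (E * E) ≤ ℓ
      88EE≤ℓ = ℕ.*-cancelˡ-≤ 2 (ℕ.+-cancelʳ-≤ 2 _ _ (begin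
        2 * (88 * (E * E)) + 2 * 1                ≤⟨ ℕ.+-monoʳ-≤ (2 * (88 * (E * E))) (ℕ.*-monoʳ-≤ 2 1≤EE) ⟩
        2 * (88 * (E * E)) + 2 * (E * E)          ≡⟨ lem (E * E) ⟩
        178 * (E * E)                             ≤⟨ ℕ.*-monoˡ-≤ (E * E) (ℕ.m≤m+n 178 (256 * 95 ∸ 178)) ⟩
        256 * 95 * (E * E)                        ≡⟨ ℕ.*-assoc 256 95 (E * E) ⟩
        256 * K                                   ≤⟨ ℕ.≤-trans 256K≤L₀ L₀≤L ⟩
        L                                         ≤⟨ L≤2ℓ+2 ⟩
        2 * ℓ + 2                                 ∎))
        where
        lem : ∀ x → 2 * (88 * x) + 2 * x ≡ 178 * x
        lem = ℕ.solve-∀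

    makerWins-i : ∃[ n₀ ] ∀ n → n₀ ≤ n → ∃[ ℓ ] LogFloor n ℓ ×
      (∀ a b → 0 < a → 0 < b → E * (b * (a + ℓ)) + a * n ≤ E * (a * n) → MakerWins a b n)
    makerWins-i = 2 ^ (256 * K) , λ n n₀≤n → wins n (scale (256 * K) n n₀≤n)
      where
      wins : ∀ n → ∃[ ℓ ] Scale (256 * K) n ℓ → _
      wins n (ℓ , s) = ℓ , log , λ a b 0<a 0<b bound → play 0<a 0<b bound (ℕ.≤-total a n)
        where
        open Scale s
        play : ∀ {a b} → 0 < a → 0 < b → E * (b * (a + ℓ)) + a * n ≤ E * (a * n) → a ≤ n ⊎ n ≤ a → MakerWins a b n
        play 0<a 0<b bound (inj₁ a≤n) =
          makerWins-small e log 0<a a≤n 0<b (8E≤n s ℕ.≤-refl) (88EE≤ℓ s ℕ.≤-refl) bound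
        -- As a ≤ a + ℓ, a factor a cancels from the hypothesis and leaves b ≤ (1 - 1/E) n; a ≥ n
        -- exceeds the logarithmic lower bound on a.
        play {a} {b} 0<a 0<b bound (inj₂ n≤a) =
          makerWins-large e log 0<b (8E≤n s ℕ.≤-refl) (ℕ.≤-trans (cost≤n s ℕ.≤-refl) n≤a) (cost≤n s ℕ.≤-refl)
            (ℕ.*-cancelˡ-≤ a {{ℕ.>-nonZero 0<a}} (begin
              a * (E * b + n)                    ≤⟨ ℕ.m≤m+n _ (E * (b * ℓ)) ⟩
              a * (E * b + n) + E * (b * ℓ)      ≡⟨ lem a E b n ℓ ⟩
              E * (b * (a + ℓ)) + a * n          ≤⟨ bound ⟩
              E * (a * n)                        ≡⟨ lem′ E a n ⟩
              a * (E * n)                        ∎))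
          where
          lem : ∀ a E b n l → a * (E * b + n) + E * (b * l) ≡ E * (b * (a + l)) + a * n
          lem = ℕ.solve-∀
          lem′ : ∀ E a n → E * (a * n) ≡ a * (E * n)
          lem′ = ℕ.solve-∀

    -- The condition on T expresses a lower bound of order √(n/ln n) on a without roots: ℓ + 2 is at
    -- least ln n, and the 2 beside a absorbs the errors of real approximation. It is applied to a T
    -- of order ln n only: T² (ℓ + 2) is then cubic in L and thus at most n.
    makerWins-ii : ∀ C → 0 < C → ∃[ n₀ ] ∀ n → n₀ ≤ n → ∃[ ℓ ] LogFloor n ℓ × 1 < n ×
      (∀ a b → 0 < b → (∀ T → T * T * (ℓ + 2) ≤ n → T ≤ C * (a + 2)) → E * b + n ≤ E * n → MakerWins a b n)
    makerWins-ii C 0<C = 2 ^ L₀ , λ n n₀≤n → wins refl (ℕ.m≤m+n (256 * K) (256 * K₀)) (ℕ.m≤n+m (256 * K₀) (256 * K)) n (scale L₀ n n₀≤n)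
      where
      K₀ L₀ : ℕ
      K₀ = 3 * (C * K * (C * K))
      L₀ = 256 * K + 256 * K₀
      wins : ∀ {K′ L₀} → K′ ≡ 3 * (C * K * (C * K)) → 256 * K ≤ L₀ → 256 * K′ ≤ L₀ →
             ∀ n → ∃[ ℓ ] Scale L₀ n ℓ → ∃[ ℓ ] LogFloor n ℓ × 1 < n ×
             (∀ a b → 0 < b → (∀ T → T * T * (ℓ + 2) ≤ n → T ≤ C * (a + 2)) → E * b + n ≤ E * n → MakerWins a b n)
      wins {K′} {L₀} K′≡ 256K≤L₀ 256K′≤L₀ n (ℓ , s) = ℓ , log , 1<n , λ a b 0<b large bound →
          makerWins-large e log 0<b (8E≤n s 256K≤L₀) (cost≤a large) (cost≤n s 256K≤L₀) bound
        where
        open Scale s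
        1<n : 1 < n
        1<n = ℕ.≤-trans (ℕ.≤-trans (s≤s (s≤s z≤n)) (ℕ.*-monoʳ-≤ 8 {1} {E} (s≤s z≤n))) (8E≤n s 256K≤L₀)
        T : ℕ
        -- The 3 outweighs the 2 in `C * (a + 2)`.
        T = C * (4 * E * (22 * E + ℓ) + 3)
        T≤ : T ≤ C * K * suc L
        T≤ = ℕ.≤-trans (ℕ.*-monoʳ-≤ C (cost≤K s 256K≤L₀)) (ℕ.≤-reflexive (sym (ℕ.*-assoc C K (suc L))))
        ℓ+2≤ : ℓ + 2 ≤ 3 * suc L
        ℓ+2≤ = begin
          ℓ + 2                ≤⟨ ℕ.+-monoˡ-≤ 2 ℓ≤1+L ⟩
          suc L + 2            ≤⟨ ℕ.m≤m+n _ (2 * L) ⟩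
          suc L + 2 + 2 * L    ≡⟨ lem L ⟩
          3 * suc L            ∎
          where
          lem : ∀ L → suc L + 2 + 2 * L ≡ 3 * suc L
          lem = ℕ.solve-∀
        TT≤ : T * T * (ℓ + 2) ≤ n
        TT≤ = begin
          T * T * (ℓ + 2)                                  ≤⟨ ℕ.*-mono-≤ (ℕ.*-mono-≤ T≤ T≤) ℓ+2≤ ⟩
          C * K * suc L * (C * K * suc L) * (3 * suc L)    ≡⟨ lem (C * K) (suc L) ⟩
          3 * (C * K * (C * K)) * cube (suc L)             ≡⟨ cong (_* cube (suc L)) K′≡ ⟨
          K′ * cube (suc L)                                ≤⟨ c*cube≤2^ K′ L (ℕ.≤-trans 256K′≤L₀ L₀≤L) ⟩
          2 ^ L                                            ≤⟨ 2^L≤n ⟩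
          n                                                ∎
          where
          lem : ∀ x X → x * X * (x * X) * (3 * X) ≡ 3 * (x * x) * (X * X * X)
          lem = ℕ.solve-∀
        cost≤a : ∀ {a} → (∀ T → T * T * (ℓ + 2) ≤ n → T ≤ C * (a + 2)) → 4 * E * (22 * E + ℓ) ≤ a
        cost≤a {a} large = ℕ.+-cancelʳ-≤ 2 _ a (ℕ.≤-trans (ℕ.+-monoʳ-≤ (4 * E * (22 * E + ℓ)) (ℕ.n≤1+n 2))
          (ℕ.*-cancelˡ-≤ C {{ℕ.>-nonZero 0<C}} (large T TT≤)))

    breakerWins-i : ∃[ n₀ ] ∀ n → n₀ ≤ n → ∃[ ℓ ] LogFloor n ℓ × 1 < n ×
      (∀ a b → 0 < a → 0 < b → suc E * (a * n) ≤ E * (b * (a + (ℓ + 2))) → BreakerWins a b n)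
    breakerWins-i = 2 ^ L₀ , λ n n₀≤n → wins refl (ℕ.m≤m+n (256 * K₀ * (32 * E)) (64 * E)) (ℕ.m≤n+m (64 * E) (256 * K₀ * (32 * E))) n (scale L₀ n n₀≤n)
      where
      K₀ L₀ : ℕ
      -- Because L + 3 ≤ 34 E (l + 1), the requirement `l-large` follows from K₀ (l + 1)² ≤ 2^l. In
      -- `L₀` the first summand ensures 256 K₀ ≤ l, and the second 64 E ≤ L.
      K₀ = 6 * (E * suc E) * (34 * E * (34 * E))
      L₀ = 256 * K₀ * (32 * E) + 64 * E
      wins : ∀ {K′ L₀} → K′ ≡ 6 * (E * suc E) * (34 * E * (34 * E)) → 256 * K′ * (32 * E) ≤ L₀ → 64 * E ≤ L₀ →
             ∀ n → ∃[ ℓ ] Scale L₀ n ℓ → ∃[ ℓ ] LogFloor n ℓ × 1 < n ×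
             (∀ a b → 0 < a → 0 < b → suc E * (a * n) ≤ E * (b * (a + (ℓ + 2))) → BreakerWins a b n)
      wins {K′} {L₀} K′≡ K′-small 64E≤L₀ n (ℓ , s) = ℓ , log , 1<n , λ a b 0<a 0<b bound →
          breakerWins-above {l = l} e log 0<a 0<b 1<n 2^L≤n n≤2^L+1 (m/n≤m L (32 * E)) ℓ-large l-large bound
        where
        open Scale s
        l : ℕ
        -- Four times the left side of `ℓ-large` is 32 E l + 64 E, at most 2 L with this l, while L
        -- is at most 2 ℓ + 2.
        l = L / (32 * E)
        256K′≤l : 256 * K′ ≤ l
        256K′≤l = ℕ.≤-trans (ℕ.≤-reflexive (sym (m*n/n≡m (256 * K′) (32 * E)))) (/-monoˡ-≤ (32 * E) (ℕ.≤-trans K′-small L₀≤L))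
        64E≤L : 64 * E ≤ L
        64E≤L = ℕ.≤-trans 64E≤L₀ L₀≤L
        1<n : 1 < n
        1<n = ℕ.≤-trans (ℕ.^-monoʳ-≤ 2 (ℕ.≤-trans (s≤s z≤n) 64E≤L)) 2^L≤n
        ℓ-large : 4 * E * (2 * l + 4) ≤ ℓ + 2
        ℓ-large = ℕ.*-cancelˡ-≤ 4 (begin
          4 * (4 * E * (2 * l + 4))        ≡⟨ lem₁ E l ⟩
          l * (32 * E) + 64 * E            ≤⟨ ℕ.+-mono-≤ (m/n*n≤m L (32 * E)) 64E≤L ⟩
          L + L                            ≤⟨ ℕ.+-mono-≤ L≤2ℓ+2 L≤2ℓ+2 ⟩
          2 * ℓ + 2 + (2 * ℓ + 2)          ≤⟨ ℕ.m≤m+n _ 4 ⟩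
          2 * ℓ + 2 + (2 * ℓ + 2) + 4      ≡⟨ lem₂ ℓ ⟩
          4 * (ℓ + 2)                      ∎)
          where
          lem₁ : ∀ E l → 4 * (4 * E * (2 * l + 4)) ≡ l * (32 * E) + 64 * E
          lem₁ = ℕ.solve-∀
          lem₂ : ∀ l → 2 * l + 2 + (2 * l + 2) + 4 ≡ 4 * (l + 2)
          lem₂ = ℕ.solve-∀
        L+3≤ : L + 3 ≤ 34 * E * suc l
        L+3≤ = begin
          L + 3                                        ≡⟨ lem₁ L ⟩
          suc L + 2 * (1 * 1)                          ≤⟨ ℕ.+-mono-≤ (≤[1+m/n]*n L (32 * E)) (ℕ.*-monoʳ-≤ 2 (ℕ.*-mono-≤ {1} {E} {1} {suc l} (s≤s z≤n) (s≤s z≤n))) ⟩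
          suc l * (32 * E) + 2 * (E * suc l)           ≡⟨ lem₂ E (suc l) ⟩
          34 * E * suc l                               ∎
          where
          lem₁ : ∀ L → L + 3 ≡ suc L + 2 * (1 * 1)
          lem₁ = ℕ.solve-∀
          lem₂ : ∀ E X → X * (32 * E) + 2 * (E * X) ≡ 34 * E * X
          lem₂ = ℕ.solve-∀
        l-large : 6 * (E * suc E) * ((L + 3) * (L + 3)) ≤ 2 ^ l
        l-large = begin
          6 * (E * suc E) * ((L + 3) * (L + 3))                    ≤⟨ ℕ.*-monoʳ-≤ (6 * (E * suc E)) (ℕ.*-mono-≤ L+3≤ L+3≤) ⟩
          6 * (E * suc E) * (34 * E * suc l * (34 * E * suc l))    ≡⟨ lem (6 * (E * suc E)) (34 * E) (suc l) ⟩
          6 * (E * suc E) * (34 * E * (34 * E)) * (suc l * suc l)  ≡⟨ cong (_* (suc l * suc l)) K′≡ ⟨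
          K′ * (suc l * suc l)                                     ≤⟨ ℕ.*-monoʳ-≤ K′ (ℕ.m≤m*n (suc l * suc l) (suc l)) ⟩
          K′ * cube (suc l)                                        ≤⟨ c*cube≤2^ K′ l 256K′≤l ⟩
          2 ^ l                                                    ∎
          where
          lem : ∀ x y X → x * (y * X * (y * X)) ≡ x * (y * y) * (X * X)
          lem = ℕ.solve-∀

-- Integer inequalities from inequalities between reals.

module RealBounds where
  open import Data.Rational using (_+_; _*_; -_; _≤_; _<_; _⊔_)
  open Rational
  open Harmonic
  open ℚSolver.+-*-Solver
  open ℚ.≤-Reasoning

  fromℕ-< : ∀ D → fromℕ D * recip D < 1ℚ
  fromℕ-< D = begin-strict
    fromℕ D * recip D              <⟨ ℚ.*-monoˡ-<-pos (recip D) {{ℚ.positive (0<recip D)}} D<1+D ⟩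
    fromℕ (suc D) * recip D        ≡⟨ ℚ.*-comm (fromℕ (suc D)) (recip D) ⟩
    recip D * fromℕ (suc D)        ≡⟨ recip*suc D ⟩
    1ℚ                             ∎
    where
    D<1+D : fromℕ D < fromℕ (suc D)
    D<1+D = subst₂ _<_ (ℚ.+-identityˡ (fromℕ D)) (sym (fromℕ-suc D)) (ℚ.+-monoˡ-< (fromℕ D) (ℚ.positive⁻¹ 1ℚ))

  -- The order of the reals holds only up to a positive tolerance. A tolerance 1/(D + 1) scaled by D
  -- stays below 1, which is invisible between integers; so D is always the factor by which an
  -- inequality is multiplied.
  ≤-approx : ∀ {X Y D} → fromℕ X ≤ fromℕ Y + fromℕ D * recip D → X ℕ.≤ Y
  ≤-approx {X} {Y} {D} h = fromℕ-cancel (ℚ.≤-<-trans h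
    (subst (fromℕ Y + fromℕ D * recip D <_) (ℚ.+-comm (fromℕ Y) 1ℚ) (ℚ.+-monoʳ-< (fromℕ Y) (fromℕ-< D))))

  -- From here on a positive real enters only through a unit fraction that bounds its terms from
  -- below.
  recip-below : ∀ {x} → 0ℝ ℝ.< x → ∃[ e ] ∃[ N ] ∀ m → N ℕ.≤ m → recip e ≤ seq x m
  recip-below {x} (mk< δ 0<δ N δ≤) with archimedean δ 0<δ
  ... | e , recip≤ = e , N , λ m N≤m → ℚ.≤-trans (recip≤ e ℕ.≤-refl)
    (subst (_≤ seq x m) (ℚ.+-identityˡ δ) (δ≤ m N≤m))

  -- `reciprocal` inverts the terms of `y` after raising them to the gap, so with the maximum in
  -- place the equation holds at every index, not just eventually.
  reciprocal-inverse : ∀ y 0<y m → (seq y m ⊔ ℝ._<_.gap 0<y) * seq (reciprocal y 0<y) m ≡ 1ℚ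
  reciprocal-inverse y (mk< δ 0<δ N δ≤) m = ℚ.*-inverseʳ (seq y m ⊔ δ) {{_}}

  0≤reciprocal : ∀ y 0<y m → 0ℚ ≤ seq (reciprocal y 0<y) m
  0≤reciprocal y (mk< δ 0<δ N δ≤) m = ℚ.<⇒≤ (ℚ.positive⁻¹ _ {{ℚ.1/pos⇒pos (seq y m ⊔ δ)
    {{ℚ.positive (ℚ.<-≤-trans 0<δ (ℚ.p≤q⊔p (seq y m) δ))}}}})

  E*recip : ∀ e → fromℕ (suc e) * recip e ≡ 1ℚ
  E*recip e = trans (ℚ.*-comm (fromℕ (suc e)) (recip e)) (recip*suc e)

  E*[1-ε]≤e : ∀ e {ε} → recip e ≤ ε → fromℕ (suc e) * (1ℚ + - ε) ≤ fromℕ e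
  E*[1-ε]≤e e {ε} r≤ε = begin
    fromℕ (suc e) * (1ℚ + - ε)                      ≤⟨ *-monoˡ (fromℕ (suc e)) (0≤fromℕ (suc e)) (ℚ.+-monoʳ-≤ 1ℚ (ℚ.neg-antimono-≤ r≤ε)) ⟩
    fromℕ (suc e) * (1ℚ + - recip e)                ≡⟨ solve 2 (λ E r → E :* (con 1ℚ :+ :- r) := E :+ :- (E :* r)) refl (fromℕ (suc e)) (recip e) ⟩
    fromℕ (suc e) + - (fromℕ (suc e) * recip e)     ≡⟨ cong₂ (λ x y → x + - y) (fromℕ-suc e) (E*recip e) ⟩
    1ℚ + fromℕ e + - 1ℚ                             ≡⟨ solve 1 (λ x → con 1ℚ :+ x :+ :- (con 1ℚ) := x) refl (fromℕ e) ⟩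
    fromℕ e                                         ∎

  1+E≤E*[1+ε] : ∀ e {ε} → recip e ≤ ε → fromℕ (suc (suc e)) ≤ fromℕ (suc e) * (1ℚ + ε)
  1+E≤E*[1+ε] e {ε} r≤ε = begin
    fromℕ (suc (suc e))                             ≡⟨ fromℕ-suc (suc e) ⟩
    1ℚ + fromℕ (suc e)                              ≡⟨ cong (_+ fromℕ (suc e)) (E*recip e) ⟨
    fromℕ (suc e) * recip e + fromℕ (suc e)         ≡⟨ solve 2 (λ E r → E :* r :+ E := E :* (con 1ℚ :+ r)) refl (fromℕ (suc e)) (recip e) ⟩
    fromℕ (suc e) * (1ℚ + recip e)                  ≤⟨ *-monoˡ (fromℕ (suc e)) (0≤fromℕ (suc e)) (ℚ.+-monoʳ-≤ 1ℚ r≤ε) ⟩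
    fromℕ (suc e) * (1ℚ + ε)                        ∎

  module _ {ε : ℝ} {e N} (r≤ε : ∀ m → N ℕ.≤ m → recip e ≤ seq ε m) where
    private
      E : ℕ
      E = suc e

    below-n : ∀ {b n} → ℝ.fromℕ b ℝ.≤ (1ℝ ℝ.- ε) ℝ.* ℝ.fromℕ n → E ℕ.* b ℕ.+ n ℕ.≤ E ℕ.* n
    below-n {b} {n} (mk≤ ev) with ev (recip E) (0<recip E)
    ... | M , h = ℕ.≤-trans (ℕ.+-monoˡ-≤ n (≤-approx {E ℕ.* b} {e ℕ.* n} {E} (begin
      fromℕ (E ℕ.* b)                                     ≡⟨ fromℕ-* E b ⟩
      fromℕ E * fromℕ b                                   ≤⟨ *-monoˡ (fromℕ E) (0≤fromℕ E) (h m (ℕ.m≤m⊔n M N)) ⟩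
      fromℕ E * ((1ℚ + - seq ε m) * fromℕ n + recip E)    ≡⟨ solve 4 (λ E x n r → E :* (x :* n :+ r) := E :* x :* n :+ E :* r) refl (fromℕ E) (1ℚ + - seq ε m) (fromℕ n) (recip E) ⟩
      fromℕ E * (1ℚ + - seq ε m) * fromℕ n + fromℕ E * recip E
                                                          ≤⟨ ℚ.+-monoˡ-≤ (fromℕ E * recip E) (*-monoʳ (fromℕ n) (0≤fromℕ n) (E*[1-ε]≤e e (r≤ε m (ℕ.m≤n⊔m M N)))) ⟩
      fromℕ e * fromℕ n + fromℕ E * recip E               ≡⟨ cong (_+ fromℕ E * recip E) (fromℕ-* e n) ⟨
      fromℕ (e ℕ.* n) + fromℕ E * recip E                 ∎))) (ℕ.≤-reflexive (ℕ.+-comm (e ℕ.* n) n))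
      where m = M ℕ.⊔ N

    above-n : ∀ {b n} → (1ℝ ℝ.+ ε) ℝ.* ℝ.fromℕ n ℝ.≤ ℝ.fromℕ b → n ℕ.≤ b
    above-n {b} {n} (mk≤ ev) with ev (fromℕ 1 * recip 1) (ℚ.positive⁻¹ _)
    ... | M , h = ≤-approx {n} {b} {1} (begin
      fromℕ n                                             ≡⟨ ℚ.*-identityˡ (fromℕ n) ⟨
      1ℚ * fromℕ n                                        ≤⟨ *-monoʳ (fromℕ n) (0≤fromℕ n) (subst (_≤ 1ℚ + seq ε m) (ℚ.+-identityʳ 1ℚ)
                                                               (ℚ.+-monoʳ-≤ 1ℚ (ℚ.≤-trans (ℚ.<⇒≤ (0<recip e)) (r≤ε m (ℕ.m≤n⊔m M N))))) ⟩
      (1ℚ + seq ε m) * fromℕ n                            ≤⟨ h m (ℕ.m≤m⊔n M N) ⟩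
      fromℕ b + fromℕ 1 * recip 1                         ∎)
      where m = M ℕ.⊔ N

    module _ {n ℓ a} (log : LogFloor n ℓ) (0<a : 0 ℕ.< a) where
      open LogFloor log

      private
        A : ℚ
        A = fromℕ a * fromℕ n

        0≤A : 0ℚ ≤ A
        0≤A = 0≤p*q (0≤fromℕ a) (0≤fromℕ n)

        u q : ℕ → ℚ
        u m = (fromℕ a + seq (ln n) m) ⊔ 1ℚ
        q m = seq (reciprocal (ℝ.fromℕ a ℝ.+ ln n) (0<a+ln n 0<a)) m

        u*q : ∀ m → u m * q m ≡ 1ℚ
        u*q = reciprocal-inverse (ℝ.fromℕ a ℝ.+ ln n) (0<a+ln n 0<a)

        0≤q : ∀ m → 0ℚ ≤ q m
        0≤q = 0≤reciprocal (ℝ.fromℕ a ℝ.+ ln n) (0<a+ln n 0<a)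

        a+ℓ≤u : ∀ m → fromℕ (a ℕ.+ ℓ) ≤ u m
        a+ℓ≤u m = begin
          fromℕ (a ℕ.+ ℓ)                 ≡⟨ fromℕ-+ a ℓ ⟩
          fromℕ a + fromℕ ℓ               ≤⟨ ℚ.+-monoʳ-≤ (fromℕ a) (ℓ≤ln m) ⟩
          fromℕ a + seq (ln n) m          ≤⟨ ℚ.p≤p⊔q _ 1ℚ ⟩
          u m                             ∎

        V : ℕ
        V = a ℕ.+ (ℓ ℕ.+ 2)

        u≤V : ∀ m → u m ≤ fromℕ V
        u≤V m = ℚ.⊔-lub (begin
          fromℕ a + seq (ln n) m          ≤⟨ ℚ.+-monoʳ-≤ (fromℕ a) (ln≤ m) ⟩
          fromℕ a + fromℕ (2 ℕ.+ ℓ)       ≡⟨ fromℕ-+ a (2 ℕ.+ ℓ) ⟨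
          fromℕ (a ℕ.+ (2 ℕ.+ ℓ))         ≡⟨ cong (λ x → fromℕ (a ℕ.+ x)) (ℕ.+-comm 2 ℓ) ⟩
          fromℕ V                         ∎) (fromℕ-mono {1} {V} (ℕ.≤-trans 0<a (ℕ.m≤m+n a _)))

        0≤u : ∀ m → 0ℚ ≤ u m
        0≤u m = ℚ.≤-trans (0≤fromℕ (a ℕ.+ ℓ)) (a+ℓ≤u m)

      -- Multiplication by D = E (a + ℓ) clears the denominator, since a + ℓ ≤ a + ln n, and leaves
      -- b (a + ℓ) ≤ (1 - 1/E) a n.
      below-β : ∀ {b} → ℝ.fromℕ b ℝ.≤ (1ℝ ℝ.- ε) ℝ.* ((ℝ.fromℕ a ℝ.* ℝ.fromℕ n) ÷ (ℝ.fromℕ a ℝ.+ ln n) [ 0<a+ln n 0<a ]) →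
                E ℕ.* (b ℕ.* (a ℕ.+ ℓ)) ℕ.+ a ℕ.* n ℕ.≤ E ℕ.* (a ℕ.* n)
      below-β {b} (mk≤ ev) = ℕ.≤-trans (ℕ.+-monoˡ-≤ (a ℕ.* n) (scaled refl (ev (recip D) (0<recip D))))
        (ℕ.≤-reflexive (ℕ.+-comm (e ℕ.* (a ℕ.* n)) (a ℕ.* n)))
        where
        D = E ℕ.* (a ℕ.+ ℓ)
        F = fromℕ (a ℕ.+ ℓ)
        lem : ∀ E b c → E ℕ.* (b ℕ.* c) ≡ E ℕ.* c ℕ.* b
        lem = ℕ.solve-∀
        bound : ∀ m {x} → fromℕ E * x ≤ fromℕ e → fromℕ E * F * (x * (A * q m)) ≤ fromℕ (e ℕ.* (a ℕ.* n))
        bound m {x} Ex≤e = begin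
          fromℕ E * F * (x * (A * q m))           ≡⟨ solve 5 (λ E F x A q → E :* F :* (x :* (A :* q)) := (E :* x) :* (A :* (F :* q))) refl (fromℕ E) F x A (q m) ⟩
          (fromℕ E * x) * (A * (F * q m))         ≤⟨ *-monoʳ (A * (F * q m)) (0≤p*q 0≤A (0≤p*q (0≤fromℕ (a ℕ.+ ℓ)) (0≤q m))) Ex≤e ⟩
          fromℕ e * (A * (F * q m))               ≤⟨ *-monoˡ (fromℕ e) (0≤fromℕ e) (*-monoˡ A 0≤A (*-monoʳ (q m) (0≤q m) (a+ℓ≤u m))) ⟩
          fromℕ e * (A * (u m * q m))             ≡⟨ cong (λ z → fromℕ e * (A * z)) (u*q m) ⟩
          fromℕ e * (A * 1ℚ)                      ≡⟨ cong (fromℕ e *_) (trans (ℚ.*-identityʳ A) (sym (fromℕ-* a n))) ⟩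
          fromℕ e * fromℕ (a ℕ.* n)               ≡⟨ fromℕ-* e (a ℕ.* n) ⟨
          fromℕ (e ℕ.* (a ℕ.* n))                 ∎
        scaled : ∀ {D} → D ≡ E ℕ.* (a ℕ.+ ℓ) →
                 ∃[ M ] (∀ m → M ℕ.≤ m → fromℕ b ≤ (1ℚ + - seq ε m) * (A * q m) + recip D) →
                 E ℕ.* (b ℕ.* (a ℕ.+ ℓ)) ℕ.≤ e ℕ.* (a ℕ.* n)
        scaled {D} D≡ (M , h) = ≤-approx {E ℕ.* (b ℕ.* (a ℕ.+ ℓ))} {e ℕ.* (a ℕ.* n)} {D} (begin
          fromℕ (E ℕ.* (b ℕ.* (a ℕ.+ ℓ)))           ≡⟨ cong fromℕ (trans (lem E b (a ℕ.+ ℓ)) (cong (ℕ._* b) (sym D≡))) ⟩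
          fromℕ (D ℕ.* b)                           ≡⟨ fromℕ-* D b ⟩
          fromℕ D * fromℕ b                         ≤⟨ *-monoˡ (fromℕ D) (0≤fromℕ D) (h m (ℕ.m≤m⊔n M N)) ⟩
          fromℕ D * (x * (A * q m) + recip D)       ≡⟨ ℚ.*-distribˡ-+ (fromℕ D) (x * (A * q m)) (recip D) ⟩
          fromℕ D * (x * (A * q m)) + fromℕ D * recip D
                                                    ≡⟨ cong (λ z → z * (x * (A * q m)) + fromℕ D * recip D) (trans (cong fromℕ D≡) (fromℕ-* E (a ℕ.+ ℓ))) ⟩
          fromℕ E * F * (x * (A * q m)) + fromℕ D * recip D
                                                    ≤⟨ ℚ.+-monoˡ-≤ (fromℕ D * recip D) (bound m (E*[1-ε]≤e e (r≤ε m (ℕ.m≤n⊔m M N)))) ⟩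
          fromℕ (e ℕ.* (a ℕ.* n)) + fromℕ D * recip D ∎)
          where
          m = M ℕ.⊔ N
          x = 1ℚ + - seq ε m

      -- In this direction the denominator must be bounded from above: V = a + ℓ + 2 is at least a +
      -- ln n, and the factor is D = E V.
      above-β : ∀ {b} → (1ℝ ℝ.+ ε) ℝ.* ((ℝ.fromℕ a ℝ.* ℝ.fromℕ n) ÷ (ℝ.fromℕ a ℝ.+ ln n) [ 0<a+ln n 0<a ]) ℝ.≤ ℝ.fromℕ b →
                suc E ℕ.* (a ℕ.* n) ℕ.≤ E ℕ.* (b ℕ.* V)
      above-β {b} (mk≤ ev) = scaled refl (ev (recip D) (0<recip D))
        where
        D = E ℕ.* V
        scaled : ∀ {D} → D ≡ E ℕ.* V →
                 ∃[ M ] (∀ m → M ℕ.≤ m → (1ℚ + seq ε m) * (A * q m) ≤ fromℕ b + recip D) →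
                 suc E ℕ.* (a ℕ.* n) ℕ.≤ E ℕ.* (b ℕ.* V)
        scaled {D} D≡ (M , h) = ≤-approx {suc E ℕ.* (a ℕ.* n)} {E ℕ.* (b ℕ.* V)} {D} (begin
          fromℕ (suc E ℕ.* (a ℕ.* n))                   ≡⟨ trans (fromℕ-* (suc E) (a ℕ.* n)) (cong (fromℕ (suc E) *_) (fromℕ-* a n)) ⟩
          fromℕ (suc E) * A                             ≤⟨ *-monoʳ A 0≤A (1+E≤E*[1+ε] e (r≤ε m (ℕ.m≤n⊔m M N))) ⟩
          fromℕ E * x * A                               ≡⟨ ℚ.*-identityʳ (fromℕ E * x * A) ⟨
          fromℕ E * x * A * 1ℚ                          ≡⟨ cong (fromℕ E * x * A *_) (u*q m) ⟨
          fromℕ E * x * A * (u m * q m)                 ≡⟨ solve 5 (λ E x A u q → E :* x :* A :* (u :* q) := (E :* u) :* (x :* (A :* q))) refl (fromℕ E) x A (u m) (q m) ⟩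
          (fromℕ E * u m) * (x * (A * q m))             ≤⟨ *-monoˡ (fromℕ E * u m) (0≤p*q (0≤fromℕ E) (0≤u m)) (h m (ℕ.m≤m⊔n M N)) ⟩
          (fromℕ E * u m) * (fromℕ b + recip D)         ≤⟨ *-monoʳ (fromℕ b + recip D) (ℚ.+-mono-≤ (0≤fromℕ b) (ℚ.<⇒≤ (0<recip D)))
                                                             (*-monoˡ (fromℕ E) (0≤fromℕ E) (u≤V m)) ⟩
          (fromℕ E * fromℕ V) * (fromℕ b + recip D)     ≡⟨ solve 4 (λ E V b r → (E :* V) :* (b :+ r) := E :* (b :* V) :+ E :* V :* r) refl (fromℕ E) (fromℕ V) (fromℕ b) (recip D) ⟩
          fromℕ E * (fromℕ b * fromℕ V) + fromℕ E * fromℕ V * recip D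
                                                        ≡⟨ cong₂ (λ y z → y + z * recip D)
                                                             (trans (cong (fromℕ E *_) (sym (fromℕ-* b V))) (sym (fromℕ-* E (b ℕ.* V))))
                                                             (trans (sym (fromℕ-* E V)) (cong fromℕ (sym D≡))) ⟩
          fromℕ (E ℕ.* (b ℕ.* V)) + fromℕ D * recip D   ∎)
          where
          m = M ℕ.⊔ N
          x = 1ℚ + seq ε m

  square-cancel-< : ∀ {p q} → 0ℚ ≤ p → 0ℚ ≤ q → p * p < q * q → p < q
  square-cancel-< {p} {q} 0≤p 0≤q p²<q² = ℚ.≰⇒> λ q≤p → ℚ.<-irrefl refl (ℚ.<-≤-trans p²<q² (*-mono-≤ 0≤p 0≤q q≤p q≤p))

  -- Agda compares reals by their fields, including the proofs of convergence;
  -- with the equation for x as an argument the unfolding of √[n/ln-n] is cheap.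
  above-√ : ∀ {c : ℝ} {C N} → (∀ m → N ℕ.≤ m → recip C ≤ seq c m) →
            ∀ {n ℓ a} → LogFloor n ℓ → (0<ln : 0ℝ ℝ.< ln n) → ℝ._<_.gap 0<ln ≤ recip 0 →
            ∀ x → x ≡ √ (ℝ.fromℕ n ÷ ln n [ 0<ln ]) → c ℝ.* x ℝ.≤ ℝ.fromℕ a →
            ∀ T → T ℕ.* T ℕ.* (ℓ ℕ.+ 2) ℕ.≤ n → T ℕ.≤ suc C ℕ.* (a ℕ.+ 2)
  above-√ {c} {C} {N} r≤c {n} {ℓ} {a} log 0<ln gap≤1 _ refl (mk≤ ev) T T²≤ = bound (ev 1ℚ (ℚ.positive⁻¹ 1ℚ))
    where
    open LogFloor log
    0≤r : 0ℚ ≤ recip C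
    0≤r = ℚ.<⇒≤ (0<recip C)
    q u Q s : ℕ → ℚ
    q m = seq (reciprocal (ln n) 0<ln) m
    u m = seq (ln n) m ⊔ ℝ._<_.gap 0<ln
    Q m = (fromℕ n * q m) ⊔ 0ℚ
    s m = SquareRoot.approx m (Q m)
    0≤s : ∀ m → 0ℚ ≤ s m
    0≤s m = SquareRoot.0≤approx m (Q m)
    0≤q : ∀ m → 0ℚ ≤ q m
    0≤q = 0≤reciprocal (ln n) 0<ln
    u≤ : ∀ m → u m ≤ fromℕ (ℓ ℕ.+ 2)
    u≤ m = ℚ.⊔-lub (ℚ.≤-trans (ln≤ m) (fromℕ-mono (ℕ.≤-reflexive (ℕ.+-comm 2 ℓ))))
      (ℚ.≤-trans gap≤1 (fromℕ-mono {1} (ℕ.≤-trans (s≤s z≤n) (ℕ.m≤n+m 2 ℓ))))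
    T²≤Q : ∀ m → fromℕ T * fromℕ T ≤ Q m
    T²≤Q m = begin
      fromℕ T * fromℕ T                                  ≡⟨ fromℕ-* T T ⟨
      fromℕ (T ℕ.* T)                                    ≡⟨ ℚ.*-identityʳ (fromℕ (T ℕ.* T)) ⟨
      fromℕ (T ℕ.* T) * 1ℚ                               ≡⟨ cong (fromℕ (T ℕ.* T) *_) (reciprocal-inverse (ln n) 0<ln m) ⟨
      fromℕ (T ℕ.* T) * (u m * q m)                      ≤⟨ *-monoˡ (fromℕ (T ℕ.* T)) (0≤fromℕ (T ℕ.* T)) (*-monoʳ (q m) (0≤q m) (u≤ m)) ⟩
      fromℕ (T ℕ.* T) * (fromℕ (ℓ ℕ.+ 2) * q m)          ≡⟨ ℚ.*-assoc (fromℕ (T ℕ.* T)) (fromℕ (ℓ ℕ.+ 2)) (q m) ⟨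
      fromℕ (T ℕ.* T) * fromℕ (ℓ ℕ.+ 2) * q m            ≡⟨ cong (_* q m) (fromℕ-* (T ℕ.* T) (ℓ ℕ.+ 2)) ⟨
      fromℕ (T ℕ.* T ℕ.* (ℓ ℕ.+ 2)) * q m                ≤⟨ *-monoʳ (q m) (0≤q m) (fromℕ-mono T²≤) ⟩
      fromℕ n * q m                                      ≤⟨ ℚ.p≤p⊔q (fromℕ n * q m) 0ℚ ⟩
      Q m                                                ∎
    T< : ∀ m → fromℕ T < s m + recip m
    T< m = square-cancel-< (0≤fromℕ T) (ℚ.+-mono-≤ (0≤s m) (ℚ.<⇒≤ (0<recip m)))
      (ℚ.≤-<-trans (T²≤Q m) (proj₂ (SquareRoot.approx² m (Q m) (ℚ.p≤q⊔p (fromℕ n * q m) 0ℚ))))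
    recip*recip≤1 : ∀ m → recip C * recip m ≤ recip 0 * recip 0
    recip*recip≤1 m = *-mono-≤ (ℚ.<⇒≤ (0<recip 0)) (ℚ.<⇒≤ (0<recip m)) (recip-antimono {0} {C} z≤n) (recip-antimono {0} {m} z≤n)
    -- Of the two units added to a, one is the tolerance, set to 1, and the other covers the
    -- rounding error 1/(m + 1) of the approximate root.
    bound : ∃[ M ] (∀ m → M ℕ.≤ m → seq c m * s m ≤ fromℕ a + 1ℚ) → T ℕ.≤ suc C ℕ.* (a ℕ.+ 2)
    bound (M , h) = fromℕ-cancel-≤ (begin
      fromℕ T                                            ≡⟨ ℚ.*-identityˡ (fromℕ T) ⟨
      1ℚ * fromℕ T                                       ≡⟨ cong (_* fromℕ T) (E*recip C) ⟨
      fromℕ (suc C) * recip C * fromℕ T                  ≡⟨ ℚ.*-assoc (fromℕ (suc C)) (recip C) (fromℕ T) ⟩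
      fromℕ (suc C) * (recip C * fromℕ T)                ≤⟨ *-monoˡ (fromℕ (suc C)) (0≤fromℕ (suc C)) (begin
        recip C * fromℕ T                                  ≤⟨ *-monoˡ (recip C) 0≤r (ℚ.<⇒≤ (T< m)) ⟩
        recip C * (s m + recip m)                          ≡⟨ ℚ.*-distribˡ-+ (recip C) (s m) (recip m) ⟩
        recip C * s m + recip C * recip m                  ≤⟨ ℚ.+-mono-≤ (*-monoʳ (s m) (0≤s m) (r≤c m (ℕ.m≤n⊔m M N))) (recip*recip≤1 m) ⟩
        seq c m * s m + 1ℚ                                 ≤⟨ ℚ.+-monoˡ-≤ 1ℚ (h m (ℕ.m≤m⊔n M N)) ⟩
        fromℕ a + 1ℚ + 1ℚ                                  ≡⟨ ℚ.+-assoc (fromℕ a) 1ℚ 1ℚ ⟩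
        fromℕ a + fromℕ 2                                  ≡⟨ fromℕ-+ a 2 ⟨
        fromℕ (a ℕ.+ 2)                                    ∎) ⟩
      fromℕ (suc C) * fromℕ (a ℕ.+ 2)                    ≡⟨ fromℕ-* (suc C) (a ℕ.+ 2) ⟨
      fromℕ (suc C ℕ.* (a ℕ.+ 2))                        ∎)
      where
      m = M ℕ.⊔ N

-- The two threshold biases.

module Threshold (a : ℕ → ℕ) (0<a : ∀ n → 0 ℕ.< a n) where
  open import Data.Nat using (_*_; _+_; _⊔_; _≤_; _<_)
  open import Defs using (_=Ω_; IsThresholdBias)
  open Asymptotics
  open RealBounds
  open Rational using (recip; recip-antimono)

  left≤ : ∀ {m n k} → m ⊔ n ≤ k → m ≤ k
  left≤ {m} {n} = ℕ.m⊔n≤o⇒m≤o m n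

  right≤ : ∀ {m n k} → m ⊔ n ≤ k → n ≤ k
  right≤ {m} {n} = ℕ.m⊔n≤o⇒n≤o m n

  positive-bias : ∀ {E n V} b {m} → 0 < m → 1 < n → suc E * (m * n) ≤ E * (b * V) → 0 < b
  positive-bias         (suc b) _ _ _ = s≤s z≤n
  positive-bias {E} {n} zero {m} 0<m 1<n h = contradiction (ℕ.≤-trans h (ℕ.≤-reflexive (ℕ.*-zeroʳ E)))
    (ℕ.<⇒≱ (ℕ.≤-trans (ℕ.*-mono-≤ 0<m (ℕ.<⇒≤ 1<n)) (ℕ.m≤n*m (m * n) (suc E))))

  √-bound : ∀ {c : ℝ} {C N} → (∀ m → N ≤ m → recip C ℚ.≤ seq c m) →
            ∀ {n ℓ a} → Harmonic.LogFloor n ℓ → 1 < n → c ℝ.* √[n/ln-n] n ℝ.≤ ℝ.fromℕ a →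
            ∀ T → T * T * (ℓ + 2) ≤ n → T ≤ suc C * (a + 2)
  √-bound {c} {C} {N} r≤c {suc (suc k)} {ℓ} {a} log (s≤s (s≤s _)) h =
    above-√ {c} {C} {N} r≤c {suc (suc k)} {ℓ} {a} log (0<ln k) (recip-antimono {0} {suc k} z≤n)
      (√[n/ln-n] (suc (suc k))) refl h

  threshold : IsThresholdBias a (λ n → (ℝ.fromℕ (a n) ℝ.* ℝ.fromℕ n) ÷ (ℝ.fromℕ (a n) ℝ.+ ln n) [ 0<a+ln n (0<a n) ])
  threshold ε 0<ε = n₁ ⊔ n₂ , λ n n≥ →
    (λ b 0<b h → let (ℓ , log , wins) = proj₂ makerSide n (left≤ n≥)
                 in wins (a n) b (0<a n) 0<b (below-β {ε} {e} {N} r≤ε {n} {ℓ} {a n} log (0<a n) {b} h)) ,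
    (λ b h → let (ℓ , log , 1<n , wins) = proj₂ breakerSide n (right≤ {n₁} n≥)
                 bound                  = above-β {ε} {e} {N} r≤ε {n} {ℓ} {a n} log (0<a n) {b} h
             in wins (a n) b (0<a n) (positive-bias {suc e} b (0<a n) 1<n bound) bound)
    where
    below       = recip-below 0<ε
    e           = proj₁ below
    N           = proj₁ (proj₂ below)
    r≤ε         = proj₂ (proj₂ below)
    makerSide   = makerWins-i e
    breakerSide = breakerWins-i e
    n₁          = proj₁ makerSide
    n₂          = proj₁ breakerSide

  threshold-Ω : (λ n → ℝ.fromℕ (a n)) =Ω √[n/ln-n] → IsThresholdBias a ℝ.fromℕ
  threshold-Ω (c , 0<c , n₀ , a≥) ε 0<ε = n₀ ⊔ n₁ , λ n n≥ →
    (λ b 0<b h → let (ℓ , log , 1<n , wins) = proj₂ makerSide n (right≤ {n₀} n≥)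
                 in wins (a n) b 0<b (√-bound {c} {C} {N′} r≤c {n} {ℓ} {a n} log 1<n (a≥ n (left≤ n≥)))
                      (below-n {ε} {e} {N} r≤ε {b} {n} h)) ,
    (λ b h → let (ℓ , log , 1<n , _) = proj₂ makerSide n (right≤ {n₀} n≥)
                 n≤b                 = above-n {ε} {e} {N} r≤ε {b} {n} h
             in BreakerStrategy.breakerWins-at-once (0<a n) (ℕ.≤-trans (ℕ.<⇒≤ 1<n) n≤b) 1<n n≤b)
    where
    below       = recip-below 0<ε
    e           = proj₁ below
    N           = proj₁ (proj₂ below)
    r≤ε         = proj₂ (proj₂ below)
    below′      = recip-below 0<c
    C           = proj₁ below′
    N′          = proj₁ (proj₂ below′)
    r≤c         = proj₂ (proj₂ below′)
    makerSide   = makerWins-ii e (suc C) (s≤s z≤n)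
    n₁          = proj₁ makerSide

open import Defs using (fromℕ; _+_; _*_; _=o_; _=Ω_; IsThresholdBias)

theorem15 : (a : ℕ → ℕ) (0<a : ∀ n → 0 ℕ.< a n) →
    ((λ n → fromℕ (a n)) =o √[n/ln-n] →
    IsThresholdBias a (λ n → (fromℕ (a n) * fromℕ n) ÷ (fromℕ (a n) + ln n) [ 0<a+ln n (0<a n) ])) ×
    ((λ n → fromℕ (a n)) =Ω √[n/ln-n] →
    IsThresholdBias a fromℕ)
theorem15 a 0<a = (λ _ → threshold) , threshold-Ω
  where open Threshold a 0<a
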